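{- Let $\mathcal P\subset\mathbb{R}^d$ be a rational polytope with denominator $p$, and $\lambda$ an integral form that is generic and positive with respect to $\mathcal P$. Then for any $0\le r<p$ and any integer $k>0$, \[ (-1)^{\dim\mathcal P}\,\chi_{\mathcal P}^{\lambda,r}\!\left(\tfrac1q,\,[-k]_{\frac1q}\right)=\operatorname{ehr}_{\mathcal P^\circ}^\lambda(q,kp-r), \] where $\chi_{\mathcal P}^{\lambda,r}(\tfrac1q,\cdot)$ means substituting $1/q$ for $q$ in the coefficients.
   Context: A rational polytope is the convex hull of finitely many points of $\mathbb{Q}^d$; its denominator is the smallest positive integer $p$ such that $p\mathcal P$ has all vertices in $\mathbb{Z}^d$. $\mathcal P^\circ$ denotes the relative interior of $\mathcal P$. Two vertices are adjacent if they form an edge. An integral form is $\lambda(\mathbf m)=\lambda_1m_1+\dots+\lambda_dm_d$ with $\lambda_j\in\mathbb{Z}$; it is generic and positive w.r.t. $\mathcal P$ if $\lambda(\mathbf v)\ne\lambda(\mathbf w)$ for adjacent vertices and $\lambda(\mathbf v)\ge0$ for all vertices. $[k]_q=\frac{q^k-1}{q-1}$ (for any integer $k$, and with $q$ replaced by $1/q$ in $[\,\cdot\,]_{1/q}$). For a set $S$, $\operatorname{ehr}_{S}^\lambda(q,t)=\sum_{\mathbf m\in tS\cap\mathbb{Z}^d}q^{\lambda(\mathbf m)}$. For $0\le r<p$, $\chi_{\mathcal P}^{\lambda,r}(q,x)\in\mathbb{Q}(q)[x]$ is the (unique) polynomial with $\chi_{\mathcal P}^{\lambda,r}(q,[k]_q)=\operatorname{ehr}_{\mathcal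 P}^\lambda(q,kp+r)$ for all integers $k\ge0$. -}

module Defs where

open import Data.Nat as ℕ using (ℕ; zero; suc)
open import Data.Nat.DivMod using (_%_)
open import Data.Integer as ℤ using (ℤ; +_; -[1+_])
open import Data.Rational as ℚ using (ℚ; 0ℚ; 1ℚ; _/_)
open import Data.List using (List; []; _∷_; reverse; length; replicate; _++_; map; foldr)
open import Data.List.Membership.Propositional using (_∈_)
open import Data.List.Relation.Unary.Unique.Propositional using (Unique)
open import Data.Vec as V using (Vec)
open import Data.Fin using (Fin)
open import Data.Product using (Σ; ∃; _×_; _,_)
open import Function.Bundles using (_⇔_)
open import Relation.Binary.PropositionalEquality using (_≡_; _≢_)
open import Relation.Nullary using (¬_)

-- Polynomials in q over ℚ: coefficient lists, ascending degree.

Poly : Set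
Poly = List ℚ

coeff : Poly → ℕ → ℚ
coeff []      n       = 0ℚ
coeff (a ∷ p) zero    = a
coeff (a ∷ p) (suc n) = coeff p n

-- equality of polynomials (ignores trailing zeros)
_≈P_ : Poly → Poly → Set
p ≈P r = ∀ n → coeff p n ≡ coeff r n

_+P_ : Poly → Poly → Poly
[]      +P r       = r
(a ∷ p) +P []      = a ∷ p
(a ∷ p) +P (b ∷ r) = (a ℚ.+ b) ∷ (p +P r)

_·P_ : ℚ → Poly → Poly
c ·P p = map (c ℚ.*_) p

_*P_ : Poly → Poly → Poly
[]      *P r = []
(a ∷ p) *P r = (a ·P r) +P (0ℚ ∷ (p *P r))

qⁿP : ℕ → Poly
qⁿP n = replicate n 0ℚ ++ (1ℚ ∷ [])

-- q^{length p} · p(1/q)  (a polynomial)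
flipP : Poly → Poly
flipP p = 0ℚ ∷ reverse p

-- The field ℚ(q) of rational functions, as fractions num/den.
-- Equality is by cross-multiplication; this is equality in ℚ(q) as long
-- as the denominators are non-zero polynomials (all denominators built
-- below from ones that are non-zero are non-zero).

record Frac : Set where
  constructor _⁄_
  field
    num : Poly
    den : Poly
open Frac public

NonZeroDen : Frac → Set
NonZeroDen f = ¬ (den f ≈P [])

_≈F_ : Frac → Frac → Set
f ≈F g = (num f *P den g) ≈P (num g *P den f)

constF : ℚ → Frac
constF c = (c ∷ []) ⁄ (1ℚ ∷ [])

0F 1F : Frac
0F = constF 0ℚ
1F = constF 1ℚ

_+F_ : Frac → Frac → Frac
(a ⁄ b) +F (c ⁄ d) = ((a *P d) +P (c *P b)) ⁄ (b *P d)

_*F_ : Frac → Frac → Frac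
(a ⁄ b) *F (c ⁄ d) = (a *P c) ⁄ (b *P d)

-F_ : Frac → Frac
-F (a ⁄ b) = ((ℚ.- 1ℚ) ·P a) ⁄ b

_-F_ : Frac → Frac → Frac
f -F g = f +F (-F g)

-- division (only used with non-zero divisors)
_÷F_ : Frac → Frac → Frac
(a ⁄ b) ÷F (c ⁄ d) = (a *P d) ⁄ (b *P c)

qpow : ℤ → Frac
qpow (+ n)     = qⁿP n ⁄ (1ℚ ∷ [])
qpow -[1+ n ]  = (1ℚ ∷ []) ⁄ qⁿP (suc n)

qMinus1 : Frac
qMinus1 = ((ℚ.- 1ℚ) ∷ 1ℚ ∷ []) ⁄ (1ℚ ∷ [])

[_]q : ℤ → Frac
[ z ]q = (qpow z -F 1F) ÷F qMinus1

-- substitution q ↦ 1/q in a rational function: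
-- N(1/q)/D(1/q) = (q^{|N|} N(1/q)) q^{|D|} / ((q^{|D|} D(1/q)) q^{|N|})
inv-q : Frac → Frac
inv-q (a ⁄ b) = (flipP a *P qⁿP (length b)) ⁄ (flipP b *P qⁿP (length a))

-- polynomials in x with coefficients in ℚ(q): ascending coefficient lists
PolyX : Set
PolyX = List Frac

evalX : PolyX → Frac → Frac
evalX []      x = 0F
evalX (c ∷ χ) x = c +F (x *F evalX χ x)

inv-qX : PolyX → PolyX
inv-qX = map inv-q

signF : ℤ → Frac
signF z with ℤ.∣ z ∣ % 2
... | zero = 1F
... | _    = -F 1F

Pt : ℕ → Set
Pt d = Vec ℚ d

Lat : ℕ → Set
Lat d = Vec ℤ d

embed : ∀ {d} → Lat d → Pt d
embed = V.map (λ z → z / 1)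

_•_ : ∀ {d} → ℚ → Pt d → Pt d
t • x = V.map (t ℚ.*_) x

_⊕_ : ∀ {d} → Pt d → Pt d → Pt d
x ⊕ y = V.zipWith ℚ._+_ x y

dot : ∀ {d} → Pt d → Pt d → ℚ
dot x y = V.foldr _ ℚ._+_ 0ℚ (V.zipWith ℚ._*_ x y)

sumQ : ∀ {n} → Vec ℚ n → ℚ
sumQ = V.foldr _ ℚ._+_ 0ℚ

combo : ∀ {d n} → Vec ℚ n → Vec (Pt d) n → Pt d
combo μ ps = V.foldr _ _⊕_ (V.replicate _ 0ℚ) (V.zipWith _•_ μ ps)

ℕtoℚ : ℕ → ℚ
ℕtoℚ n = (+ n) / 1

PSet : ℕ → Set₁
PSet d = Pt d → Set

Conv : ∀ {d n} → Vec (Pt d) n → PSet d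
Conv {n = n} gs x =
  Σ (Vec ℚ n) λ μ → (∀ i → 0ℚ ℚ.≤ V.lookup μ i) × (sumQ μ ≡ 1ℚ) × (combo μ gs ≡ x)

Dil : ∀ {d} → ℕ → PSet d → PSet d
Dil t S x = Σ (Pt _) λ y → S y × (x ≡ ℕtoℚ t • y)

AffHull : ∀ {d} → PSet d → PSet d
AffHull {d} S y =
  Σ ℕ λ n → Σ (Vec (Pt d) n) λ ps → Σ (Vec ℚ n) λ μ →
    (∀ i → S (V.lookup ps i)) × (sumQ μ ≡ 1ℚ) × (combo μ ps ≡ y)

RelInt : ∀ {d} → PSet d → PSet d
RelInt S x = S x × Σ ℚ λ ε → (0ℚ ℚ.< ε) ×
  (∀ y → AffHull S y → (∀ i → ℚ.∣ V.lookup x i ℚ.- V.lookup y i ∣ ℚ.< ε) → S y)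

AffIndep : ∀ {d n} → Vec (Pt d) n → Set
AffIndep {d} {n} ps = ∀ (μ : Vec ℚ n) → sumQ μ ≡ 0ℚ →
  combo μ ps ≡ V.replicate d 0ℚ → ∀ i → V.lookup μ i ≡ 0ℚ

-- S has dimension δ: the maximal number of affinely independent points of S is n,
-- and δ = n - 1 (so the empty set has dimension -1)
HasDim : ∀ {d} → PSet d → ℤ → Set
HasDim {d} S δ = Σ ℕ λ n → (δ ≡ (+ n) ℤ.- (+ 1)) ×
  (Σ (Vec (Pt d) n) λ ps → (∀ i → S (V.lookup ps i)) × AffIndep ps) ×
  (∀ m (ps : Vec (Pt d) m) → (∀ i → S (V.lookup ps i)) → AffIndep ps → m ℕ.≤ n)

Vertex : ∀ {d} → PSet d → Pt d → Set
Vertex S v = S v × (∀ x y t → S x → S y → 0ℚ ℚ.< t → t ℚ.< 1ℚ →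
  v ≡ (t • x) ⊕ ((1ℚ ℚ.- t) • y) → x ≡ y)

Seg : ∀ {d} → Pt d → Pt d → PSet d
Seg v w x = Σ ℚ λ t → (0ℚ ℚ.≤ t) × (t ℚ.≤ 1ℚ) × (x ≡ (t • v) ⊕ ((1ℚ ℚ.- t) • w))

-- v, w adjacent: distinct vertices such that [v,w] is a face (an edge),
-- i.e. the set of maximisers in S of some linear functional c
Adjacent : ∀ {d} → PSet d → Pt d → Pt d → Set
Adjacent S v w = Vertex S v × Vertex S w × (v ≢ w) ×
  Σ (Pt _) λ c → (∀ x → S x → (dot c x ℚ.≤ dot c v)) ×
    (∀ x → S x → dot c x ≡ dot c v → Seg v w x) × (dot c w ≡ dot c v)

IsIntegral : ∀ {d} → Pt d → Set
IsIntegral x = Σ (Lat _) λ m → embed m ≡ x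

IsDenominator : ∀ {d} → PSet d → ℕ → Set
IsDenominator S p = (0 ℕ.< p) × (∀ v → Vertex S v → IsIntegral (ℕtoℚ p • v)) ×
  (∀ p' → 0 ℕ.< p' → (∀ v → Vertex S v → IsIntegral (ℕtoℚ p' • v)) → p ℕ.≤ p')

Form : ℕ → Set
Form d = Vec ℤ d

evalForm : ∀ {d} → Form d → Pt d → ℚ
evalForm λf x = dot (embed λf) x

evalFormℤ : ∀ {d} → Form d → Lat d → ℤ
evalFormℤ λf m = V.foldr _ ℤ._+_ (+ 0) (V.zipWith ℤ._*_ λf m)

GenericPositive : ∀ {d} → Form d → PSet d → Set
GenericPositive λf S =
  (∀ v w → Adjacent S v w → evalForm λf v ≢ evalForm λf w) ×
  (∀ v → Vertex S v → 0ℚ ℚ.≤ evalForm λf v)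

Enumerates : ∀ {d} → List (Lat d) → PSet d → Set
Enumerates L S = Unique L × (∀ m → (m ∈ L) ⇔ S (embed m))

ehrSum : ∀ {d} → Form d → List (Lat d) → Frac
ehrSum λf []      = 0F
ehrSum λf (m ∷ L) = qpow (evalFormℤ λf m) +F ehrSum λf L

-- χ is the quasi-polynomial constituent χ^{λ,r}_P: ehr_P^λ(q, kp+r) = χ(q,[k]_q) for all k ≥ 0
IsChi : ∀ {d} → PSet d → Form d → ℕ → ℕ → PolyX → Set
IsChi P λf p r χ = (∀ c → c ∈ χ → NonZeroDen c) ×
  (∀ (k : ℕ) (L : List (Lat _)) → Enumerates L (Dil (k ℕ.* p ℕ.+ r) P) →
     evalX χ [ + k ]q ≈F ehrSum λf L)

{-# OPTIONS --safe #-}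
-- Let C be the cone over P = conv(g₁, …, gₙ), generated by the vectors uᵢ = (1, gᵢ), let C° be its relative
-- interior and Φ = [C] - (-1)^(dim C) [-C°]. The key fact is that ∏ᵢ (1 - T_{N uᵢ}) kills the function Φ
-- identically, T_v being translation by v. This goes by adding one generator u at a time. If C′ = C + ℝ≥0 u, then
-- [C′] and [-C′°] are, up to the right signs, integrals of [C] and [-C°] along the lines in direction u with
-- respect to the Euler characteristic: a fibre of the closed cone is a closed interval of mass 1, and one of the
-- open cone is an open interval of mass -1 if u lies in the span of C and a point of mass 1 otherwise. Hence
-- (1 - T_{Nu}) Φ′ is the integral of Φ(x - s u) over 0 ≤ s < N. The inequalities for C and C° come together from
-- Gaussian and Fourier-Motzkin elimination.
--
-- Choose N to be a multiple of p clearing the denominators of the gᵢ, specialise q to a number w and sum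
-- w^λ(m) Φ(t, m) over m ∈ ℤᵈ for t = kp + r. The result is a sequence in k ∈ ℤ satisfying a linear recurrence; it
-- is ehr_P(w, kp + r) for k > 0 and (up to sign) ehr_P°(1/w, -kp - r) for k < 0. The sequence χ(w, [k]_w) also
-- satisfies a linear recurrence and agrees with it for k > 0, hence everywhere. As this holds for all large
-- integers w, the identity holds in ℚ(q).
module Submission where

open import Defs
open import Level using (0ℓ)
open import Function using (_∘_)
open import Function.Bundles using (_⇔_; mk⇔; module Equivalence)
open Equivalence using (to; from)
open import Data.Bool using (Bool; true; false; if_then_else_)
open import Data.Product using (Σ; ∃; ∃₂; _×_; _,_; proj₁; proj₂)
open import Data.Sum using (_⊎_; inj₁; inj₂)
open import Data.Nat as ℕ using (ℕ; zero; suc)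
import Data.Nat.Properties as ℕₚ
open import Data.Nat.DivMod using (_%_)
open import Data.Integer as ℤ using (ℤ; -[1+_])
import Data.Integer.Properties as ℤₚ
open import Data.Rational as ℚ using (ℚ; 0ℚ; 1ℚ; _/_)
import Data.Rational.Properties as ℚₚ
open import Data.Fin using (Fin; zero; suc)
open import Data.Vec as V using (Vec; []; _∷_; lookup)
import Data.Vec.Properties as Vₚ
open import Data.List as List using (List; []; _∷_; _++_; map; length; reverse; upTo; cartesianProductWith; deduplicate; filter)
import Data.List.Properties as Listₚ
open import Data.List.Relation.Unary.All as All using (All; []; _∷_)
import Data.List.Relation.Unary.All.Properties as Allₚ
open import Data.List.Relation.Unary.Any using (here; there)
open import Data.List.Relation.Unary.Unique.Propositional using (Unique; []; _∷_)
import Data.List.Relation.Unary.Unique.Propositional.Properties as Uniqueₚ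
import Data.List.Relation.Unary.Unique.DecPropositional.Properties as DecUniqueₚ
open import Data.List.Membership.Propositional using (_∈_; find)
open import Data.List.Membership.Propositional.Properties
open import Relation.Nullary using (¬_; Dec; yes; no; _×-dec_; does)
open import Relation.Nullary.Decidable using (dec⇒maybe; does-⇔)
open import Relation.Nullary.Negation using (contradiction)
open import Relation.Binary.Definitions using (tri<; tri≈; tri>)
open import Relation.Binary.PropositionalEquality
open import Tactic.RingSolver using (solve-∀)
open import Tactic.RingSolver.Core.AlmostCommutativeRing using (AlmostCommutativeRing; fromCommutativeRing)
import Data.Integer.Tactic.RingSolver as ℤSolver
import Data.Nat.Coprimality as Coprimality
import Data.List.Relation.Unary.Any.Properties as Anyₚ
import Data.Rational.Unnormalised as ℚᵘ

-- By Stanley's reciprocity the generating functions of C and -C° are, up to sign, expansions of one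
-- rational function in opposite directions. That the product of the operators 1 - T kills Φ is this
-- statement with denominators cleared: an identity of functions on the whole space, open to
-- induction on the generators without a triangulation.
--
-- The obstacle in the induction is that C may contain the ray along u, so that a line in direction
-- u can meet it in an unbounded set. The lines are therefore cut at s = 0, with C integrated on one
-- side and -C° on the other; both pieces are bounded because every generator has positive first
-- coordinate.
--
-- Passing from k > 0 to k < 0 means solving a recurrence backwards, so its coefficients have to be
-- inverted. They are products of powers of q, and a number w in place of q keeps this computation
-- in ℚ; large w avoid the poles of the coefficients of χ. Since the theorem substitutes 1/q, its
-- two sides are compared at the points 1/w.

module Reciprocity where
  open import Data.Rational using (_+_; _*_; _-_; -_; _≤_; _<_; ∣_∣)

  -- Order and inverses in the rational numbers

  ℚ-ring : AlmostCommutativeRing 0ℓ 0ℓ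
  ℚ-ring = fromCommutativeRing ℚₚ.+-*-commutativeRing (λ x → dec⇒maybe (0ℚ ℚₚ.≟ x))

  -- The Boolean lets each argument about inequalities be made once for the closed cone (`false`)
  -- and its relative interior (`true`).
  _≺[_]_ : ℚ → Bool → ℚ → Set
  x ≺[ false ] y = x ≤ y
  x ≺[ true ] y = x < y

  _≺?[_]_ : ∀ x b y → Dec (x ≺[ b ] y)
  x ≺?[ false ] y = x ℚₚ.≤? y
  x ≺?[ true ] y = x ℚₚ.<? y

  <⇒≺ : ∀ b {x y} → x < y → x ≺[ b ] y
  <⇒≺ false = ℚₚ.<⇒≤
  <⇒≺ true p = p

  ≺⇒≤ : ∀ b {x y} → x ≺[ b ] y → x ≤ y
  ≺⇒≤ false p = p
  ≺⇒≤ true = ℚₚ.<⇒≤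

  ≤-≺-trans : ∀ b {x y z} → x ≤ y → y ≺[ b ] z → x ≺[ b ] z
  ≤-≺-trans false = ℚₚ.≤-trans
  ≤-≺-trans true = ℚₚ.≤-<-trans

  ≺-≤-trans : ∀ b {x y z} → x ≺[ b ] y → y ≤ z → x ≺[ b ] z
  ≺-≤-trans false = ℚₚ.≤-trans
  ≺-≤-trans true = ℚₚ.<-≤-trans

  ≺-trans : ∀ b {x y z} → x ≺[ b ] y → y ≺[ b ] z → x ≺[ b ] z
  ≺-trans b p q = ≤-≺-trans b (≺⇒≤ b p) q

  ≺-≢⇒< : ∀ b {x y} → x ≺[ b ] y → x ≢ y → x < y
  ≺-≢⇒< true p _ = p
  ≺-≢⇒< false {x} {y} p n with ℚₚ.<-cmp x y
  ... | tri< q _ _ = q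
  ... | tri≈ _ q _ = contradiction q n
  ... | tri> _ _ q = contradiction (ℚₚ.<-≤-trans q p) (ℚₚ.<-irrefl refl)

  ≺-translate : ∀ b {x y} c → x ≺[ b ] y → (x + c) ≺[ b ] (y + c)
  ≺-translate false c = ℚₚ.+-monoˡ-≤ c
  ≺-translate true c = ℚₚ.+-monoˡ-< c

  -- An inequality depends only on the difference of its sides, so every rearrangement reduces to a
  -- ring identity.
  ≺-shift : ∀ b {u v x y} → v - u ≡ y - x → u ≺[ b ] v → x ≺[ b ] y
  ≺-shift b {u} {v} {x} {y} e p = subst₂ (λ s t → s ≺[ b ] t) (l u x) (trans (r v u x) (trans (cong (_+ x) e) (r' y x))) (≺-translate b (x - u) p)
    where
    l : ∀ u x → u + (x - u) ≡ x
    l = solve-∀ ℚ-ring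
    r : ∀ v u x → v + (x - u) ≡ (v - u) + x
    r = solve-∀ ℚ-ring
    r' : ∀ y x → y - x + x ≡ y
    r' = solve-∀ ℚ-ring

  ≺-scale : ∀ b {x y} c → 0ℚ < c → x ≺[ b ] y → (c * x) ≺[ b ] (c * y)
  ≺-scale false c 0<c = ℚₚ.*-monoˡ-≤-nonNeg c {{ℚₚ.pos⇒nonNeg c {{ℚ.positive 0<c}}}}
  ≺-scale true c 0<c = ℚₚ.*-monoʳ-<-pos c {{ℚ.positive 0<c}}

  0≺-* : ∀ b {x} c → 0ℚ < c → 0ℚ ≺[ b ] x → 0ℚ ≺[ b ] (c * x)
  0≺-* b {x} c 0<c p = subst (λ s → s ≺[ b ] (c * x)) (ℚₚ.*-zeroʳ c) (≺-scale b c 0<c p)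

  0≤-* : ∀ {x y} → 0ℚ ≤ x → 0ℚ ≤ y → 0ℚ ≤ x * y
  0≤-* {x} {y} p q = subst (_≤ x * y) (ℚₚ.*-zeroʳ x) (ℚₚ.*-monoˡ-≤-nonNeg x {{ℚ.nonNegative p}} q)

  0≺-+ : ∀ b {x y} → 0ℚ ≺[ b ] x → 0ℚ ≤ y → 0ℚ ≺[ b ] (x + y)
  0≺-+ b {x} {y} p q = ≺-≤-trans b p (subst (_≤ x + y) (ℚₚ.+-identityʳ x) (ℚₚ.+-monoʳ-≤ x q))

  0≤1 : 0ℚ ≤ 1ℚ
  0≤1 = ℚₚ.nonNegative⁻¹ 1ℚ

  0<1 : 0ℚ < 1ℚ
  0<1 = ℚₚ.positive⁻¹ 1ℚ

  1≢0 : 1ℚ ≢ 0ℚ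
  1≢0 ()

  inverse : ∀ c → c ≢ 0ℚ → ∃ λ c⁻¹ → c⁻¹ * c ≡ 1ℚ
  inverse c c≢0 = ℚ.1/_ c {{nz}} , ℚₚ.*-inverseˡ c {{nz}}
    where nz = ℚ.≢-nonZero c≢0

  inverse-pos : ∀ {c c⁻¹} → c⁻¹ * c ≡ 1ℚ → 0ℚ < c → 0ℚ < c⁻¹
  inverse-pos {c} {c⁻¹} e 0<c with ℚₚ.<-cmp 0ℚ c⁻¹
  ... | tri< p _ _ = p
  ... | tri≈ _ p _ = contradiction (trans (sym e) (trans (cong (_* c) (sym p)) (ℚₚ.*-zeroˡ c))) 1≢0
  ... | tri> _ _ p = contradiction (subst₂ _<_ e (ℚₚ.*-zeroˡ c) (ℚₚ.*-monoˡ-<-pos c {{ℚ.positive 0<c}} p)) (ℚₚ.<-asym 0<1)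

  pos-inverse : ∀ {c} → 0ℚ < c → ∃ λ c⁻¹ → 0ℚ < c⁻¹ × c⁻¹ * c ≡ 1ℚ
  pos-inverse {c} p with inverse c (λ e → ℚₚ.<-irrefl (sym e) p)
  ... | c⁻¹ , e = c⁻¹ , inverse-pos e p , e

  *-cancel-zero : ∀ {x y} → x ≢ 0ℚ → x * y ≡ 0ℚ → y ≡ 0ℚ
  *-cancel-zero {x} {y} x≢0 e with inverse x x≢0
  ... | z , zx = begin
    y           ≡⟨ ℚₚ.*-identityˡ y ⟨
    1ℚ * y      ≡⟨ cong (_* y) zx ⟨
    z * x * y   ≡⟨ ℚₚ.*-assoc z x y ⟩
    z * (x * y) ≡⟨ cong (z *_) e ⟩
    z * 0ℚ      ≡⟨ ℚₚ.*-zeroʳ z ⟩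
    0ℚ          ∎
    where open ≡-Reasoning

  *-nonzero : ∀ {x y} → x ≢ 0ℚ → y ≢ 0ℚ → x * y ≢ 0ℚ
  *-nonzero p q e = q (*-cancel-zero p e)

  difference-zero : ∀ x y → x - y ≡ 0ℚ → x ≡ y
  difference-zero x y e = trans (l x y) (trans (cong (_+ y) e) (ℚₚ.+-identityˡ y))
    where
    l : ∀ x y → x ≡ x - y + y
    l = solve-∀ ℚ-ring

  indicator : ∀ {A : Set} → Dec A → ℚ
  indicator d = if does d then 1ℚ else 0ℚ

  indicator-⇔ : ∀ {A B : Set} (a : Dec A) (b : Dec B) → A ⇔ B → indicator a ≡ indicator b
  indicator-⇔ a b e = cong (if_then 1ℚ else 0ℚ) (does-⇔ e a b)

  indicator-yes : ∀ {A : Set} (a : Dec A) → A → indicator a ≡ 1ℚ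
  indicator-yes (yes _) _ = refl
  indicator-yes (no n) p = contradiction p n

  indicator-no : ∀ {A : Set} (a : Dec A) → ¬ A → indicator a ≡ 0ℚ
  indicator-no (yes p) n = contradiction p n
  indicator-no (no _) _ = refl

  indicator-× : ∀ {A B : Set} (a : Dec A) (b : Dec B) → indicator (a ×-dec b) ≡ indicator a * indicator b
  indicator-× (yes _) (yes _) = refl
  indicator-× (yes _) (no _) = refl
  indicator-× (no _) (yes _) = refl
  indicator-× (no _) (no _) = refl

  indicator-¬ : ∀ {A B : Set} (a : Dec A) (b : Dec B) → (A → ¬ B) → (¬ A → B) → indicator b ≡ 1ℚ - indicator a
  indicator-¬ (yes p) b f g = indicator-no b (f p)
  indicator-¬ (no p) b f g = indicator-yes b (g p)

  -- The Euler characteristic integral in one variable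

  sumOver : ∀ {A : Set} → (A → ℚ) → List A → ℚ
  sumOver f [] = 0ℚ
  sumOver f (x ∷ xs) = f x + sumOver f xs

  sumOver-cong : ∀ {A : Set} {f g : A → ℚ} xs → (∀ {x} → x ∈ xs → f x ≡ g x) → sumOver f xs ≡ sumOver g xs
  sumOver-cong [] h = refl
  sumOver-cong (x ∷ xs) h = cong₂ _+_ (h (here refl)) (sumOver-cong xs (h ∘ there))

  sumOver-+ : ∀ {A : Set} (f g : A → ℚ) xs → sumOver (λ x → f x + g x) xs ≡ sumOver f xs + sumOver g xs
  sumOver-+ f g [] = refl
  sumOver-+ f g (x ∷ xs) = trans (cong (f x + g x +_) (sumOver-+ f g xs)) (l (f x) (g x) (sumOver f xs) (sumOver g xs))
    where
    l : ∀ a b s t → (a + b) + (s + t) ≡ (a + s) + (b + t)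
    l = solve-∀ ℚ-ring

  sumOver-* : ∀ {A : Set} c (f : A → ℚ) xs → sumOver (λ x → c * f x) xs ≡ c * sumOver f xs
  sumOver-* c f [] = sym (ℚₚ.*-zeroʳ c)
  sumOver-* c f (x ∷ xs) = trans (cong (c * f x +_) (sumOver-* c f xs)) (sym (ℚₚ.*-distribˡ-+ c (f x) (sumOver f xs)))

  sumOver-zero : ∀ {A : Set} {f : A → ℚ} xs → (∀ {x} → x ∈ xs → f x ≡ 0ℚ) → sumOver f xs ≡ 0ℚ
  sumOver-zero [] h = refl
  sumOver-zero (x ∷ xs) h = trans (cong₂ _+_ (h (here refl)) (sumOver-zero xs (h ∘ there))) (ℚₚ.+-identityˡ 0ℚ)

  sumOver-single : ∀ {A : Set} {f : A → ℚ} {xs a} → Unique xs → a ∈ xs →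
    (∀ {x} → x ∈ xs → x ≢ a → f x ≡ 0ℚ) → sumOver f xs ≡ f a
  sumOver-single {f = f} {x ∷ xs} (n ∷ u) (here refl) h =
    trans (cong (f x +_) (sumOver-zero xs λ m → h (there m) (λ e → All.lookup n m (sym e)))) (ℚₚ.+-identityʳ _)
  sumOver-single {f = f} {x ∷ xs} {a} (n ∷ u) (there m) h =
    trans (cong (_+ sumOver f xs) (h (here refl) (λ e → All.lookup n m e)))
    (trans (ℚₚ.+-identityˡ _) (sumOver-single u m (h ∘ there)))

  positive-lower-bound : ∀ (xs : List ℚ) → ∃ λ ε → 0ℚ < ε × (∀ {x} → x ∈ xs → 0ℚ < x → ε < x)
  positive-lower-bound [] = 1ℚ , 0<1 , λ ()
  positive-lower-bound (x ∷ xs) with positive-lower-bound xs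
  ... | ε , 0<ε , h with x ℚₚ.≤? ε | 0ℚ ℚₚ.<? x
  ... | no x≰ε | _ = ε , 0<ε , λ { (here refl) _ → ℚₚ.≰⇒> x≰ε ; (there m) p → h m p }
  ... | yes _ | no ¬0<x = ε , 0<ε , λ { (here refl) p → contradiction p ¬0<x ; (there m) p → h m p }
  ... | yes x≤ε | yes 0<x with ℚₚ.<-dense 0<x
  ... | y , 0<y , y<x = y , 0<y , λ { (here refl) _ → y<x ; (there m) p → ℚₚ.<-trans (ℚₚ.<-≤-trans y<x x≤ε) (h m p) }

  -- Since `ε` is smaller than every gap between nodes, the value at `x + ε` stands in for the
  -- right-hand limit at `x`.
  record Mesh (points : List ℚ) : Set where
    field
      nodes : List ℚ
      unique : Unique nodes
      ε : ℚ
      0<ε : 0ℚ < ε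
      gap : ∀ {x y} → x ∈ nodes → y ∈ nodes → x < y → (x + ε) < y
      covers : ∀ {x} → x ∈ points → x ∈ nodes

  mesh : ∀ points → Mesh points
  mesh points = record
    { nodes = nodes
    ; unique = DecUniqueₚ.deduplicate-! ℚₚ._≟_ points
    ; ε = proj₁ lower
    ; 0<ε = proj₁ (proj₂ lower)
    ; gap = λ {x} {y} x∈ y∈ x<y → ≺-shift true (l x y (proj₁ lower))
        (proj₂ (proj₂ lower) (∈-cartesianProductWith⁺ _-_ y∈ x∈) (≺-shift true (r x y) x<y))
    ; covers = ∈-deduplicate⁺ ℚₚ._≟_
    }
    where
    nodes = deduplicate ℚₚ._≟_ points
    lower = positive-lower-bound (cartesianProductWith _-_ nodes nodes)
    l : ∀ x y e → y - x - e ≡ y - (x + e)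
    l = solve-∀ ℚ-ring
    r : ∀ x y → y - x ≡ (y - x) - 0ℚ
    r = solve-∀ ℚ-ring

  restrict : ∀ {ps qs} → (∀ {x} → x ∈ ps → x ∈ qs) → Mesh qs → Mesh ps
  restrict h M = record { Mesh M ; covers = λ m → Mesh.covers M (h m) }

  -- Each point carries the jump f(x) - f(x+) of f there, so closed intervals have mass 1 and open ones mass -1.
  jumpSum : ∀ {ps} → Mesh ps → (ℚ → ℚ) → ℚ
  jumpSum M f = sumOver (λ x → f x - f (x + Mesh.ε M)) (Mesh.nodes M)

  -- Quantifying over all meshes that contain the breakpoints allows two integrals to be computed on
  -- a common mesh, where linearity is termwise.
  record ∫_≐_ (f : ℚ → ℚ) (v : ℚ) : Set where
    constructor byJumps
    field
      breakpoints : List ℚ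
      jumps : ∀ (M : Mesh breakpoints) → jumpSum M f ≡ v

  jumpSum-+ : ∀ {ps} (M : Mesh ps) f g → jumpSum M (λ s → f s + g s) ≡ jumpSum M f + jumpSum M g
  jumpSum-+ M f g = trans (sumOver-cong (Mesh.nodes M) (λ {x} _ → l (f x) (g x) (f (x + Mesh.ε M)) (g (x + Mesh.ε M)))) (sumOver-+ _ _ (Mesh.nodes M))
    where
    l : ∀ a b c d → a + b - (c + d) ≡ (a - c) + (b - d)
    l = solve-∀ ℚ-ring

  ∫-+ : ∀ {f g v w} → ∫ f ≐ v → ∫ g ≐ w → ∫ (λ s → f s + g s) ≐ (v + w)
  ∫-+ {f} {g} (byJumps ps F) (byJumps qs G) = byJumps (ps ++ qs) λ M → trans (jumpSum-+ M f g)
    (cong₂ _+_ (F (restrict ∈-++⁺ˡ M)) (G (restrict (∈-++⁺ʳ ps) M)))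

  ∫-* : ∀ {f v} c → ∫ f ≐ v → ∫ (λ s → c * f s) ≐ (c * v)
  ∫-* {f} c (byJumps ps F) = byJumps ps λ M → trans
    (trans (sumOver-cong (Mesh.nodes M) (λ {x} _ → l c (f x) (f (x + Mesh.ε M)))) (sumOver-* c _ (Mesh.nodes M)))
    (cong (c *_) (F M))
    where
    l : ∀ c a b → c * a - c * b ≡ c * (a - b)
    l = solve-∀ ℚ-ring

  ∫-cong : ∀ {f g v w} → (∀ s → f s ≡ g s) → v ≡ w → ∫ f ≐ v → ∫ g ≐ w
  ∫-cong h refl (byJumps ps F) = byJumps ps λ M → trans (sumOver-cong (Mesh.nodes M) (λ {x} _ → cong₂ _-_ (sym (h x)) (sym (h (x + Mesh.ε M))))) (F M)

  ∫-- : ∀ {f g v w} → ∫ f ≐ v → ∫ g ≐ w → ∫ (λ s → f s - g s) ≐ (v - w)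
  ∫-- {f} {g} {v} {w} F G = ∫-cong (λ s → l (f s) (g s)) (l v w) (∫-+ {f} {λ s → - 1ℚ * g s} F (∫-* {g} (- 1ℚ) G))
    where
    l : ∀ a b → a + - 1ℚ * b ≡ a - b
    l = solve-∀ ℚ-ring

  -- Every list of breakpoints has a mesh, so the value is forced by the jumps on it, all of which
  -- vanish.
  ∫-zero : ∀ {f v} → (∀ s → f s ≡ 0ℚ) → ∫ f ≐ v → v ≡ 0ℚ
  ∫-zero h (byJumps ps F) = trans (sym (F (mesh ps))) (sumOver-zero nodes (λ {x} _ → cong₂ _-_ (h x) (h (x + ε))))
    where open Mesh (mesh ps)

  -- `Q` is the condition for the fibre `P` to be nonempty. In the open case `x < y` rules out the
  -- empty interval, whose mass would be 0 and not -1.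
  IsInterval : Bool → (ℚ → Set) → Set → Set
  IsInterval b P Q = (∀ s → P s → Q) × (Q → ∃₂ λ x y → x ≺[ b ] y × (∀ s → P s ⇔ (x ≺[ b ] s × s ≺[ b ] y)))

  IsInterval-translate : ∀ b {P Q} c → IsInterval b P Q → IsInterval b (λ s → P (s - c)) Q
  IsInterval-translate b c (f , g) = (λ s → f (s - c)) , λ q → go (g q)
    where
    l : ∀ s c x → s - c - x ≡ s - (x + c)
    l = solve-∀ ℚ-ring
    r : ∀ s c y → y - (s - c) ≡ y + c - s
    r = solve-∀ ℚ-ring
    go : _ → _
    go (x , y , x≺y , h) = x + c , y + c , ≺-translate b c x≺y , λ s → mk⇔
      (λ p → let (u , v) = to (h (s - c)) p in ≺-shift b (l s c x) u , ≺-shift b (r s c y) v)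
      (λ (u , v) → from (h (s - c)) (≺-shift b (sym (l s c x)) u , ≺-shift b (sym (r s c y)) v))

  IsInterval-negate : ∀ b {P Q} → IsInterval b P Q → IsInterval b (λ s → P (- s)) Q
  IsInterval-negate b (f , g) = (λ s → f (- s)) , λ q → go (g q)
    where
    l : ∀ x y → y - x ≡ - x - - y
    l = solve-∀ ℚ-ring
    l₁ : ∀ s x → - s - x ≡ - x - s
    l₁ = solve-∀ ℚ-ring
    l₂ : ∀ s y → y - - s ≡ s - - y
    l₂ = solve-∀ ℚ-ring
    go : _ → _
    go (x , y , x≺y , h) = - y , - x , ≺-shift b (l x y) x≺y , λ s → mk⇔
      (λ p → let (u , v) = to (h (- s)) p in ≺-shift b (l₂ s y) v , ≺-shift b (l₁ s x) u)
      (λ (u , v) → from (h (- s)) (≺-shift b (sym (l₁ s x)) v , ≺-shift b (sym (l₂ s y)) u))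

  mass : Bool → ℚ
  mass false = 1ℚ
  mass true = - 1ℚ

  module _ {x y : ℚ} {P : ℚ → Set} (P? : ∀ s → Dec (P s)) (M : Mesh (x ∷ y ∷ [])) where
    open Mesh M

    private
      x∈ : x ∈ nodes
      x∈ = covers (here refl)

      y∈ : y ∈ nodes
      y∈ = covers (there (here refl))

      up : ∀ s → s < s + ε
      up s = ≺-shift true (l s ε) 0<ε
        where
        l : ∀ s e → e - 0ℚ ≡ s + e - s
        l = solve-∀ ℚ-ring

      jump : ℚ → ℚ
      jump s = indicator (P? s) - indicator (P? (s + ε))

      no-jump-inside : ∀ s → P s → P (s + ε) → jump s ≡ 0ℚ
      no-jump-inside s p q = cong₂ _-_ (indicator-yes (P? s) p) (indicator-yes (P? (s + ε)) q)

      no-jump-outside : ∀ s → ¬ P s → ¬ P (s + ε) → jump s ≡ 0ℚ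
      no-jump-outside s p q = cong₂ _-_ (indicator-no (P? s) p) (indicator-no (P? (s + ε)) q)

    -- Only `y` carries a jump. The function has already risen at `x` itself, and nodes before `x`
    -- look no further than `s + ε < x`.
    jumpSum-closed : x ≤ y → (∀ s → P s ⇔ (x ≤ s × s ≤ y)) → jumpSum M (λ s → indicator (P? s)) ≡ 1ℚ
    jumpSum-closed x≤y h = trans (sumOver-single unique y∈ other)
      (cong₂ _-_ (indicator-yes (P? y) (from (h y) (x≤y , ℚₚ.≤-refl)))
                 (indicator-no (P? (y + ε)) (above (up y))))
      where
      above : ∀ {s} → y < s → ¬ P s
      above y<s p = ℚₚ.<-irrefl refl (ℚₚ.<-≤-trans y<s (proj₂ (to (h _) p)))
      below : ∀ {s} → s < x → ¬ P s
      below s<x p = ℚₚ.<-irrefl refl (ℚₚ.<-≤-trans s<x (proj₁ (to (h _) p)))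
      other : ∀ {s} → s ∈ nodes → s ≢ y → jump s ≡ 0ℚ
      other {s} s∈ s≢y with ℚₚ.<-cmp s y
      ... | tri≈ _ e _ = contradiction e s≢y
      ... | tri> _ _ y<s = no-jump-outside s (above y<s) (above (ℚₚ.<-trans y<s (up s)))
      ... | tri< s<y _ _ with s ℚₚ.<? x
      ... | yes s<x = no-jump-outside s (below s<x) (below (gap s∈ x∈ s<x))
      ... | no s≮x = no-jump-inside s (from (h s) (x≤s , ℚₚ.<⇒≤ s<y))
        (from (h (s + ε)) (ℚₚ.≤-trans x≤s (ℚₚ.<⇒≤ (up s)) , ℚₚ.<⇒≤ (gap s∈ y∈ s<y)))
        where x≤s = ℚₚ.≮⇒≥ s≮x

    -- Only `x` carries a jump, from 0 to 1 and so of value -1. At `y` the function has already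
    -- dropped, and nodes before `y` do not reach it.
    jumpSum-open : x < y → (∀ s → P s ⇔ (x < s × s < y)) → jumpSum M (λ s → indicator (P? s)) ≡ - 1ℚ
    jumpSum-open x<y h = trans (sumOver-single unique x∈ other)
      (cong₂ _-_ (indicator-no (P? x) (below ℚₚ.≤-refl))
                 (indicator-yes (P? (x + ε)) (from (h _) (up x , gap x∈ y∈ x<y))))
      where
      above : ∀ {s} → y ≤ s → ¬ P s
      above y≤s p = ℚₚ.<-irrefl refl (ℚₚ.≤-<-trans y≤s (proj₂ (to (h _) p)))
      below : ∀ {s} → s ≤ x → ¬ P s
      below s≤x p = ℚₚ.<-irrefl refl (ℚₚ.<-≤-trans (proj₁ (to (h _) p)) s≤x)
      other : ∀ {s} → s ∈ nodes → s ≢ x → jump s ≡ 0ℚ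
      other {s} s∈ s≢x with ℚₚ.<-cmp s x
      ... | tri≈ _ e _ = contradiction e s≢x
      ... | tri< s<x _ _ = no-jump-outside s (below (ℚₚ.<⇒≤ s<x)) (below (ℚₚ.<⇒≤ (gap s∈ x∈ s<x)))
      ... | tri> _ _ x<s with s ℚₚ.<? y
      ... | yes s<y = no-jump-inside s (from (h s) (x<s , s<y)) (from (h (s + ε)) (ℚₚ.<-trans x<s (up s) , gap s∈ y∈ s<y))
      ... | no s≮y = no-jump-outside s (above y≤s) (above (ℚₚ.≤-trans y≤s (ℚₚ.<⇒≤ (up s))))
        where y≤s = ℚₚ.≮⇒≥ s≮y

  ∫-interval : ∀ b {P : ℚ → Set} {Q : Set} (P? : ∀ s → Dec (P s)) (Q? : Dec Q) → IsInterval b P Q →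
    ∫ (λ s → indicator (P? s)) ≐ (mass b * indicator Q?)
  ∫-interval b P? (no ¬q) (f , g) = byJumps [] λ M → trans
    (sumOver-zero (Mesh.nodes M) (λ _ → cong₂ _-_ (indicator-no (P? _) (¬q ∘ f _)) (indicator-no (P? _) (¬q ∘ f _))))
    (sym (ℚₚ.*-zeroʳ (mass b)))
  ∫-interval false P? (yes q) (f , g) = let (x , y , x≤y , h) = g q in
    byJumps (x ∷ y ∷ []) λ M → jumpSum-closed P? M x≤y h
  ∫-interval true P? (yes q) (f , g) = let (x , y , x<y , h) = g q in
    byJumps (x ∷ y ∷ []) λ M → jumpSum-open P? M x<y h

  -- Linear functionals and systems of linear inequalities

  0V : ∀ {D} → Pt D
  0V = V.replicate _ 0ℚ

  infixl 6 _⊖_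
  _⊖_ : ∀ {D} → Pt D → Pt D → Pt D
  x ⊖ y = V.zipWith _-_ x y

  negV : ∀ {D} → Pt D → Pt D
  negV = V.map (λ a → - a)




  ⊖-exchange : ∀ {D} (x y z : Pt D) → (x ⊖ y) ⊖ z ≡ (x ⊖ z) ⊖ y
  ⊖-exchange [] [] [] = refl
  ⊖-exchange (a ∷ x) (b ∷ y) (c ∷ z) = cong₂ _∷_ (l a b c) (⊖-exchange x y z)
    where
    l : ∀ a b c → a - b - c ≡ a - c - b
    l = solve-∀ ℚ-ring

  ⊖-rebase : ∀ {D} (x u : Pt D) s t → (x ⊖ t • u) ⊖ (s - t) • u ≡ x ⊖ s • u
  ⊖-rebase [] [] s t = refl
  ⊖-rebase (a ∷ x) (b ∷ u) s t = cong₂ _∷_ (l a b s t) (⊖-rebase x u s t)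
    where
    l : ∀ a b s t → a - t * b - (s - t) * b ≡ a - s * b
    l = solve-∀ ℚ-ring

  negV-⊖ : ∀ {D} (x u : Pt D) s → negV x ⊖ (- s) • u ≡ negV (x ⊖ s • u)
  negV-⊖ [] [] s = refl
  negV-⊖ (a ∷ x) (b ∷ u) s = cong₂ _∷_ (l a b s) (negV-⊖ x u s)
    where
    l : ∀ a b s → - a - - s * b ≡ - (a - s * b)
    l = solve-∀ ℚ-ring

  ⊕-as-⊖ : ∀ {D} (x y : Pt D) → x ⊕ y ≡ x ⊖ (- 1ℚ) • y
  ⊕-as-⊖ [] [] = refl
  ⊕-as-⊖ (a ∷ x) (b ∷ y) = cong₂ _∷_ (l a b) (⊕-as-⊖ x y)
    where
    l : ∀ a b → a + b ≡ a - - 1ℚ * b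
    l = solve-∀ ℚ-ring

  ⊕-⊖-cancel : ∀ {D} (x y : Pt D) → y ⊕ (x ⊖ y) ≡ x
  ⊕-⊖-cancel [] [] = refl
  ⊕-⊖-cancel (a ∷ x) (b ∷ y) = cong₂ _∷_ (l a b) (⊕-⊖-cancel x y)
    where
    l : ∀ a b → b + (a - b) ≡ a
    l = solve-∀ ℚ-ring

  ⊖-⊕-cancel : ∀ {D} (x y : Pt D) → (y ⊕ x) ⊖ y ≡ x
  ⊖-⊕-cancel [] [] = refl
  ⊖-⊕-cancel (a ∷ x) (b ∷ y) = cong₂ _∷_ (l a b) (⊖-⊕-cancel x y)
    where
    l : ∀ a b → b + a - b ≡ a
    l = solve-∀ ℚ-ring

  0•-0V : ∀ D → 0ℚ • 0V {D} ≡ 0V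
  0•-0V zero = refl
  0•-0V (suc D) = cong (0ℚ ∷_) (0•-0V D)

  -- Functionals are functions with laws, so elimination can combine them freely. `norm` bounds them
  -- with respect to the maximum norm and later yields neighbourhoods inside the cone.
  record Lin (D : ℕ) : Set where
    field
      ap : Pt D → ℚ
      ap-⊖ : ∀ x y → ap (x ⊖ y) ≡ ap x - ap y
      ap-• : ∀ s x → ap (s • x) ≡ s * ap x
      norm : ℚ
      0≤norm : 0ℚ ≤ norm
      ap-bound : ∀ x ε → (∀ i → ∣ lookup x i ∣ ≤ ε) → 0ℚ ≤ ε → ∣ ap x ∣ ≤ norm * ε

    ap-⊖• : ∀ x s u → ap (x ⊖ s • u) ≡ ap x - s * ap u
    ap-⊖• x s u = trans (ap-⊖ x (s • u)) (cong (λ t → ap x - t) (ap-• s u))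

    ap-⊕ : ∀ x y → ap (x ⊕ y) ≡ ap x + ap y
    ap-⊕ x y = trans (cong ap (⊕-as-⊖ x y)) (trans (ap-⊖• x (- 1ℚ) y) (l (ap x) (ap y)))
      where
      l : ∀ a b → a - - 1ℚ * b ≡ a + b
      l = solve-∀ ℚ-ring

    ap-0V : ap 0V ≡ 0ℚ
    ap-0V = trans (cong ap (sym (0•-0V D))) (trans (ap-• 0ℚ 0V) (ℚₚ.*-zeroˡ (ap 0V)))

  open Lin public using (ap)

  zeroL : ∀ {D} → Lin D
  zeroL = record
    { ap = λ _ → 0ℚ ; ap-⊖ = λ _ _ → refl ; ap-• = λ s _ → sym (ℚₚ.*-zeroʳ s)
    ; norm = 0ℚ ; 0≤norm = ℚₚ.≤-refl
    ; ap-bound = λ x ε _ _ → ℚₚ.≤-reflexive (sym (ℚₚ.*-zeroˡ ε)) }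

  coordinate : ∀ {D} → Fin D → Lin D
  coordinate i = record
    { ap = λ x → lookup x i
    ; ap-⊖ = λ x y → Vₚ.lookup-zipWith _-_ i x y
    ; ap-• = λ s x → Vₚ.lookup-map i (s *_) x
    ; norm = 1ℚ ; 0≤norm = 0≤1
    ; ap-bound = λ x ε h _ → subst (∣ lookup x i ∣ ≤_) (sym (ℚₚ.*-identityˡ ε)) (h i) }

  scaleL : ∀ {D} → ℚ → Lin D → Lin D
  scaleL c f = record
    { ap = λ x → c * ap f x
    ; ap-⊖ = λ x y → trans (cong (c *_) (Lin.ap-⊖ f x y)) (l c (ap f x) (ap f y))
    ; ap-• = λ s x → trans (cong (c *_) (Lin.ap-• f s x)) (r c s (ap f x))
    ; norm = ∣ c ∣ * Lin.norm f
    ; 0≤norm = 0≤-* (ℚₚ.0≤∣p∣ c) (Lin.0≤norm f)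
    ; ap-bound = λ x ε h 0≤ε → subst₂ _≤_ (sym (ℚₚ.∣p*q∣≡∣p∣*∣q∣ c (ap f x))) (sym (ℚₚ.*-assoc ∣ c ∣ (Lin.norm f) ε))
        (ℚₚ.*-monoˡ-≤-nonNeg ∣ c ∣ {{ℚ.nonNegative (ℚₚ.0≤∣p∣ c)}} (Lin.ap-bound f x ε h 0≤ε)) }
    where
    l : ∀ c a b → c * (a - b) ≡ c * a - c * b
    l = solve-∀ ℚ-ring
    r : ∀ c s a → c * (s * a) ≡ s * (c * a)
    r = solve-∀ ℚ-ring

  subL : ∀ {D} → Lin D → Lin D → Lin D
  subL f g = record
    { ap = λ x → ap f x - ap g x
    ; ap-⊖ = λ x y → trans (cong₂ _-_ (Lin.ap-⊖ f x y) (Lin.ap-⊖ g x y)) (l (ap f x) (ap f y) (ap g x) (ap g y))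
    ; ap-• = λ s x → trans (cong₂ _-_ (Lin.ap-• f s x) (Lin.ap-• g s x)) (r s (ap f x) (ap g x))
    ; norm = Lin.norm f + Lin.norm g
    ; 0≤norm = 0≺-+ false (Lin.0≤norm f) (Lin.0≤norm g)
    ; ap-bound = λ x ε h 0≤ε → ℚₚ.≤-trans (ℚₚ.∣p-q∣≤∣p∣+∣q∣ (ap f x) (ap g x))
        (subst (∣ ap f x ∣ + ∣ ap g x ∣ ≤_) (sym (ℚₚ.*-distribʳ-+ ε (Lin.norm f) (Lin.norm g)))
          (ℚₚ.+-mono-≤ (Lin.ap-bound f x ε h 0≤ε) (Lin.ap-bound g x ε h 0≤ε))) }
    where
    l : ∀ a b c d → (a - b) - (c - d) ≡ (a - c) - (b - d)
    l = solve-∀ ℚ-ring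
    r : ∀ s a b → s * a - s * b ≡ s * (a - b)
    r = solve-∀ ℚ-ring

  record System (D : ℕ) : Set where
    constructor system
    field
      eqs ineqs : List (Lin D)
  open System public

  -- In the systems built below the equations cut out the span of the cone. Only the inequalities
  -- become strict, so `true` describes the relative interior and not the interior.
  Sat : ∀ {D} → Bool → System D → Pt D → Set
  Sat b S x = All (λ e → ap e x ≡ 0ℚ) (eqs S) × All (λ i → 0ℚ ≺[ b ] ap i x) (ineqs S)

  Sat? : ∀ {D} b (S : System D) x → Dec (Sat b S x)
  Sat? b S x = All.all? (λ e → ap e x ℚₚ.≟ 0ℚ) (eqs S) ×-dec All.all? (λ i → 0ℚ ≺?[ b ] ap i x) (ineqs S)

  Sat-weaken : ∀ {D} b {S : System D} {x} → Sat true S x → Sat b S x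
  Sat-weaken b (p , q) = p , All.map (<⇒≺ b) q

  Sat-scale : ∀ {D} b {S : System D} {x c} → 0ℚ < c → Sat b S x → Sat b S (c • x)
  Sat-scale b {x = x} {c} 0<c (p , q) =
    All.map (λ {e} h → trans (Lin.ap-• e c x) (trans (cong (c *_) h) (ℚₚ.*-zeroʳ c))) p ,
    All.map (λ {i} h → subst (0ℚ ≺[ b ]_) (sym (Lin.ap-• i c x)) (0≺-* b c 0<c h)) q

  Sat-⊕ : ∀ {D} b {S : System D} {x y} → Sat b S x → Sat false S y → Sat b S (x ⊕ y)
  Sat-⊕ b {x = x} {y} (p , q) (p′ , q′) =
    All.zipWith (λ {e} (h , h′) → trans (Lin.ap-⊕ e x y) (trans (cong₂ _+_ h h′) (ℚₚ.+-identityˡ 0ℚ))) (p , p′) ,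
    All.zipWith (λ {i} (h , h′) → subst (0ℚ ≺[ b ]_) (sym (Lin.ap-⊕ i x y)) (0≺-+ b h h′)) (q , q′)

  0≺-rescale : ∀ b {c a X Y} → 0ℚ < c → 0ℚ < a → c * a ≡ 1ℚ → c * X ≡ Y → 0ℚ ≺[ b ] X ⇔ 0ℚ ≺[ b ] Y
  0≺-rescale b {c} {a} {X} {Y} 0<c 0<a ca e = mk⇔
    (λ p → subst (0ℚ ≺[ b ]_) e (0≺-* b c 0<c p))
    (λ p → subst (0ℚ ≺[ b ]_) back (0≺-* b a 0<a p))
    where
    l : ∀ a c X → a * (c * X) ≡ c * a * X
    l = solve-∀ ℚ-ring
    back : a * Y ≡ X
    back = trans (cong (a *_) (sym e)) (trans (l a c X) (trans (cong (_* X) ca) (ℚₚ.*-identityˡ X)))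

  -- Along the line `x - s u` an inequality bounds `s` from above, from below or not at all,
  -- according to the sign of its functional at `u`. The bounds are rescaled to have coefficient 1
  -- at `s`.
  record Split {D} (u : Pt D) (Is : List (Lin D)) : Set where
    field
      flat lower upper : List (Lin D)
      splits : ∀ b x s → All (λ i → 0ℚ ≺[ b ] ap i (x ⊖ s • u)) Is ⇔
        (All (λ i → 0ℚ ≺[ b ] ap i x) flat × All (λ l → ap l x ≺[ b ] s) lower × All (λ w → s ≺[ b ] ap w x) upper)

  split : ∀ {D} (u : Pt D) Is → Split u Is
  split u [] = record { flat = [] ; lower = [] ; upper = [] ; splits = λ b x s → mk⇔ (λ _ → [] , [] , []) (λ _ → []) }
  split u (i ∷ Is) with split u Is | ℚₚ.<-cmp (ap i u) 0ℚ
  ... | record { flat = Z ; lower = L ; upper = U ; splits = h } | tri≈ _ iu≡0 _ = record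
    { flat = i ∷ Z ; lower = L ; upper = U
    ; splits = λ b x s → mk⇔
        (λ { (p ∷ ps) → let (z , l , w) = to (h b x s) ps in (subst (0ℚ ≺[ b ]_) (e x s) p ∷ z) , l , w })
        (λ { (p ∷ z , l , w) → subst (0ℚ ≺[ b ]_) (sym (e x s)) p ∷ from (h b x s) (z , l , w) }) }
    where
    r : ∀ a s → a - s * 0ℚ ≡ a
    r = solve-∀ ℚ-ring
    e : ∀ x s → ap i (x ⊖ s • u) ≡ ap i x
    e x s = trans (Lin.ap-⊖• i x s u) (trans (cong (λ t → ap i x - s * t) iu≡0) (r (ap i x) s))
  ... | record { flat = Z ; lower = L ; upper = U ; splits = h } | tri> _ _ 0<iu = record
    { flat = Z ; lower = L ; upper = scaleL c i ∷ U
    ; splits = λ b x s → mk⇔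
        (λ { (p ∷ ps) → let (z , l , w) = to (h b x s) ps in z , l , (≺-shift b (r (c * ap i x) s) (to (q b x s) p) ∷ w) })
        (λ { (z , l , p ∷ w) → from (q b x s) (≺-shift b (sym (r (c * ap i x) s)) p) ∷ from (h b x s) (z , l , w) }) }
    where
    c = proj₁ (pos-inverse 0<iu)
    0<c = proj₁ (proj₂ (pos-inverse 0<iu))
    ca = proj₂ (proj₂ (pos-inverse 0<iu))
    r : ∀ a s → (a - s) - 0ℚ ≡ a - s
    r = solve-∀ ℚ-ring
    l : ∀ c a X s → c * (X - s * a) ≡ c * X - s * (c * a)
    l = solve-∀ ℚ-ring
    q : ∀ b x s → 0ℚ ≺[ b ] ap i (x ⊖ s • u) ⇔ 0ℚ ≺[ b ] (c * ap i x - s)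
    q b x s = 0≺-rescale b 0<c 0<iu ca (trans (cong (c *_) (Lin.ap-⊖• i x s u))
      (trans (l c (ap i u) (ap i x) s) (cong (λ t → c * ap i x - t) (trans (cong (s *_) ca) (ℚₚ.*-identityʳ s)))))
  ... | record { flat = Z ; lower = L ; upper = U ; splits = h } | tri< iu<0 _ _ = record
    { flat = Z ; lower = scaleL (- c) i ∷ L ; upper = U
    ; splits = λ b x s → mk⇔
        (λ { (p ∷ ps) → let (z , l , w) = to (h b x s) ps in z , (≺-shift b (r c (ap i x) s) (to (q b x s) p) ∷ l) , w })
        (λ { (z , p ∷ l , w) → from (q b x s) (≺-shift b (sym (r c (ap i x) s)) p) ∷ from (h b x s) (z , l , w) }) }
    where
    0<-iu : 0ℚ < - ap i u
    0<-iu = ℚₚ.neg-antimono-< iu<0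
    c = proj₁ (pos-inverse 0<-iu)
    0<c = proj₁ (proj₂ (pos-inverse 0<-iu))
    ca = proj₂ (proj₂ (pos-inverse 0<-iu))
    r : ∀ c a s → (c * a + s) - 0ℚ ≡ s - - c * a
    r = solve-∀ ℚ-ring
    l : ∀ c a X s → c * (X - s * a) ≡ c * X + s * (c * - a)
    l = solve-∀ ℚ-ring
    q : ∀ b x s → 0ℚ ≺[ b ] ap i (x ⊖ s • u) ⇔ 0ℚ ≺[ b ] (c * ap i x + s)
    q b x s = 0≺-rescale b 0<c 0<-iu ca (trans (cong (c *_) (Lin.ap-⊖• i x s u))
      (trans (l c (ap i u) (ap i x) s) (cong (λ t → c * ap i x + t) (trans (cong (s *_) ca) (ℚₚ.*-identityʳ s)))))

  greatest : ∀ {A : Set} (v : A → ℚ) a as → ∃ λ m → m ∈ (a ∷ as) × All (λ z → v z ≤ v m) (a ∷ as)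
  greatest v a [] = a , here refl , ℚₚ.≤-refl ∷ []
  greatest v a (z ∷ as) with greatest v z as
  ... | m , m∈ , h with v a ℚₚ.≤? v m
  ... | yes p = m , there m∈ , p ∷ h
  ... | no p = a , here refl , ℚₚ.≤-refl ∷ All.map (λ q → ℚₚ.≤-trans q (ℚₚ.<⇒≤ (ℚₚ.≰⇒> p))) h

  least : ∀ {A : Set} (v : A → ℚ) a as → ∃ λ m → m ∈ (a ∷ as) × All (λ z → v m ≤ v z) (a ∷ as)
  least v a [] = a , here refl , ℚₚ.≤-refl ∷ []
  least v a (z ∷ as) with least v z as
  ... | m , m∈ , h with v m ℚₚ.≤? v a
  ... | yes p = m , there m∈ , p ∷ h
  ... | no p = a , here refl , ℚₚ.≤-refl ∷ All.map (ℚₚ.≤-trans (ℚₚ.<⇒≤ (ℚₚ.≰⇒> p))) h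

  -- kind tells whether the fibres of the strict system are open intervals (u in the span of the cone) or points.
  record AddsRay {D : ℕ} (S : System D) (u : Pt D) (S′ : System D) (kind : Bool) : Set where
    field
      closed-fibre : ∀ x → IsInterval false (λ s → 0ℚ ≤ s × Sat false S (x ⊖ s • u)) (Sat false S′ x)
      open-fibre : ∀ x → IsInterval kind (λ s → 0ℚ < s × Sat true S (x ⊖ s • u)) (Sat true S′ x)

  module _ {D : ℕ} (S : System D) (u : Pt D) (h : All (λ e → ap e u ≡ 0ℚ) (eqs S))
           (pointed : ¬ Sat false S (0V ⊖ 1ℚ • u)) where
    open Split (split u (ineqs S))

    -- `zeroL` is the lower bound coming from `s ≥ 0`. An interval for `s` exists when each lower
    -- bound lies below each upper bound; the equations vanish at `u` and do not restrict `s`.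
    fourierMotzkin : System D
    fourierMotzkin = system (eqs S) (flat ++ cartesianProductWith subL upper (zeroL ∷ lower))

    private
      invariant : ∀ {x} s e → ap e u ≡ 0ℚ → ap e (x ⊖ s • u) ≡ ap e x
      invariant {x} s e eu≡0 = trans (Lin.ap-⊖• e x s u) (trans (cong (λ t → ap e x - s * t) eu≡0) (r (ap e x) s))
        where
        r : ∀ a s → a - s * 0ℚ ≡ a
        r = solve-∀ ℚ-ring

      eqs-at : ∀ {x} s → All (λ e → ap e (x ⊖ s • u) ≡ 0ℚ) (eqs S) ⇔ All (λ e → ap e x ≡ 0ℚ) (eqs S)
      eqs-at {x} s = mk⇔
        (λ p → All.zipWith (λ {e} (q , eu) → trans (sym (invariant s e eu)) q) (p , h))
        (λ p → All.zipWith (λ {e} (q , eu) → trans (invariant s e eu) q) (p , h))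

      shifted : ∀ b x s → (0ℚ ≺[ b ] s × Sat b S (x ⊖ s • u)) ⇔
        (All (λ e → ap e x ≡ 0ℚ) (eqs S) × All (λ i → 0ℚ ≺[ b ] ap i x) flat ×
         All (λ l → ap l x ≺[ b ] s) (zeroL ∷ lower) × All (λ w → s ≺[ b ] ap w x) upper)
      shifted b x s = mk⇔
        (λ (p , q , r) → let (z , l , w) = to (splits b x s) r in to (eqs-at s) q , z , p ∷ l , w)
        (λ { (q , z , p ∷ l , w) → p , from (eqs-at s) q , from (splits b x s) (z , l , w) })

      r₀ : ∀ a b → b - a ≡ (b - a) - 0ℚ
      r₀ = solve-∀ ℚ-ring

      bounded : upper ≢ []
      bounded e = pointed (from (eqs-at 1ℚ) (All.universal (λ f → Lin.ap-0V f) (eqs S)) ,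
        from (splits false 0V 1ℚ)
          ( All.universal (λ f → ℚₚ.≤-reflexive (sym (Lin.ap-0V f))) flat
          , All.universal (λ f → subst (_≤ 1ℚ) (sym (Lin.ap-0V f)) 0≤1) lower
          , subst (All _) (sym e) []))

      -- The ends are the greatest lower and the least upper bound at `x`, and the difference of
      -- exactly this pair occurs among the inequalities. The equation `upper ≡ us` allows a case
      -- split that exposes a first upper bound for the minimum.
      fm-fibre : ∀ us → upper ≡ us → ∀ b x →
        IsInterval b (λ s → 0ℚ ≺[ b ] s × Sat b S (x ⊖ s • u)) (Sat b fourierMotzkin x)
      fm-fibre [] e b x = contradiction e bounded
      fm-fibre (w₀ ∷ ws) e b x =
        (λ s p → let (q , z , l , w) = to (shifted b x s) p in q , Allₚ.++⁺ z (All.tabulate λ {f} f∈ →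
          let (w′ , l′ , w∈ , l∈ , eq) = ∈-cartesianProductWith⁻ subL upper (zeroL ∷ lower) f∈ in
          subst (λ f → 0ℚ ≺[ b ] ap f x) (sym eq)
            (≺-shift b (r₀ (ap l′ x) (ap w′ x)) (≺-trans b (All.lookup l l∈) (All.lookup w w∈))))) ,
        λ (q , i) →
          let (l , l∈ , l-max) = greatest (λ f → ap f x) zeroL lower
              (w , w∈ , w-min) = least (λ f → ap f x) w₀ ws
              w∈′ = subst (w ∈_) (sym e) w∈
              w-min′ = subst (All _) (sym e) w-min
          in ap l x , ap w x ,
             ≺-shift b (sym (r₀ (ap l x) (ap w x))) (All.lookup (Allₚ.++⁻ʳ flat i) (∈-cartesianProductWith⁺ subL w∈′ l∈)) ,
             λ s → mk⇔
               (λ p → let (_ , _ , ls , ws) = to (shifted b x s) p in All.lookup ls l∈ , All.lookup ws w∈′)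
               (λ (l<s , s<w) → from (shifted b x s) (q , Allₚ.++⁻ˡ flat i ,
                 All.map (λ le → ≤-≺-trans b le l<s) l-max ,
                 All.map (λ le → ≺-≤-trans b s<w le) w-min′))

    fourierMotzkin-adds-ray : AddsRay S u fourierMotzkin true
    fourierMotzkin-adds-ray = record { closed-fibre = fm-fibre upper refl false ; open-fibre = fm-fibre upper refl true }

  module _ {D : ℕ} (S : System D) (u : Pt D) (e : Lin D) (e∈ : e ∈ eqs S) (eu≢0 : ap e u ≢ 0ℚ) where
    private
      c : ℚ
      c = proj₁ (inverse (ap e u) eu≢0)
      ce : c * ap e u ≡ 1ℚ
      ce = proj₂ (inverse (ap e u) eu≢0)

    -- The only `s` for which `x - s u` can satisfy the equation `e`.
    height : Lin D
    height = scaleL c e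

    alongRay : Lin D → Lin D
    alongRay f = subL f (scaleL (ap f u) height)

    -- The forced value of `s` is substituted everywhere. The condition `s ≥ 0` becomes the
    -- inequality `height`, and `e` itself turns into a trivial equation.
    gauss : System D
    gauss = system (map alongRay (eqs S)) (height ∷ map alongRay (ineqs S))

    alongRay-correct : ∀ f x → ap (alongRay f) x ≡ ap f (x ⊖ ap height x • u)
    alongRay-correct f x = trans (cong (λ t → ap f x - t) (ℚₚ.*-comm (ap f u) (ap height x))) (sym (Lin.ap-⊖• f x (ap height x) u))

    height-unique : ∀ x s → ap e (x ⊖ s • u) ≡ 0ℚ → s ≡ ap height x
    height-unique x s p = difference-zero s (ap height x) (begin
      s - c * ap e x                         ≡⟨ cong (_- c * ap e x) (trans (sym (ℚₚ.*-identityʳ s)) (cong (s *_) (sym ce))) ⟩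
      s * (c * ap e u) - c * ap e x          ≡⟨ l s c (ap e u) (ap e x) ⟩
      (- c) * (ap e x - s * ap e u)          ≡⟨ cong ((- c) *_) (trans (sym (Lin.ap-⊖• e x s u)) p) ⟩
      (- c) * 0ℚ                             ≡⟨ ℚₚ.*-zeroʳ (- c) ⟩
      0ℚ ∎)
      where
      open ≡-Reasoning
      l : ∀ s c a X → s * (c * a) - c * X ≡ (- c) * (X - s * a)
      l = solve-∀ ℚ-ring

    private
      at-height : ∀ b x → (0ℚ ≺[ b ] ap height x × Sat b S (x ⊖ ap height x • u)) ⇔ Sat b gauss x
      at-height b x = mk⇔
        (λ (p , q , r) → Allₚ.map⁺ (All.map (λ {f} → trans (alongRay-correct f x)) q) ,
          p ∷ Allₚ.map⁺ (All.map (λ {f} → subst (0ℚ ≺[ b ]_) (sym (alongRay-correct f x))) r))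
        (λ { (q , p ∷ r) → p , All.map (λ {f} → trans (sym (alongRay-correct f x))) (Allₚ.map⁻ q) ,
          All.map (λ {f} → subst (0ℚ ≺[ b ]_) (alongRay-correct f x)) (Allₚ.map⁻ r) })

    -- A point is a closed interval with equal ends, also when it is a fibre of the strict system;
    -- hence the kind `false`.
    gauss-adds-ray : AddsRay S u gauss false
    gauss-adds-ray = record { closed-fibre = fibre false ; open-fibre = fibre true }
      where
      only : ∀ {b} x s → Sat b S (x ⊖ s • u) → s ≡ ap height x
      only x s (q , _) = height-unique x s (All.lookup q e∈)
      fibre : ∀ b x → IsInterval false (λ s → 0ℚ ≺[ b ] s × Sat b S (x ⊖ s • u)) (Sat b gauss x)
      fibre b x =
        (λ s (p , q) → to (at-height b x) (subst (λ s → 0ℚ ≺[ b ] s × Sat b S (x ⊖ s • u)) (only x s q) (p , q))) ,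
        (λ q → ap height x , ap height x , ℚₚ.≤-refl , λ s → mk⇔
          (λ (_ , r) → ℚₚ.≤-reflexive (sym (only x s r)) , ℚₚ.≤-reflexive (only x s r))
          (λ (l , r) → subst (λ s → 0ℚ ≺[ b ] s × Sat b S (x ⊖ s • u)) (ℚₚ.≤-antisym l r) (from (at-height b x) q)))

  -- Difference operators and the function Φ

  Ω : ∀ {D} → List (Pt D) → (Pt D → ℚ) → Pt D → ℚ
  Ω [] f x = f x
  Ω (v ∷ vs) f x = Ω vs (λ y → f y - f (y ⊖ v)) x

  Ω-cong : ∀ {D} vs {f g : Pt D → ℚ} → (∀ x → f x ≡ g x) → ∀ x → Ω vs f x ≡ Ω vs g x
  Ω-cong [] h x = h x
  Ω-cong (v ∷ vs) h x = Ω-cong vs (λ y → cong₂ _-_ (h y) (h (y ⊖ v))) x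

  -- `Ω` takes finite differences in `x`, and integration over the separate variable `s` is linear.
  Ω-∫ : ∀ {D} vs {A : Pt D → ℚ → ℚ} {B : Pt D → ℚ} → (∀ x → ∫ A x ≐ B x) →
    ∀ x → ∫ (λ s → Ω vs (λ y → A y s) x) ≐ Ω vs B x
  Ω-∫ [] h x = h x
  Ω-∫ (v ∷ vs) {A} h x = Ω-∫ vs (λ y → ∫-- {A y} {A (y ⊖ v)} (h y) (h (y ⊖ v))) x

  Ω-translate : ∀ {D} vs (f : Pt D → ℚ) κ w x → Ω vs (λ y → κ * f (y ⊖ w)) x ≡ κ * Ω vs f (x ⊖ w)
  Ω-translate [] f κ w x = refl
  Ω-translate (v ∷ vs) f κ w x = trans
    (Ω-cong vs (λ y → trans (cong (λ z → κ * f (y ⊖ w) - κ * f z) (⊖-exchange y v w)) (l κ (f (y ⊖ w)) (f ((y ⊖ w) ⊖ v)))) x)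
    (Ω-translate vs (λ y → f y - f (y ⊖ v)) κ w x)
    where
    l : ∀ c a b → c * a - c * b ≡ c * (a - b)
    l = solve-∀ ℚ-ring

  -- `ρ` stands for the sign of the dimension. It is a parameter because adding a ray multiplies it
  -- by `- mass kind`.
  Φ : ∀ {D} → System D → ℚ → Pt D → ℚ
  Φ S ρ x = indicator (Sat? false S x) - ρ * indicator (Sat? true S (negV x))

  -- Along lines in direction u, (1 - T_{Nu}) Φ′ integrates Φ over 0 ≤ s < N.
  module _ {D : ℕ} {S : System D} {u : Pt D} {S′ : System D} {kind : Bool} (adds : AddsRay S u S′ kind) (N ρ : ℚ) where
    open AddsRay adds

    private
      P? : ∀ b x s → Dec (0ℚ ≺[ b ] s × Sat b S (x ⊖ s • u))
      P? b x s = (0ℚ ≺?[ b ] s) ×-dec Sat? b S (x ⊖ s • u)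

      θ : ℚ → ℚ
      θ s = indicator (0ℚ ℚₚ.≤? s)

      1-θ : ∀ s → indicator (0ℚ ℚₚ.<? - s) ≡ 1ℚ - θ s
      1-θ s = indicator-¬ (0ℚ ℚₚ.≤? s) (0ℚ ℚₚ.<? - s)
        (λ p q → ℚₚ.<-irrefl refl (ℚₚ.<-≤-trans q (ℚₚ.neg-antimono-≤ p)))
        (λ p → ℚₚ.neg-antimono-< (ℚₚ.≰⇒> p))

      -- The closed cone is taken on `s ≥ 0` and the reflected open one on `s < 0`. On these sides
      -- the fibres are bounded; on a whole line they may be infinite.
      half : Pt D → ℚ → ℚ
      half x s = indicator (P? false x s) + ρ * indicator (P? true (negV x) (- s))

      half-value : ∀ x s → half x s ≡ θ s * indicator (Sat? false S (x ⊖ s • u)) +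
        ρ * ((1ℚ - θ s) * indicator (Sat? true S (negV (x ⊖ s • u))))
      half-value x s = cong₂ (λ a b → a + ρ * b) (indicator-× (0ℚ ≺?[ false ] s) (Sat? false S (x ⊖ s • u)))
        (trans (indicator-× (0ℚ ≺?[ true ] (- s)) (Sat? true S (negV x ⊖ (- s) • u)))
          (cong₂ _*_ (1-θ s) (cong (λ y → indicator (Sat? true S y)) (negV-⊖ x u s))))

      ρ′ : ℚ
      ρ′ = - mass kind * ρ

      slab : Pt D → ℚ → ℚ
      slab x s = half x s - half (x ⊖ N • u) (s - N)

      -- Both halves look at the same point `x - s u`. Writing the factor of the open part as
      -- `1 - θ`, its term without `θ` cancels in the difference, and what remains is a multiple of
      -- `Φ`.
      slab-value : ∀ x s → slab x s ≡ (θ s - θ (s - N)) * Φ S ρ (x ⊖ s • u)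
      slab-value x s = trans
        (cong₂ _-_ (half-value x s)
          (trans (half-value (x ⊖ N • u) (s - N)) (cong (λ y → θ (s - N) * indicator (Sat? false S y) +
            ρ * ((1ℚ - θ (s - N)) * indicator (Sat? true S (negV y)))) (⊖-rebase x u s N))))
        (l (θ s) (θ (s - N)) (indicator (Sat? false S (x ⊖ s • u))) (indicator (Sat? true S (negV (x ⊖ s • u)))) ρ)
        where
        l : ∀ a b c d r → (a * c + r * ((1ℚ - a) * d)) - (b * c + r * ((1ℚ - b) * d)) ≡ (a - b) * (c - r * d)
        l = solve-∀ ℚ-ring

      ∫-half : ∀ x c → ∫ (λ s → half x (s - c)) ≐ Φ S′ ρ′ x
      ∫-half x c = ∫-cong (λ s → refl) (l (mass kind) ρ (indicator (Sat? false S′ x)) (indicator (Sat? true S′ (negV x))))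
        (∫-+ {λ s → indicator (P? false x (s - c))} {λ s → ρ * indicator (P? true (negV x) (- (s - c)))}
          (∫-interval false (λ s → P? false x (s - c)) (Sat? false S′ x) (IsInterval-translate false c (closed-fibre x)))
          (∫-* {λ s → indicator (P? true (negV x) (- (s - c)))} ρ
            (∫-interval kind (λ s → P? true (negV x) (- (s - c))) (Sat? true S′ (negV x))
              (IsInterval-translate kind c (IsInterval-negate kind (open-fibre (negV x)))))))
        where
        l : ∀ m r a b → 1ℚ * a + r * (m * b) ≡ a - - m * r * b
        l = solve-∀ ℚ-ring

      ∫-slab : ∀ x → ∫ slab x ≐ (Φ S′ ρ′ x - Φ S′ ρ′ (x ⊖ N • u))
      ∫-slab x = ∫-- {half x} {λ s → half (x ⊖ N • u) (s - N)}
        (∫-cong (λ s → cong (half x) (ℚₚ.+-identityʳ s)) refl (∫-half x 0ℚ)) (∫-half (x ⊖ N • u) N)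

    -- The slabs integrate to the difference of `Φ` for `S′` in direction `N • u`. Under the
    -- integral sign `Ω vs` meets, for each fixed `s`, a multiple of a translate of `Φ` for `S`,
    -- which it kills.
    Ω-adds-ray : ∀ vs → (∀ x → Ω vs (Φ S ρ) x ≡ 0ℚ) → ∀ x → Ω (N • u ∷ vs) (Φ S′ (- mass kind * ρ)) x ≡ 0ℚ
    Ω-adds-ray vs h x = ∫-zero
      (λ s → trans (Ω-cong vs (λ y → slab-value y s) x)
        (trans (Ω-translate vs (Φ S ρ) (θ s - θ (s - N)) (s • u) x)
          (trans (cong ((θ s - θ (s - N)) *_) (h (x ⊖ s • u))) (ℚₚ.*-zeroʳ (θ s - θ (s - N))))))
      (Ω-∫ vs ∫-slab x)

  -- Cones and the systems that describe them

  Cone : ∀ {D n} → Vec (Pt D) n → Pt D → Set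
  Cone {n = n} us x = Σ (Vec ℚ n) λ a → (∀ i → 0ℚ ≤ lookup a i) × combo a us ≡ x

  Cone-∷ : ∀ {D n} (u : Pt D) (us : Vec (Pt D) n) x → Cone (u ∷ us) x ⇔ (∃ λ s → 0ℚ ≤ s × Cone us (x ⊖ s • u))
  Cone-∷ u us x = mk⇔
    (λ { (s ∷ a , h , e) → s , h zero , a , h ∘ suc , trans (sym (⊖-⊕-cancel (combo a us) (s • u))) (cong (_⊖ s • u) e) })
    (λ (s , 0≤s , a , h , e) → s ∷ a , (λ { zero → 0≤s ; (suc i) → h i }) ,
      trans (cong ((s • u) ⊕_) e) (⊕-⊖-cancel x (s • u)))

  ap-combo-zero : ∀ {D n} (f : Lin D) (us : Vec (Pt D) n) → (∀ i → ap f (lookup us i) ≡ 0ℚ) → ∀ a → ap f (combo a us) ≡ 0ℚ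
  ap-combo-zero f [] h [] = Lin.ap-0V f
  ap-combo-zero f (u ∷ us) h (s ∷ a) = trans (Lin.ap-⊕ f (s • u) (combo a us))
    (cong₂ _+_ (trans (Lin.ap-• f s u) (trans (cong (s *_) (h zero)) (ℚₚ.*-zeroʳ s))) (ap-combo-zero f us (h ∘ suc) a))

  Cone-nonneg : ∀ {D n} (f : Lin D) (us : Vec (Pt D) n) → (∀ i → 0ℚ ≤ ap f (lookup us i)) → ∀ {x} → Cone us x → 0ℚ ≤ ap f x
  Cone-nonneg f [] h ([] , _ , refl) = ℚₚ.≤-reflexive (sym (Lin.ap-0V f))
  Cone-nonneg f (u ∷ us) h {x} (s ∷ a , p , refl) = subst (0ℚ ≤_) (sym (Lin.ap-⊕ f (s • u) (combo a us)))
    (0≺-+ false (subst (0ℚ ≤_) (sym (Lin.ap-• f s u)) (0≤-* (p zero) (h zero)))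
      (Cone-nonneg f us (h ∘ suc) (a , p ∘ suc , refl)))

  vec-ext : ∀ {A : Set} {n} {x y : Vec A n} → (∀ i → lookup x i ≡ lookup y i) → x ≡ y
  vec-ext {x = x} {y} h = trans (sym (Vₚ.tabulate∘lookup x)) (trans (Vₚ.tabulate-cong h) (Vₚ.tabulate∘lookup y))

  ⊖-zero : ∀ {D} (x u : Pt D) → x ⊖ 0ℚ • u ≡ x
  ⊖-zero [] [] = refl
  ⊖-zero (a ∷ x) (b ∷ u) = cong₂ _∷_ (l a b) (⊖-zero x u)
    where
    l : ∀ a b → a - 0ℚ * b ≡ a
    l = solve-∀ ℚ-ring

  ⊖-self : ∀ {D} (u : Pt D) → u ⊖ 1ℚ • u ≡ 0V
  ⊖-self [] = refl
  ⊖-self (b ∷ u) = cong₂ _∷_ (l b) (⊖-self u)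
    where
    l : ∀ b → b - 1ℚ * b ≡ 0ℚ
    l = solve-∀ ℚ-ring

  ⊕-⊖-one : ∀ {D} (z u : Pt D) → (z ⊕ u) ⊖ 1ℚ • u ≡ z
  ⊕-⊖-one [] [] = refl
  ⊕-⊖-one (a ∷ z) (b ∷ u) = cong₂ _∷_ (l a b) (⊕-⊖-one z u)
    where
    l : ∀ a b → a + b - 1ℚ * b ≡ a
    l = solve-∀ ℚ-ring

  0•-⊕ : ∀ {D} (u w : Pt D) → (0ℚ • u) ⊕ w ≡ w
  0•-⊕ [] [] = refl
  0•-⊕ (a ∷ u) (b ∷ w) = cong₂ _∷_ (l a b) (0•-⊕ u w)
    where
    l : ∀ a b → 0ℚ * a + b ≡ b
    l = solve-∀ ℚ-ring

  Sat-0V : ∀ {D} (S : System D) → Sat false S 0V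
  Sat-0V S = All.universal Lin.ap-0V (eqs S) , All.universal (λ i → ℚₚ.≤-reflexive (sym (Lin.ap-0V i))) (ineqs S)

  altSign : ℕ → ℚ
  altSign zero = 1ℚ
  altSign (suc r) = - altSign r

  LinIndep : ∀ {D n} → Vec (Pt D) n → Set
  LinIndep ps = ∀ μ → combo μ ps ≡ 0V → ∀ i → lookup μ i ≡ 0ℚ

  -- `coords` and `basis` pin down the rank from both sides: `rank` functionals separate the
  -- solutions of the equations, and `rank` of the generators are independent. `centre` supplies the
  -- interior point needed to recognise the relative interior.
  record ConeSystem {D n : ℕ} (N : ℚ) (us : Vec (Pt D) n) : Set where
    field
      sys : System D
      rank : ℕ
      membership : ∀ x → Sat false sys x ⇔ Cone us x
      generators : ∀ j → Sat false sys (lookup us j)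
      centre : Pt D
      centre-interior : Sat true sys centre
      Ω-Φ : ∀ x → Ω (map (N •_) (V.toList us)) (Φ sys (altSign rank)) x ≡ 0ℚ
      coords : Vec (Lin D) rank
      coords-injective : ∀ x → All (λ e → ap e x ≡ 0ℚ) (eqs sys) → (∀ i → ap (lookup coords i) x ≡ 0ℚ) → x ≡ 0V
      basis : Vec (Pt D) rank
      basis-generators : ∀ i → ∃ λ j → lookup basis i ≡ lookup us j
      basis-independent : LinIndep basis

  -- The cone is the origin, which is its own relative interior and its own reflection. So `Φ`
  -- vanishes with the sign 1 before any operator is applied.
  coneSystem-[] : ∀ {D} N → ConeSystem {D} N []
  coneSystem-[] {D} N = record
    { sys = S
    ; rank = 0
    ; membership = λ x → mk⇔ (λ p → [] , (λ ()) , sym (vanish x (proj₁ p))) (λ { ([] , _ , refl) → Sat-0V S })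
    ; generators = λ ()
    ; centre = 0V
    ; centre-interior = proj₁ (Sat-0V S) , []
    ; Ω-Φ = λ x → trans (cong (λ t → indicator (Sat? false S x) - 1ℚ * t)
        (indicator-⇔ (Sat? true S (negV x)) (Sat? false S x) (mk⇔ (λ p → zeros x (proj₁ p) , []) (λ p → zeros′ x (proj₁ p) , []))))
        (l (indicator (Sat? false S x)))
    ; coords = []
    ; coords-injective = λ x p _ → vanish x p
    ; basis = []
    ; basis-generators = λ ()
    ; basis-independent = λ { [] _ () }
    }
    where
    S : System D
    S = system (List.tabulate coordinate) []
    l : ∀ a → a - 1ℚ * a ≡ 0ℚ
    l = solve-∀ ℚ-ring
    vanish : ∀ x → All (λ e → ap e x ≡ 0ℚ) (eqs S) → x ≡ 0V
    vanish x p = vec-ext (λ i → trans (Allₚ.tabulate⁻ p i) (sym (Vₚ.lookup-replicate i 0ℚ)))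
    neg-zero : ∀ D → negV (0V {D}) ≡ 0V
    neg-zero zero = refl
    neg-zero (suc D) = cong (0ℚ ∷_) (neg-zero D)
    neg-neg : ∀ {D} (x : Pt D) → negV (negV x) ≡ x
    neg-neg [] = refl
    neg-neg (a ∷ x) = cong₂ _∷_ (ll a) (neg-neg x)
      where
      ll : ∀ a → - (- a) ≡ a
      ll = solve-∀ ℚ-ring
    zeros′ : ∀ x → All (λ e → ap e x ≡ 0ℚ) (eqs S) → All (λ e → ap e (negV x) ≡ 0ℚ) (eqs S)
    zeros′ x p = subst (λ y → All (λ e → ap e y ≡ 0ℚ) (eqs S)) (sym (trans (cong negV (vanish x p)) (neg-zero D))) (proj₁ (Sat-0V S))
    zeros : ∀ x → All (λ e → ap e (negV x) ≡ 0ℚ) (eqs S) → All (λ e → ap e x ≡ 0ℚ) (eqs S)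
    zeros x p = subst (λ y → All (λ e → ap e y ≡ 0ℚ) (eqs S)) (neg-neg x) (zeros′ (negV x) p)

  module _ {D n : ℕ} {N : ℚ} {u : Pt D} {us : Vec (Pt D) n} (C : ConeSystem N us) {S′ : System D} {kind : Bool}
           (adds : AddsRay (ConeSystem.sys C) u S′ kind) where
    open ConeSystem C
    open AddsRay adds

    private
      add-point : ∀ x → Sat false S′ x ⇔ (∃ λ s → 0ℚ ≤ s × Sat false sys (x ⊖ s • u))
      add-point x = mk⇔
        -- The lower end of the closed fibre serves as the coefficient of `u`.
        (λ p → let (a , _ , a≤b , h) = proj₂ (closed-fibre x) p in a , from (h a) (ℚₚ.≤-refl , a≤b))
        (λ (s , p) → proj₁ (closed-fibre x) s p)

    membership-∷ : ∀ x → Sat false S′ x ⇔ Cone (u ∷ us) x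
    membership-∷ x = mk⇔
      (λ p → let (s , 0≤s , q) = to (add-point x) p in from (Cone-∷ u us x) (s , 0≤s , to (membership _) q))
      (λ p → let (s , 0≤s , q) = to (Cone-∷ u us x) p in from (add-point x) (s , 0≤s , from (membership _) q))

    generators-∷ : ∀ j → Sat false S′ (lookup (u ∷ us) j)
    generators-∷ zero = from (add-point u) (1ℚ , 0≤1 , subst (Sat false sys) (sym (⊖-self u)) (Sat-0V sys))
    generators-∷ (suc j) = from (add-point _) (0ℚ , ℚₚ.≤-refl , subst (Sat false sys) (sym (⊖-zero _ u)) (generators j))

    centre-∷ : Sat true S′ (centre ⊕ u)
    centre-∷ = proj₁ (open-fibre (centre ⊕ u)) 1ℚ (0<1 , subst (Sat true sys) (sym (⊕-⊖-one centre u)) centre-interior)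

  module _ {D n : ℕ} {N : ℚ} (u : Pt D) {us : Vec (Pt D) n} (τ : Lin D) (0<τu : 0ℚ < ap τ u)
           (0≤τ : ∀ i → 0ℚ ≤ ap τ (lookup us i)) (C : ConeSystem N us) where
    open ConeSystem C

    private
      -- `τ` is nonnegative on the cone and negative at `-u`.
      pointed : ¬ Sat false sys (0V ⊖ 1ℚ • u)
      pointed p = ℚₚ.<-irrefl refl (ℚₚ.<-≤-trans (ℚₚ.neg-antimono-< 0<τu)
        (subst (0ℚ ≤_) (trans (Lin.ap-⊖• τ 0V 1ℚ u) (trans (cong (_- 1ℚ * ap τ u) (Lin.ap-0V τ)) (l (ap τ u))))
          (Cone-nonneg τ us 0≤τ (to (membership _) p))))
        where
        l : ∀ a → 0ℚ - 1ℚ * a ≡ - a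
        l = solve-∀ ℚ-ring

      dependent : All (λ e → ap e u ≡ 0ℚ) (eqs sys) → ConeSystem N (u ∷ us)
      dependent h = record
        { sys = fourierMotzkin sys u h pointed
        ; rank = rank
        ; membership = membership-∷ C adds
        ; generators = generators-∷ C adds
        ; centre = centre ⊕ u
        ; centre-interior = centre-∷ C adds
        ; Ω-Φ = λ x → trans (cong (λ ρ → Ω (N • u ∷ map (N •_) (V.toList us)) (Φ (fourierMotzkin sys u h pointed) ρ) x) (l (altSign rank)))
            (Ω-adds-ray adds N (altSign rank) (map (N •_) (V.toList us)) Ω-Φ x)
        ; coords = coords
        ; coords-injective = coords-injective
        ; basis = basis
        ; basis-generators = λ i → let (j , e) = basis-generators i in suc j , e
        ; basis-independent = basis-independent
        }
        where
        adds = fourierMotzkin-adds-ray sys u h pointed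
        l : ∀ a → a ≡ - (- 1ℚ) * a
        l = solve-∀ ℚ-ring

      independent : ∀ e → e ∈ eqs sys → ap e u ≢ 0ℚ → ConeSystem N (u ∷ us)
      independent e e∈ eu≢0 = record
        { sys = G
        ; rank = suc rank
        ; membership = membership-∷ C adds
        ; generators = generators-∷ C adds
        ; centre = centre ⊕ u
        ; centre-interior = centre-∷ C adds
        ; Ω-Φ = λ x → trans (cong (λ ρ → Ω (N • u ∷ map (N •_) (V.toList us)) (Φ G ρ) x) (l (altSign rank)))
            (Ω-adds-ray adds N (altSign rank) (map (N •_) (V.toList us)) Ω-Φ x)
        ; coords = h ∷ V.map along coords
        ; coords-injective = injective
        ; basis = u ∷ basis
        ; basis-generators = λ { zero → zero , refl ; (suc i) → let (j , e) = basis-generators i in suc j , e }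
        ; basis-independent = indep
        }
        where
        G = gauss sys u e e∈ eu≢0
        adds = gauss-adds-ray sys u e e∈ eu≢0
        h = height sys u e e∈ eu≢0
        along = alongRay sys u e e∈ eu≢0
        l : ∀ a → - a ≡ - 1ℚ * a
        l = solve-∀ ℚ-ring
        injective : ∀ x → All (λ f → ap f x ≡ 0ℚ) (eqs G) → (∀ i → ap (lookup (h ∷ V.map along coords) i) x ≡ 0ℚ) → x ≡ 0V
        -- Where the new coordinate `h` vanishes, projecting along `u` changes nothing, so the old
        -- coordinates decide about `x` itself.
        injective x p q = trans (sym (trans (cong (λ s → x ⊖ s • u) (q zero)) (⊖-zero x u)))
          (coords-injective (x ⊖ ap h x • u)
            (All.map (λ {f} → trans (sym (alongRay-correct sys u e e∈ eu≢0 f x))) (Allₚ.map⁻ p))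
            (λ i → trans (sym (alongRay-correct sys u e e∈ eu≢0 (lookup coords i) x))
              (trans (cong (λ f → ap f x) (sym (Vₚ.lookup-map i along coords))) (q (suc i)))))
        basis-e : ∀ i → ap e (lookup basis i) ≡ 0ℚ
        basis-e i = let (j , eq) = basis-generators i in
          trans (cong (ap e) eq) (All.lookup (proj₁ (generators j)) e∈)
        indep : LinIndep (u ∷ basis)
        indep (m ∷ μ) eq = λ { zero → m≡0 ; (suc i) → basis-independent μ rest i }
          where
          -- The old generators satisfy `e` and `u` does not, so applying `e` to the relation
          -- isolates the coefficient of `u`.
          m≡0 : m ≡ 0ℚ
          m≡0 = *-cancel-zero eu≢0 (begin
            ap e u * m                               ≡⟨ ℚₚ.*-comm (ap e u) m ⟩
            m * ap e u                               ≡⟨ ℚₚ.+-identityʳ (m * ap e u) ⟨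
            m * ap e u + 0ℚ                          ≡⟨ cong₂ _+_ (Lin.ap-• e m u) (ap-combo-zero e basis basis-e μ) ⟨
            ap e (m • u) + ap e (combo μ basis)      ≡⟨ Lin.ap-⊕ e (m • u) (combo μ basis) ⟨
            ap e ((m • u) ⊕ combo μ basis)             ≡⟨ cong (ap e) eq ⟩
            ap e 0V                                  ≡⟨ Lin.ap-0V e ⟩
            0ℚ                                       ∎)
            where open ≡-Reasoning
          rest : combo μ basis ≡ 0V
          rest = trans (sym (0•-⊕ u (combo μ basis))) (trans (cong (λ s → (s • u) ⊕ combo μ basis) (sym m≡0)) eq)

    coneSystem-∷ : ConeSystem N (u ∷ us)
    coneSystem-∷ with All.all? (λ e → ap e u ℚₚ.≟ 0ℚ) (eqs sys)
    ... | yes h = dependent h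
    ... | no ¬h with find (Allₚ.¬All⇒Any¬ (λ e → ap e u ℚₚ.≟ 0ℚ) (eqs sys) ¬h)
    ... | e , e∈ , eu≢0 = independent e e∈ eu≢0

  coneSystem : ∀ {D n} N (τ : Lin D) (us : Vec (Pt D) n) → (∀ i → 0ℚ < ap τ (lookup us i)) → ConeSystem N us
  coneSystem N τ [] h = coneSystem-[] N
  coneSystem N τ (u ∷ us) h = coneSystem-∷ u τ (h zero) (λ i → ℚₚ.<⇒≤ (h (suc i))) (coneSystem N τ us (h ∘ suc))

  -- Linear dependence by elimination

  module _ {D : ℕ} (f : Lin D) where
    private
      module _ (v : Pt D) (c : ℚ) where
        reduce : Pt D → Pt D
        reduce w = w ⊖ (ap f w * c) • v

        rearrange : ∀ {D} (w v z : Pt D) m a k → (m • (w ⊖ a • v)) ⊕ ((k • v) ⊕ z) ≡ ((k - m * a) • v) ⊕ ((m • w) ⊕ z)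
        rearrange [] [] [] m a k = refl
        rearrange (w ∷ ws) (v ∷ vs) (z ∷ zs) m a k = cong₂ _∷_ (l w v z m a k) (rearrange ws vs zs m a k)
          where
          l : ∀ w v z m a k → m * (w - a * v) + (k * v + z) ≡ (k - m * a) * v + (m * w + z)
          l = solve-∀ ℚ-ring

        combo-reduce : ∀ {n} (ws : Vec (Pt D) n) μ → ∃ λ k → (k • v) ⊕ combo μ ws ≡ combo μ (V.map reduce ws)
        combo-reduce [] [] = 0ℚ , 0•-⊕ v 0V
        combo-reduce (w ∷ ws) (m ∷ μ) = let (k , e) = combo-reduce ws μ in
          k - m * (ap f w * c) , trans (sym (rearrange w v (combo μ ws) m (ap f w * c) k)) (cong (λ z → (m • reduce w) ⊕ z) e)

    -- One vector is spent as a pivot to make `f` vanish on the others. The last clause says that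
    -- nonzero coefficients on `ws` pull back to nonzero coefficients on `vs`.
    eliminate : ∀ {n} (vs : Vec (Pt D) (suc n)) → Σ (Vec (Pt D) n) λ ws →
      (∀ i → ap f (lookup ws i) ≡ 0ℚ) ×
      (∀ μ′ → ∃ λ μ → combo μ vs ≡ combo μ′ ws × ((∀ i → lookup μ i ≡ 0ℚ) → ∀ i → lookup μ′ i ≡ 0ℚ))
    eliminate (v ∷ vs) with ap f v ℚₚ.≟ 0ℚ
    -- With no pivot to be found, a vector still has to go, and the last one is dropped.
    eliminate (v ∷ []) | yes _ = [] , (λ ()) , λ { [] → 0ℚ ∷ [] , 0•-⊕ v 0V , λ _ () }
    eliminate (v ∷ vs@(_ ∷ _)) | yes fv≡0 = let (ws , h , g) = eliminate vs in
      v ∷ ws , (λ { zero → fv≡0 ; (suc i) → h i }) ,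
      λ { (m ∷ μ′) → let (μ , e , z) = g μ′ in m ∷ μ , cong (λ t → (m • v) ⊕ t) e ,
          λ h₀ → λ { zero → h₀ zero ; (suc i) → z (h₀ ∘ suc) i } }
    eliminate (v ∷ vs) | no fv≢0 = V.map (reduce v c) vs ,
      (λ i → trans (cong (ap f) (Vₚ.lookup-map i (reduce v c) vs)) (killed (lookup vs i))) ,
      λ μ′ → let (k , e) = combo-reduce v c vs μ′ in k ∷ μ′ , e , λ z → z ∘ suc
      where
      c = proj₁ (inverse (ap f v) fv≢0)
      killed : ∀ w → ap f (reduce v c w) ≡ 0ℚ
      killed w = trans (Lin.ap-⊖• f w (ap f w * c) v) (trans (l (ap f w) c (ap f v))
        (trans (cong (λ t → ap f w - ap f w * t) (proj₂ (inverse (ap f v) fv≢0))) (r (ap f w))))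
        where
        l : ∀ a c b → a - a * c * b ≡ a - a * (c * b)
        l = solve-∀ ℚ-ring
        r : ∀ a → a - a * 1ℚ ≡ 0ℚ
        r = solve-∀ ℚ-ring

  -- Each functional costs one vector, so some vector is left when all functionals have been dealt
  -- with.
  underdetermined : ∀ {D r n} (fs : Vec (Lin D) r) (vs : Vec (Pt D) n) → r ℕ.< n →
    ∃ λ μ → ¬ (∀ i → lookup μ i ≡ 0ℚ) × (∀ j → ap (lookup fs j) (combo μ vs) ≡ 0ℚ)
  underdetermined [] (v ∷ vs) _ = V.replicate _ 1ℚ , (λ h → 1≢0 (h zero)) , λ ()
  underdetermined (f ∷ fs) (v ∷ vs) (ℕ.s≤s r<n) with eliminate f (v ∷ vs)
  ... | ws , fws , g with underdetermined fs ws r<n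
  ... | μ′ , μ′≢0 , h with g μ′
  ... | μ , e , z = μ , μ′≢0 ∘ z , λ
    { zero → trans (cong (ap f) e) (ap-combo-zero f ws fws μ′)
    ; (suc j) → trans (cong (ap (lookup fs j)) e) (h j) }

  -- The cone over a polytope

  combo-cons : ∀ {d n} t (a : Vec ℚ n) (ps : Vec (Pt d) n) → combo a (V.map (t ∷_) ps) ≡ sumQ a * t ∷ combo a ps
  combo-cons t [] [] = cong (_∷ 0V) (sym (ℚₚ.*-zeroˡ t))
  combo-cons t (s ∷ a) (p ∷ ps) = trans (cong (λ z → (s • (t ∷ p)) ⊕ z) (combo-cons t a ps))
    (cong (_∷ combo (s ∷ a) (p ∷ ps)) (sym (ℚₚ.*-distribʳ-+ t s (sumQ a))))

  •-⊕ : ∀ {D} c (x y : Pt D) → c • (x ⊕ y) ≡ (c • x) ⊕ (c • y)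
  •-⊕ c [] [] = refl
  •-⊕ c (a ∷ x) (b ∷ y) = cong₂ _∷_ (ℚₚ.*-distribˡ-+ c a b) (•-⊕ c x y)

  •-• : ∀ {D} c s (x : Pt D) → c • (s • x) ≡ (c * s) • x
  •-• c s [] = refl
  •-• c s (a ∷ x) = cong₂ _∷_ (sym (ℚₚ.*-assoc c s a)) (•-• c s x)

  1•-identity : ∀ {D} (x : Pt D) → 1ℚ • x ≡ x
  1•-identity [] = refl
  1•-identity (a ∷ x) = cong₂ _∷_ (ℚₚ.*-identityˡ a) (1•-identity x)

  •-0V : ∀ D c → c • 0V {D} ≡ 0V
  •-0V zero c = refl
  •-0V (suc D) c = cong₂ _∷_ (ℚₚ.*-zeroʳ c) (•-0V D c)

  combo-• : ∀ {D n} c (a : Vec ℚ n) (ps : Vec (Pt D) n) → combo (c • a) ps ≡ c • combo a ps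
  combo-• {D} c [] [] = sym (•-0V D c)
  combo-• c (s ∷ a) (p ∷ ps) = trans (cong₂ _⊕_ (sym (•-• c s p)) (combo-• c a ps)) (sym (•-⊕ c (s • p) (combo a ps)))

  sumQ-• : ∀ {n} c (a : Vec ℚ n) → sumQ (c • a) ≡ c * sumQ a
  sumQ-• c [] = sym (ℚₚ.*-zeroʳ c)
  sumQ-• c (s ∷ a) = trans (cong (c * s +_) (sumQ-• c a)) (sym (ℚₚ.*-distribˡ-+ c s (sumQ a)))

  -- Within distance `ε` a functional changes by at most `norm * ε`, so this is a radius around `X`
  -- on which no inequality can turn negative.
  slack : ∀ {D} (X : Pt D) (Is : List (Lin D)) → All (λ i → 0ℚ < ap i X) Is →
    ∃ λ ε → 0ℚ < ε × All (λ i → Lin.norm i * ε ≤ ap i X) Is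
  slack X [] [] = 1ℚ , 0<1 , []
  slack X (i ∷ Is) (p ∷ ps) with slack X Is ps
  ... | ε , 0<ε , h = choose (ℚₚ.≤-total δ ε)
    where
    n = Lin.norm i
    0<n+1 : 0ℚ < 1ℚ + n
    0<n+1 = 0≺-+ true 0<1 (Lin.0≤norm i)
    c = proj₁ (pos-inverse 0<n+1)
    0<c = proj₁ (proj₂ (pos-inverse 0<n+1))
    ce = proj₂ (proj₂ (pos-inverse 0<n+1))
    -- The 1 added to the norm keeps the divisor positive for the zero functional.
    δ = c * ap i X
    0<δ : 0ℚ < δ
    0<δ = 0≺-* true c 0<c p
    nδ : n * δ ≤ ap i X
    nδ = ≺-shift false (trans (l δ n) (cong (_- n * δ) back)) (ℚₚ.<⇒≤ 0<δ)
      where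
      l : ∀ d n → d - 0ℚ ≡ (1ℚ + n) * d - n * d
      l = solve-∀ ℚ-ring
      r : ∀ m c x → m * (c * x) ≡ c * m * x
      r = solve-∀ ℚ-ring
      back : (1ℚ + n) * δ ≡ ap i X
      back = trans (r (1ℚ + n) c (ap i X)) (trans (cong (_* ap i X) ce) (ℚₚ.*-identityˡ (ap i X)))
    mono : ∀ {a b} (f : Lin _) → a ≤ b → Lin.norm f * a ≤ Lin.norm f * b
    mono f q = ℚₚ.*-monoˡ-≤-nonNeg (Lin.norm f) {{ℚ.nonNegative (Lin.0≤norm f)}} q
    choose : (δ ≤ ε ⊎ ε ≤ δ) → ∃ λ ε′ → 0ℚ < ε′ × All (λ i → Lin.norm i * ε′ ≤ ap i X) (i ∷ Is)
    choose (inj₁ δ≤ε) = δ , 0<δ , nδ ∷ All.map (λ {j} → ℚₚ.≤-trans (mono j δ≤ε)) h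
    choose (inj₂ ε≤δ) = ε , 0<ε , ℚₚ.≤-trans (mono i ε≤δ) nδ ∷ h

  ≤-abs : ∀ q → q ≤ ∣ q ∣
  ≤-abs q with ℚₚ.≤-total 0ℚ q
  ... | inj₁ p = ℚₚ.≤-reflexive (sym (ℚₚ.0≤p⇒∣p∣≡p p))
  ... | inj₂ p = ℚₚ.≤-trans p (ℚₚ.0≤∣p∣ q)

  entry-bound : ∀ {n} (x : Vec ℚ n) → ∃ λ B → 0ℚ ≤ B × (∀ i → ∣ lookup x i ∣ ≤ B)
  entry-bound [] = 0ℚ , ℚₚ.≤-refl , λ ()
  entry-bound (a ∷ x) with entry-bound x
  ... | B , 0≤B , h = ∣ a ∣ + B , 0≺-+ false (ℚₚ.0≤∣p∣ a) 0≤B , λ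
    { zero → subst (_≤ ∣ a ∣ + B) (ℚₚ.+-identityʳ ∣ a ∣) (ℚₚ.+-monoʳ-≤ ∣ a ∣ 0≤B)
    ; (suc i) → ℚₚ.≤-trans (h i) (subst (_≤ ∣ a ∣ + B) (ℚₚ.+-identityˡ B) (ℚₚ.+-monoˡ-≤ B (ℚₚ.0≤∣p∣ a))) }

  homogenize : ∀ {d n} → Vec (Pt d) n → Vec (Pt (suc d)) n
  homogenize = V.map (1ℚ ∷_)

  module Polytope {d n : ℕ} (gens : Vec (Pt d) n) (N : ℚ) (C : ConeSystem N (homogenize gens)) where
    open ConeSystem C

    Slice : ℚ → PSet d
    Slice t x = Σ (Pt d) λ y → Conv gens y × x ≡ t • y

    -- All generators have height 1, so cone coefficients of a point at height `t` sum to `t`, and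
    -- dividing by `t` makes them convex.
    Sat⇔Slice : ∀ {t} x → 0ℚ < t → Sat false sys (t ∷ x) ⇔ Slice t x
    Sat⇔Slice {t} x 0<t = mk⇔ there′ back
      where
      t⁻¹ = proj₁ (pos-inverse 0<t)
      0<t⁻¹ = proj₁ (proj₂ (pos-inverse 0<t))
      t⁻¹t = proj₂ (proj₂ (pos-inverse 0<t))
      there′ : Sat false sys (t ∷ x) → Slice t x
      there′ p with to (membership (t ∷ x)) p
      ... | a , 0≤a , e with Vₚ.∷-injective (trans (sym (combo-cons 1ℚ a gens)) e)
      ... | e₁ , e₂ = t⁻¹ • x ,
        ( t⁻¹ • a
        , (λ i → subst (0ℚ ≤_) (sym (Vₚ.lookup-map i (t⁻¹ *_) a)) (0≤-* (ℚₚ.<⇒≤ 0<t⁻¹) (0≤a i)))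
        , trans (sumQ-• t⁻¹ a) (trans (cong (t⁻¹ *_) (trans (sym (ℚₚ.*-identityʳ (sumQ a))) e₁)) t⁻¹t)
        , trans (combo-• t⁻¹ a gens) (cong (t⁻¹ •_) e₂)) ,
        sym (trans (•-• t t⁻¹ x) (trans (cong (_• x) (trans (ℚₚ.*-comm t t⁻¹) t⁻¹t)) (1•-identity x)))
      back : Slice t x → Sat false sys (t ∷ x)
      back (y , (μ , 0≤μ , s , e) , refl) = from (membership (t ∷ (t • y))) (t • μ ,
        (λ i → subst (0ℚ ≤_) (sym (Vₚ.lookup-map i (t *_) μ)) (0≤-* (ℚₚ.<⇒≤ 0<t) (0≤μ i))) ,
        trans (combo-cons 1ℚ (t • μ) gens) (cong₂ _∷_
          (trans (ℚₚ.*-identityʳ (sumQ (t • μ))) (trans (sumQ-• t μ) (trans (cong (t *_) s) (ℚₚ.*-identityʳ t))))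
          (trans (combo-• t μ gens) (cong (t •_) e))))

    module _ (k : ℕ) (0<t : 0ℚ < ℕtoℚ k) where
      private
        t = ℕtoℚ k

        -- Affine coefficients sum to 1, so the lift of `y` to height `t` is the same combination of
        -- the lifted points, which satisfy the equations.
        eqs-affine : ∀ {y} → AffHull (Dil k (Conv gens)) y → All (λ e → ap e (t ∷ y) ≡ 0ℚ) (eqs sys)
        eqs-affine {y} (m , ps , μ , h , s , e) = All.tabulate λ {f} f∈ → trans
          (cong (ap f) (sym (trans (combo-cons t μ ps) (cong₂ _∷_ (trans (cong (_* t) s) (ℚₚ.*-identityˡ t)) e))))
          (ap-combo-zero f (V.map (t ∷_) ps) (λ i → trans (cong (ap f) (Vₚ.lookup-map i (t ∷_) ps))
            (All.lookup (proj₁ (from (Sat⇔Slice (lookup ps i) 0<t) (h i))) f∈)) μ)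

      RelInt⇐ : ∀ x → Sat true sys (t ∷ x) → RelInt (Dil k (Conv gens)) x
      RelInt⇐ x p = to (Sat⇔Slice x 0<t) (Sat-weaken false {sys} p) , ε , 0<ε , λ y aff close →
        to (Sat⇔Slice y 0<t) (eqs-affine aff , All.map (λ {i} → near y close i) small)
        where
        ε = proj₁ (slack (t ∷ x) (ineqs sys) (proj₂ p))
        0<ε = proj₁ (proj₂ (slack (t ∷ x) (ineqs sys) (proj₂ p)))
        small = proj₂ (proj₂ (slack (t ∷ x) (ineqs sys) (proj₂ p)))
        near : ∀ y → (∀ i → ∣ lookup x i - lookup y i ∣ < ε) → ∀ i → Lin.norm i * ε ≤ ap i (t ∷ x) → 0ℚ ≤ ap i (t ∷ y)
        near y close i q = ≺-shift false (trans (cong (λ z → ap i (t ∷ x) - z) (Lin.ap-⊖ i (t ∷ x) (t ∷ y))) (l (ap i (t ∷ x)) (ap i (t ∷ y))))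
          (ℚₚ.≤-trans (≤-abs (ap i ((t ∷ x) ⊖ (t ∷ y))))
            (ℚₚ.≤-trans (Lin.ap-bound i ((t ∷ x) ⊖ (t ∷ y)) ε entries (ℚₚ.<⇒≤ 0<ε)) q))
          where
          l : ∀ a b → a - (a - b) ≡ b - 0ℚ
          l = solve-∀ ℚ-ring
          entries : ∀ i → ∣ lookup ((t ∷ x) ⊖ (t ∷ y)) i ∣ ≤ ε
          entries zero = subst (λ a → ∣ a ∣ ≤ ε) (sym (ℚₚ.+-inverseʳ t)) (ℚₚ.<⇒≤ 0<ε)
          entries (suc i) = subst (λ a → ∣ a ∣ ≤ ε) (sym (Vₚ.lookup-zipWith _-_ i x y)) (ℚₚ.<⇒≤ (close i))

      -- Suppose an inequality is tight at `x`. A short step from an interior point `z` through `x`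
      -- and beyond stays in the dilate, but the functional, positive at `z` and zero at `x`, is
      -- negative there.
      RelInt⇒ : ∀ x → RelInt (Dil k (Conv gens)) x → Sat true sys (t ∷ x)
      RelInt⇒ x (x∈S , ε , 0<ε , ball) = proj₁ X∈ , All.tabulate λ {i} i∈ →
        ≺-≢⇒< false (All.lookup (proj₂ X∈) i∈) (λ iX≡0 → ℚₚ.<-irrefl refl (ℚₚ.<-≤-trans
          (ℚₚ.neg-antimono-< (0≺-* true η 0<η (All.lookup (proj₂ Z∈) i∈)))
          (subst (0ℚ ≤_) (value i (sym iX≡0)) (All.lookup (proj₂ Y∈) i∈))))
        where
        X = t ∷ x
        X∈ : Sat false sys X
        X∈ = from (Sat⇔Slice x 0<t) x∈S
        -- The centre is only known to have nonnegative height. Adding `X` keeps all inequalities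
        -- strict and makes the height positive, so that the sum can be rescaled to height `t`.
        W = centre ⊕ X
        h = lookup W zero
        0<h : 0ℚ < h
        0<h = subst (0ℚ <_) (trans (ℚₚ.+-comm t (ap (coordinate zero) centre)) (sym (Lin.ap-⊕ (coordinate zero) centre X)))
          (0≺-+ true 0<t (Cone-nonneg (coordinate zero) (homogenize gens)
            (λ i → subst (λ u → 0ℚ ≤ lookup u zero) (sym (Vₚ.lookup-map i (1ℚ ∷_) gens)) 0≤1)
            (to (membership centre) (Sat-weaken false {sys} centre-interior))))
        h⁻¹ = proj₁ (pos-inverse 0<h)
        0<h⁻¹ = proj₁ (proj₂ (pos-inverse 0<h))
        h⁻¹h = proj₂ (proj₂ (pos-inverse 0<h))
        c = t * h⁻¹
        z = V.tail (c • W)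
        cons-head-tail : ∀ {m} (v : Pt (suc m)) → V.head (c • v) ∷ V.tail (c • v) ≡ c • v
        cons-head-tail (_ ∷ _) = refl
        head-• : ∀ {m} (v : Pt (suc m)) → V.head (c • v) ≡ c * lookup v zero
        head-• (_ ∷ _) = refl
        Z≡ : c • W ≡ t ∷ z
        Z≡ = trans (sym (cons-head-tail W)) (cong (_∷ z) (trans (head-• W)
          (trans (ℚₚ.*-assoc t h⁻¹ h) (trans (cong (t *_) h⁻¹h) (ℚₚ.*-identityʳ t)))))
        Z∈ : Sat true sys (t ∷ z)
        Z∈ = subst (Sat true sys) Z≡ (Sat-scale true {sys} (0≺-* true t 0<t 0<h⁻¹) (Sat-⊕ true {sys} centre-interior X∈))
        B = proj₁ (entry-bound (x ⊖ z))
        0<B+1 : 0ℚ < 1ℚ + B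
        0<B+1 = 0≺-+ true 0<1 (proj₁ (proj₂ (entry-bound (x ⊖ z))))
        b⁻¹ = proj₁ (pos-inverse 0<B+1)
        0<b⁻¹ = proj₁ (proj₂ (pos-inverse 0<B+1))
        b⁻¹b = proj₂ (proj₂ (pos-inverse 0<B+1))
        -- The point `y` below is `x + η (x - z)`. Dividing by `1 + B`, which exceeds all entries of
        -- `x - z`, places it strictly within `ε` of `x`.
        η = ε * b⁻¹
        0<η : 0ℚ < η
        0<η = 0≺-* true ε 0<ε 0<b⁻¹
        y = (x ⊖ (- η) • x) ⊖ η • z
        entry : ∀ i → lookup x i - lookup y i ≡ - η * lookup (x ⊖ z) i
        entry i = trans (cong (λ a → lookup x i - a) (trans (Lin.ap-⊖• (coordinate i) (x ⊖ (- η) • x) η z)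
            (cong (_- η * lookup z i) (Lin.ap-⊖• (coordinate i) x (- η) x))))
          (trans (l (lookup x i) (lookup z i) η) (cong (- η *_) (sym (Vₚ.lookup-zipWith _-_ i x z))))
          where
          l : ∀ a b e → a - (a - - e * a - e * b) ≡ - e * (a - b)
          l = solve-∀ ℚ-ring
        close : ∀ i → ∣ lookup x i - lookup y i ∣ < ε
        close i = subst (_< ε) (sym (trans (cong ∣_∣ (entry i)) (trans (ℚₚ.∣p*q∣≡∣p∣*∣q∣ (- η) (lookup (x ⊖ z) i))
            (cong (_* ∣ lookup (x ⊖ z) i ∣) (trans (ℚₚ.∣-p∣≡∣p∣ η) (ℚₚ.0≤p⇒∣p∣≡p (ℚₚ.<⇒≤ 0<η)))))))
          (ℚₚ.≤-<-trans (ℚₚ.*-monoˡ-≤-nonNeg η {{ℚ.nonNegative (ℚₚ.<⇒≤ 0<η)}} (proj₂ (proj₂ (entry-bound (x ⊖ z))) i))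
            (≺-shift true (trans (l η B) (cong (_- η * B) (trans (r ε b⁻¹ (1ℚ + B)) (trans (cong (ε *_) b⁻¹b) (ℚₚ.*-identityʳ ε))))) 0<η))
          where
          l : ∀ e b → e - 0ℚ ≡ e * (1ℚ + b) - e * b
          l = solve-∀ ℚ-ring
          r : ∀ e c b → e * c * b ≡ e * (c * b)
          r = solve-∀ ℚ-ring
        combine : ∀ {D} (x z : Pt D) → ((1ℚ + η) • x) ⊕ (((- η) • z) ⊕ 0V) ≡ (x ⊖ (- η) • x) ⊖ η • z
        combine [] [] = refl
        combine (a ∷ x) (b ∷ z) = cong₂ _∷_ (l a b η) (combine x z)
          where
          l : ∀ a b e → (1ℚ + e) * a + (- e * b + 0ℚ) ≡ a - - e * a - e * b
          l = solve-∀ ℚ-ring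
        y∈S : Dil k (Conv gens) y
        y∈S = ball y (2 , x ∷ z ∷ [] , (1ℚ + η) ∷ (- η) ∷ [] ,
          (λ { zero → x∈S ; (suc zero) → to (Sat⇔Slice z 0<t) (Sat-weaken false {sys} Z∈) }) , l η , combine x z) close
          where
          l : ∀ e → 1ℚ + e + (- e + 0ℚ) ≡ 1ℚ
          l = solve-∀ ℚ-ring
        Y∈ : Sat false sys ((X ⊖ (- η) • X) ⊖ η • (t ∷ z))
        Y∈ = subst (Sat false sys) (cong (_∷ y) (l t η)) (from (Sat⇔Slice y 0<t) y∈S)
          where
          l : ∀ t e → t ≡ t - - e * t - e * t
          l = solve-∀ ℚ-ring
        value : ∀ i → ap i X ≡ 0ℚ → ap i ((X ⊖ (- η) • X) ⊖ η • (t ∷ z)) ≡ - (η * ap i (t ∷ z))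
        value i iX≡0 = trans (Lin.ap-⊖• i (X ⊖ (- η) • X) η (t ∷ z))
          (trans (cong (_- η * ap i (t ∷ z)) (trans (Lin.ap-⊖• i X (- η) X) (cong (λ a → a - - η * a) iX≡0))) (l η (ap i (t ∷ z))))
          where
          l : ∀ e a → 0ℚ - - e * 0ℚ - e * a ≡ - (e * a)
          l = solve-∀ ℚ-ring

    gens∈Conv : ∀ j → Conv gens (lookup gens j)
    gens∈Conv j with to (Sat⇔Slice (lookup gens j) 0<1) (subst (Sat false sys) (Vₚ.lookup-map j (1ℚ ∷_) gens) (generators j))
    ... | y , y∈ , e = subst (Conv gens) (sym (trans e (1•-identity y))) y∈

    -- Affine independence of points is linear independence of their lifts to height 1. Hence
    -- `basis` gives `rank` such points, and `coords` leaves room for no more.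
    HasDim⇒rank : ∀ {δ} → HasDim (Conv gens) δ → δ ≡ (ℤ.+ rank) ℤ.- (ℤ.+ 1)
    HasDim⇒rank (m , δ≡ , (ps , ps∈ , ps-indep) , maximal) = trans δ≡ (cong (λ r → (ℤ.+ r) ℤ.- (ℤ.+ 1)) (ℕₚ.≤-antisym m≤rank rank≤m))
      where
      bs = V.map V.tail basis
      basis≡ : homogenize bs ≡ basis
      basis≡ = vec-ext λ i → let (j , e) = basis-generators i in
        trans (trans (Vₚ.lookup-map i (1ℚ ∷_) bs) (cong (1ℚ ∷_) (Vₚ.lookup-map i V.tail basis)))
          (trans (cong (λ v → 1ℚ ∷ V.tail v) (trans e (Vₚ.lookup-map j (1ℚ ∷_) gens))) (sym (trans e (Vₚ.lookup-map j (1ℚ ∷_) gens))))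
      bs∈ : ∀ i → Conv gens (lookup bs i)
      bs∈ i = let (j , e) = basis-generators i in
        subst (Conv gens) (sym (trans (Vₚ.lookup-map i V.tail basis) (cong V.tail (trans e (Vₚ.lookup-map j (1ℚ ∷_) gens))))) (gens∈Conv j)
      rank≤m : rank ℕ.≤ m
      rank≤m = maximal rank bs bs∈ λ μ s e → basis-independent μ
        (trans (cong (combo μ) (sym basis≡)) (trans (combo-cons 1ℚ μ bs) (cong₂ _∷_ (trans (cong (_* 1ℚ) s) (ℚₚ.*-zeroˡ 1ℚ)) e)))
      m≤rank : m ℕ.≤ rank
      m≤rank = ℕₚ.≮⇒≥ λ rank<m →
        let (μ , μ≢0 , h) = underdetermined coords (homogenize ps) rank<m
            vanish = coords-injective (combo μ (homogenize ps))
              (All.tabulate λ {f} f∈ → ap-combo-zero f (homogenize ps) (λ i → trans (cong (ap f) (Vₚ.lookup-map i (1ℚ ∷_) ps))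
                (All.lookup (proj₁ (from (Sat⇔Slice (lookup ps i) 0<1) (lookup ps i , ps∈ i , sym (1•-identity _)))) f∈)) μ) h
            (s , e) = Vₚ.∷-injective (trans (sym (combo-cons 1ℚ μ ps)) vanish)
        in μ≢0 (ps-indep μ (trans (sym (ℚₚ.*-identityʳ (sumQ μ))) s) e)

  -- Integers inside the rationals, and integral powers

  fromℤ : ℤ → ℚ
  fromℤ z = ℚ.mkℚ z 0 (Coprimality.sym (Coprimality.1-coprimeTo ℤ.∣ z ∣))

  -- `z / 1` is normalised by a gcd and does not compute for a variable `z`. In `fromℤ z` numerator
  -- and denominator are visible, which carries integer facts over.
  /1≡fromℤ : ∀ z → z / 1 ≡ fromℤ z
  /1≡fromℤ z = ℚₚ.↥p/↧p≡p (fromℤ z)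

  /1-+ : ∀ a b → (a ℤ.+ b) / 1 ≡ a / 1 + b / 1
  /1-+ a b = trans (cong₂ (λ x y → (x ℤ.+ y) / 1) (sym (ℤₚ.*-identityʳ a)) (sym (ℤₚ.*-identityʳ b)))
    (cong₂ _+_ (sym (/1≡fromℤ a)) (sym (/1≡fromℤ b)))

  /1-* : ∀ a b → (a ℤ.* b) / 1 ≡ (a / 1) * (b / 1)
  /1-* a b = cong₂ _*_ (sym (/1≡fromℤ a)) (sym (/1≡fromℤ b))

  /1-- : ∀ a b → (a ℤ.- b) / 1 ≡ a / 1 - b / 1
  /1-- a b = trans (l ((a ℤ.- b) / 1) (b / 1)) (cong (_- b / 1) (trans (sym (/1-+ (a ℤ.- b) b)) (cong (_/ 1) (r a b))))
    where
    l : ∀ x y → x ≡ x + y - y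
    l = solve-∀ ℚ-ring
    r : ∀ a b → a ℤ.- b ℤ.+ b ≡ a
    r = ℤSolver.solve-∀

  /1-neg : ∀ a → (ℤ.- a) / 1 ≡ - (a / 1)
  /1-neg a = trans (cong (_/ 1) (sym (ℤₚ.+-identityˡ (ℤ.- a)))) (trans (/1-- (ℤ.+ 0) a) (ℚₚ.+-identityˡ (- (a / 1))))

  /1-injective : ∀ {a b} → a / 1 ≡ b / 1 → a ≡ b
  /1-injective {a} {b} e = cong ℚ.numerator (trans (sym (/1≡fromℤ a)) (trans e (/1≡fromℤ b)))

  /1-mono-< : ∀ {a b} → a ℤ.< b → a / 1 < b / 1
  /1-mono-< {a} {b} p = subst₂ _<_ (sym (/1≡fromℤ a)) (sym (/1≡fromℤ b))
    (ℚ.*<* (subst₂ ℤ._<_ (sym (ℤₚ.*-identityʳ a)) (sym (ℤₚ.*-identityʳ b)) p))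

  /1-mono-≤ : ∀ {a b} → a ℤ.≤ b → a / 1 ≤ b / 1
  /1-mono-≤ {a} {b} p = subst₂ _≤_ (sym (/1≡fromℤ a)) (sym (/1≡fromℤ b))
    (ℚ.*≤* (subst₂ ℤ._≤_ (sym (ℤₚ.*-identityʳ a)) (sym (ℤₚ.*-identityʳ b)) p))

  /1-cancel-≤ : ∀ {a b} → a / 1 ≤ b / 1 → a ℤ.≤ b
  /1-cancel-≤ {a} {b} p with subst₂ _≤_ (/1≡fromℤ a) (/1≡fromℤ b) p
  ... | ℚ.*≤* q = subst₂ ℤ._≤_ (ℤₚ.*-identityʳ a) (ℤₚ.*-identityʳ b) q

  ∣/1∣ : ∀ a → ∣ a / 1 ∣ ≡ (ℤ.+ ℤ.∣ a ∣) / 1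
  ∣/1∣ (ℤ.+ n) = trans (cong ∣_∣ (/1≡fromℤ (ℤ.+ n))) (sym (/1≡fromℤ (ℤ.+ n)))
  ∣/1∣ -[1+ n ] = trans (cong ∣_∣ (/1≡fromℤ -[1+ n ])) (sym (/1≡fromℤ (ℤ.+ suc n)))

  archimedean : ∀ q → ∃ λ B → q ≤ ℕtoℚ B
  archimedean q@(ℚ.mkℚ n d c) = ℤ.∣ n ∣ , subst (q ≤_) (sym (/1≡fromℤ (ℤ.+ ℤ.∣ n ∣)))
    (ℚ.*≤* (subst (ℤ._≤ (ℤ.+ ℤ.∣ n ∣) ℤ.* (ℤ.+ suc d)) (sym (ℤₚ.*-identityʳ n)) (bound n)))
    where
    bound : ∀ n → n ℤ.≤ (ℤ.+ ℤ.∣ n ∣) ℤ.* (ℤ.+ suc d)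
    bound (ℤ.+ n) = subst (ℤ._≤_ (ℤ.+ n)) (ℤₚ.pos-* n (suc d)) (ℤ.+≤+ (ℕₚ.m≤m*n n (suc d)))
    bound -[1+ n ] = ℤ.-≤+

  0<ℕtoℚ : ∀ n → 0 ℕ.< n → 0ℚ < ℕtoℚ n
  0<ℕtoℚ n p = /1-mono-< {ℤ.+ 0} {ℤ.+ n} (ℤ.+<+ p)

  pow : ℚ → ℕ → ℚ
  pow w zero = 1ℚ
  pow w (suc n) = w * pow w n

  pow-+ : ∀ w m n → pow w (m ℕ.+ n) ≡ pow w m * pow w n
  pow-+ w zero n = sym (ℚₚ.*-identityˡ (pow w n))
  pow-+ w (suc m) n = trans (cong (w *_) (pow-+ w m n)) (sym (ℚₚ.*-assoc w (pow w m) (pow w n)))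

  -- With the inverse as an argument, exchanging the two arguments expresses the passage from q to
  -- 1/q.
  zpow : ℚ → ℚ → ℤ → ℚ
  zpow w w⁻¹ (ℤ.+ n) = pow w n
  zpow w w⁻¹ -[1+ n ] = pow w⁻¹ (suc n)

  module Powers (w w⁻¹ : ℚ) (inv : w⁻¹ * w ≡ 1ℚ) where
    zpow-⊖ : ∀ m n → zpow w w⁻¹ (m ℤ.⊖ n) ≡ pow w m * pow w⁻¹ n
    zpow-⊖ zero zero = refl
    zpow-⊖ zero (suc n) = sym (ℚₚ.*-identityˡ (pow w⁻¹ (suc n)))
    zpow-⊖ (suc m) zero = sym (ℚₚ.*-identityʳ (pow w (suc m)))
    zpow-⊖ (suc m) (suc n) = trans (cong (zpow w w⁻¹) (ℤₚ.[1+m]⊖[1+n]≡m⊖n m n)) (trans (zpow-⊖ m n)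
      (trans (trans (sym (ℚₚ.*-identityˡ _)) (cong (_* (pow w m * pow w⁻¹ n)) (sym inv))) (l w⁻¹ w (pow w m) (pow w⁻¹ n))))
      where
      l : ∀ a b c d → a * b * (c * d) ≡ b * c * (a * d)
      l = solve-∀ ℚ-ring

    zpow-+ : ∀ a b → zpow w w⁻¹ (a ℤ.+ b) ≡ zpow w w⁻¹ a * zpow w w⁻¹ b
    zpow-+ (ℤ.+ m) (ℤ.+ n) = pow-+ w m n
    zpow-+ (ℤ.+ m) -[1+ n ] = zpow-⊖ m (suc n)
    zpow-+ -[1+ m ] (ℤ.+ n) = trans (zpow-⊖ n (suc m)) (ℚₚ.*-comm (pow w n) (pow w⁻¹ (suc m)))
    zpow-+ -[1+ m ] -[1+ n ] = trans (cong (λ k → w⁻¹ * pow w⁻¹ k) (sym (ℕₚ.+-suc m n))) (pow-+ w⁻¹ (suc m) (suc n))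

    zpow-neg : ∀ z → zpow w⁻¹ w z ≡ zpow w w⁻¹ (ℤ.- z)
    zpow-neg (ℤ.+ zero) = refl
    zpow-neg (ℤ.+ suc n) = refl
    zpow-neg -[1+ n ] = refl

    zpow-nonzero : ∀ z → zpow w w⁻¹ z ≢ 0ℚ
    zpow-nonzero z e = 1≢0 (trans (cong (zpow w w⁻¹) (sym (ℤₚ.+-inverseʳ z))) (trans (zpow-+ z (ℤ.- z))
      (trans (cong (_* zpow w w⁻¹ (ℤ.- z)) e) (ℚₚ.*-zeroˡ (zpow w w⁻¹ (ℤ.- z))))))

  -- Sums of finitely supported functions

  sumOver-swap : ∀ {A B : Set} (f : A → B → ℚ) xs ys →
    sumOver (λ x → sumOver (f x) ys) xs ≡ sumOver (λ y → sumOver (λ x → f x y) xs) ys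
  sumOver-swap f [] ys = sym (sumOver-zero ys (λ _ → refl))
  sumOver-swap f (x ∷ xs) ys = trans (cong (sumOver (f x) ys +_) (sumOver-swap f xs ys)) (sym (sumOver-+ (f x) (λ y → sumOver (λ x → f x y) xs) ys))

  sumOver-map : ∀ {A B : Set} (φ : A → B) (f : B → ℚ) xs → sumOver f (map φ xs) ≡ sumOver (f ∘ φ) xs
  sumOver-map φ f [] = refl
  sumOver-map φ f (x ∷ xs) = cong (f (φ x) +_) (sumOver-map φ f xs)

  lat-≟ : ∀ {d} (x y : Lat d) → Dec (x ≡ y)
  lat-≟ = Vₚ.≡-dec ℤₚ._≟_

  -- The sum is attached to the function; every duplicate-free list that contains the support
  -- computes it, so the list can be chosen to suit the argument.
  record HasSum {d : ℕ} (f : Lat d → ℚ) (s : ℚ) : Set where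
    constructor hasSum
    field
      list : List (Lat d)
      unique : Unique list
      covers : ∀ m → f m ≢ 0ℚ → m ∈ list
      total : sumOver f list ≡ s

  -- Double counting with a Kronecker delta: where `f` is nonzero, each row and each column contains
  -- exactly one diagonal entry.
  sumOver-unique : ∀ {d} (f : Lat d → ℚ) {xs ys} → Unique xs → Unique ys →
    (∀ {m} → m ∈ xs → f m ≢ 0ℚ → m ∈ ys) → (∀ {m} → m ∈ ys → f m ≢ 0ℚ → m ∈ xs) → sumOver f xs ≡ sumOver f ys
  sumOver-unique f {xs} {ys} ux uy xs⊆ys ys⊆xs = trans
    (sumOver-cong xs (λ {x} x∈ → rows x x∈))
    (trans (sumOver-swap δ xs ys) (sym (sumOver-cong ys (λ {y} y∈ → columns y y∈))))
    where
    δ : _ → _ → ℚ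
    δ x y = indicator (lat-≟ x y) * f y
    δ-diag : ∀ x → δ x x ≡ f x
    δ-diag x = trans (cong (_* f x) (indicator-yes (lat-≟ x x) refl)) (ℚₚ.*-identityˡ (f x))
    δ-off : ∀ x y → x ≢ y → δ x y ≡ 0ℚ
    δ-off x y n = trans (cong (_* f y) (indicator-no (lat-≟ x y) n)) (ℚₚ.*-zeroˡ (f y))
    δ-zero : ∀ x y → f x ≡ 0ℚ ⊎ f y ≡ 0ℚ → δ x y ≡ 0ℚ
    δ-zero x y h with lat-≟ x y | h
    ... | no _ | _ = ℚₚ.*-zeroˡ (f y)
    ... | yes _ | inj₂ e = trans (ℚₚ.*-identityˡ (f y)) e
    ... | yes refl | inj₁ e = trans (ℚₚ.*-identityˡ (f y)) e
    rows : ∀ x → x ∈ xs → f x ≡ sumOver (δ x) ys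
    rows x x∈ with f x ℚₚ.≟ 0ℚ
    ... | yes e = trans e (sym (sumOver-zero ys (λ {y} _ → δ-zero x y (inj₁ e))))
    ... | no ne = sym (trans (sumOver-single uy (xs⊆ys x∈ ne) (λ {y} _ y≢x → δ-off x y (y≢x ∘ sym))) (δ-diag x))
    columns : ∀ y → y ∈ ys → f y ≡ sumOver (λ x → δ x y) xs
    columns y y∈ with f y ℚₚ.≟ 0ℚ
    ... | yes e = trans e (sym (sumOver-zero xs (λ {x} _ → δ-zero x y (inj₂ e))))
    ... | no ne = sym (trans (sumOver-single ux (ys⊆xs y∈ ne) (λ {x} _ x≢y → δ-off x y x≢y)) (δ-diag y))

  module _ {d : ℕ} where
    HasSum-on : ∀ {f : Lat d → ℚ} {s} → HasSum f s → ∀ L → Unique L → (∀ m → f m ≢ 0ℚ → m ∈ L) → sumOver f L ≡ s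
    HasSum-on {f} (hasSum L′ u′ c′ t′) L u c = trans (sumOver-unique f u u′ (λ _ → c′ _) (λ _ → c _)) t′

    HasSum-unique : ∀ {f : Lat d → ℚ} {s t} → HasSum f s → HasSum f t → s ≡ t
    HasSum-unique S (hasSum L u c t) = trans (sym (HasSum-on S L u c)) t

    HasSum-cong : ∀ {f g : Lat d → ℚ} {s} → (∀ m → f m ≡ g m) → HasSum f s → HasSum g s
    HasSum-cong h (hasSum L u c t) = hasSum L u (λ m g≢0 → c m (λ e → g≢0 (trans (sym (h m)) e))) (trans (sumOver-cong L (λ {m} _ → sym (h m))) t)

    HasSum-* : ∀ {f : Lat d → ℚ} {s} c → HasSum f s → HasSum (λ m → c * f m) (c * s)
    HasSum-* {f} k (hasSum L u c t) = hasSum L u (λ m p → c m (λ e → p (trans (cong (k *_) e) (ℚₚ.*-zeroʳ k))))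
      (trans (sumOver-* k f L) (cong (k *_) t))

    HasSum-- : ∀ {f g : Lat d → ℚ} {s t} → HasSum f s → HasSum g t → HasSum (λ m → f m - g m) (s - t)
    HasSum-- {f} {g} {s} {t} F G = hasSum L u cover (begin
        sumOver (λ m → f m - g m) L                     ≡⟨ sumOver-cong L (λ {m} _ → l (f m) (g m)) ⟩
        sumOver (λ m → f m + (- 1ℚ) * g m) L            ≡⟨ sumOver-+ f (λ m → (- 1ℚ) * g m) L ⟩
        sumOver f L + sumOver (λ m → (- 1ℚ) * g m) L    ≡⟨ cong₂ _+_ (HasSum-on F L u cF) (trans (sumOver-* (- 1ℚ) g L) (cong ((- 1ℚ) *_) (HasSum-on G L u cG))) ⟩
        s + (- 1ℚ) * t                                  ≡⟨ l s t ⟨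
        s - t                                           ∎)
      where
      open ≡-Reasoning
      l : ∀ a b → a - b ≡ a + (- 1ℚ) * b
      l = solve-∀ ℚ-ring
      L = deduplicate lat-≟ (HasSum.list F ++ HasSum.list G)
      u = DecUniqueₚ.deduplicate-! lat-≟ (HasSum.list F ++ HasSum.list G)
      cF : ∀ m → f m ≢ 0ℚ → m ∈ L
      cF m p = ∈-deduplicate⁺ lat-≟ (∈-++⁺ˡ (HasSum.covers F m p))
      cG : ∀ m → g m ≢ 0ℚ → m ∈ L
      cG m p = ∈-deduplicate⁺ lat-≟ (∈-++⁺ʳ (HasSum.list F) (HasSum.covers G m p))
      cover : ∀ m → f m - g m ≢ 0ℚ → m ∈ L
      cover m p with f m ℚₚ.≟ 0ℚ | g m ℚₚ.≟ 0ℚ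
      ... | no q | _ = cF m q
      ... | yes _ | no q = cG m q
      ... | yes e | yes e′ = contradiction (cong₂ _-_ e e′) p

    HasSum-reindex : ∀ {f : Lat d → ℚ} {s} (φ ψ : Lat d → Lat d) → (∀ m → ψ (φ m) ≡ m) → (∀ m → φ (ψ m) ≡ m) →
      HasSum f s → HasSum (f ∘ ψ) s
    HasSum-reindex {f} φ ψ ψφ φψ (hasSum L u c t) = hasSum (map φ L)
      (Uniqueₚ.map⁺ (λ {x} {y} e → trans (sym (ψφ x)) (trans (cong ψ e) (ψφ y))) u)
      (λ m p → subst (_∈ map φ L) (φψ m) (∈-map⁺ φ (c (ψ m) p)))
      (trans (sumOver-map φ (f ∘ ψ) L) (trans (sumOver-cong L (λ {m} _ → cong f (ψφ m))) t))

  -- Bi-infinite linear recurrent sequences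

  -- The annihilating operator is kept as a product of factors 1 - c T, where T shifts by a positive
  -- amount. As `c` is nonzero, each factor can be solved backwards.
  data Recurrent (X : ℤ → ℚ) : Set where
    null : (∀ k → X k ≡ 0ℚ) → Recurrent X
    step : ∀ c M → c ≢ 0ℚ → Recurrent (λ k → X k - c * X (k ℤ.- (ℤ.+ suc M))) → Recurrent X

  Recurrent-cong : ∀ {X Y} → (∀ k → X k ≡ Y k) → Recurrent X → Recurrent Y
  Recurrent-cong h (null z) = null (λ k → trans (sym (h k)) (z k))
  Recurrent-cong h (step c M n r) = step c M n (Recurrent-cong (λ k → cong₂ (λ a b → a - c * b) (h k) (h _)) r)

  Recurrent-difference : ∀ {X} c M → Recurrent X → Recurrent (λ k → X k - c * X (k ℤ.- M))
  Recurrent-difference c M (null z) = null (λ k → trans (cong₂ (λ a b → a - c * b) (z k) (z _)) (l c))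
    where
    l : ∀ c → 0ℚ - c * 0ℚ ≡ 0ℚ
    l = solve-∀ ℚ-ring
  Recurrent-difference {X} c M (step c′ M′ n r) = step c′ M′ n (Recurrent-cong
    (λ k → trans (cong (λ j → X k - c′ * X (k ℤ.- M″) - c * (X (k ℤ.- M) - c′ * X j)) (e k M M″))
      (l (X k) (X (k ℤ.- M″)) (X (k ℤ.- M)) (X (k ℤ.- M″ ℤ.- M)) c c′))
    (Recurrent-difference c M r))
    where
    M″ = ℤ.+ suc M′
    e : ∀ k M M′ → k ℤ.- M ℤ.- M′ ≡ k ℤ.- M′ ℤ.- M
    e = ℤSolver.solve-∀
    l : ∀ x y z u c c′ → x - c′ * y - c * (z - c′ * u) ≡ x - c * z - c′ * (y - c * u)
    l = solve-∀ ℚ-ring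

  -- The factors of `X` are applied to the sum first. They commute with those of `Y`, so `Y` stays
  -- recurrent and its own factors finish.
  Recurrent-+ : ∀ {X Y} → Recurrent X → Recurrent Y → Recurrent (λ k → X k + Y k)
  Recurrent-+ {X} {Y} (null z) S = Recurrent-cong (λ k → sym (trans (cong (_+ Y k) (z k)) (ℚₚ.+-identityˡ (Y k)))) S
  Recurrent-+ {X} {Y} (step c M n r) S = step c M n (Recurrent-cong
    (λ k → l (X k) (Y k) (X (k ℤ.- (ℤ.+ suc M))) (Y (k ℤ.- (ℤ.+ suc M))) c)
    (Recurrent-+ r (Recurrent-difference c (ℤ.+ suc M) S)))
    where
    l : ∀ x y x′ y′ c → x - c * x′ + (y - c * y′) ≡ x + y - c * (x′ + y′)
    l = solve-∀ ℚ-ring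

  Recurrent-* : ∀ {X} a → Recurrent X → Recurrent (λ k → a * X k)
  Recurrent-* a (null z) = null (λ k → trans (cong (a *_) (z k)) (ℚₚ.*-zeroʳ a))
  Recurrent-* {X} a (step c M n r) = step c M n (Recurrent-cong (λ k → l a (X k) (X _) c) (Recurrent-* a r))
    where
    l : ∀ a x y c → a * (x - c * y) ≡ a * x - c * (a * y)
    l = solve-∀ ℚ-ring

  Recurrent-const : ∀ a → Recurrent (λ _ → a)
  Recurrent-const a = step 1ℚ 0 1≢0 (null (λ _ → l a))
    where
    l : ∀ a → a - 1ℚ * a ≡ 0ℚ
    l = solve-∀ ℚ-ring

  -- By induction on the factors the differenced sequence vanishes everywhere. Then `X k` is a
  -- nonzero multiple of `X (k - M′)`, and zeros spread downwards.
  Recurrent-zero : ∀ {X} → Recurrent X → ∀ B → (∀ k → B ℤ.≤ k → X k ≡ 0ℚ) → ∀ k → X k ≡ 0ℚ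
  Recurrent-zero (null z) B h k = z k
  Recurrent-zero {X} (step c M c≢0 r) B h k = descend ℤ.∣ B ℤ.- k ∣ k
    (subst₂ ℤ._≤_ (e₁ B k) refl (ℤₚ.+-monoʳ-≤ k (i≤∣i∣ (B ℤ.- k))))
    where
    M′ = ℤ.+ suc M
    e₁ : ∀ B k → k ℤ.+ (B ℤ.- k) ≡ B
    e₁ = ℤSolver.solve-∀
    e₂ : ∀ k M → k ℤ.+ M ℤ.- M ≡ k
    e₂ = ℤSolver.solve-∀
    i≤∣i∣ : ∀ i → i ℤ.≤ ℤ.+ ℤ.∣ i ∣
    i≤∣i∣ (ℤ.+ n) = ℤₚ.≤-refl
    i≤∣i∣ -[1+ n ] = ℤ.-≤+
    l : ∀ c → 0ℚ - c * 0ℚ ≡ 0ℚ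
    l = solve-∀ ℚ-ring
    rec : ∀ k → X k ≡ c * X (k ℤ.- M′)
    -- The bound rises by `M′` because the difference at `k` also looks at `k - M′`.
    rec k = difference-zero (X k) (c * X (k ℤ.- M′)) (Recurrent-zero r (B ℤ.+ M′)
      (λ k p → trans (cong₂ (λ a b → a - c * b)
          (h k (ℤₚ.≤-trans (ℤₚ.i≤i+j B M′) p))
          (h (k ℤ.- M′) (subst (ℤ._≤ k ℤ.- M′) (e₂ B M′) (ℤₚ.+-monoˡ-≤ (ℤ.- M′) p)))) (l c)) k)
    descend : ∀ n k → B ℤ.≤ k ℤ.+ (ℤ.+ n) → X k ≡ 0ℚ
    descend zero k p = h k (subst (B ℤ.≤_) (ℤₚ.+-identityʳ k) p)
    descend (suc n) k p = *-cancel-zero c≢0 (trans (cong (λ j → c * X j) (sym (e₂ k M′))) (trans (sym (rec (k ℤ.+ M′)))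
      (descend n (k ℤ.+ M′) (ℤₚ.≤-trans p (subst (k ℤ.+ (ℤ.+ suc n) ℤ.≤_) (sym (ℤₚ.+-assoc k M′ (ℤ.+ n)))
        (ℤₚ.+-monoʳ-≤ k (ℤ.+≤+ (ℕ.s≤s (ℕₚ.m≤n+m n M)))))))))

  -- Evaluation of polynomials and fractions at a rational number

  eval : Poly → ℚ → ℚ
  eval [] x = 0ℚ
  eval (a ∷ p) x = a + x * eval p x

  eval-+P : ∀ p r x → eval (p +P r) x ≡ eval p x + eval r x
  eval-+P [] r x = sym (ℚₚ.+-identityˡ (eval r x))
  eval-+P (a ∷ p) [] x = sym (ℚₚ.+-identityʳ _)
  eval-+P (a ∷ p) (b ∷ r) x = trans (cong (λ t → a + b + x * t) (eval-+P p r x)) (l a b x (eval p x) (eval r x))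
    where
    l : ∀ a b x s t → a + b + x * (s + t) ≡ a + x * s + (b + x * t)
    l = solve-∀ ℚ-ring

  eval-·P : ∀ c p x → eval (c ·P p) x ≡ c * eval p x
  eval-·P c [] x = sym (ℚₚ.*-zeroʳ c)
  eval-·P c (a ∷ p) x = trans (cong (λ t → c * a + x * t) (eval-·P c p x)) (l c a x (eval p x))
    where
    l : ∀ c a x s → c * a + x * (c * s) ≡ c * (a + x * s)
    l = solve-∀ ℚ-ring

  eval-*P : ∀ p r x → eval (p *P r) x ≡ eval p x * eval r x
  eval-*P [] r x = sym (ℚₚ.*-zeroˡ (eval r x))
  eval-*P (a ∷ p) r x = trans (eval-+P (a ·P r) (0ℚ ∷ (p *P r)) x)
    (trans (cong₂ (λ s t → s + (0ℚ + x * t)) (eval-·P a r x) (eval-*P p r x)) (l a x (eval p x) (eval r x)))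
    where
    l : ∀ a x s t → a * t + (0ℚ + x * (s * t)) ≡ (a + x * s) * t
    l = solve-∀ ℚ-ring

  eval-qⁿP : ∀ n x → eval (qⁿP n) x ≡ pow x n
  eval-qⁿP zero x = l x
    where
    l : ∀ x → 1ℚ + x * 0ℚ ≡ 1ℚ
    l = solve-∀ ℚ-ring
  eval-qⁿP (suc n) x = trans (ℚₚ.+-identityˡ _) (cong (x *_) (eval-qⁿP n x))

  eval-++ : ∀ p r x → eval (p ++ r) x ≡ eval p x + pow x (length p) * eval r x
  eval-++ [] r x = l (eval r x)
    where
    l : ∀ t → t ≡ 0ℚ + 1ℚ * t
    l = solve-∀ ℚ-ring
  eval-++ (a ∷ p) r x = trans (cong (λ t → a + x * t) (eval-++ p r x)) (l a x (eval p x) (pow x (length p)) (eval r x))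
    where
    l : ∀ a x s w t → a + x * (s + w * t) ≡ a + x * s + x * w * t
    l = solve-∀ ℚ-ring

  eval-flipP : ∀ p {x x⁻¹} → x * x⁻¹ ≡ 1ℚ → eval (flipP p) x ≡ pow x (length p) * eval p x⁻¹
  eval-flipP [] {x} e = l x
    where
    l : ∀ x → 0ℚ + x * 0ℚ ≡ 1ℚ * 0ℚ
    l = solve-∀ ℚ-ring
  eval-flipP (a ∷ p) {x} {x⁻¹} e = begin
    0ℚ + x * eval (reverse (a ∷ p)) x                        ≡⟨ cong (λ r → 0ℚ + x * eval r x) (Listₚ.unfold-reverse a p) ⟩
    0ℚ + x * eval (reverse p ++ a ∷ []) x                    ≡⟨ cong (λ t → 0ℚ + x * t) (eval-++ (reverse p) (a ∷ []) x) ⟩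
    0ℚ + x * (R + pow x (length (reverse p)) * (a + x * 0ℚ)) ≡⟨ cong (λ n → 0ℚ + x * (R + pow x n * (a + x * 0ℚ))) (Listₚ.length-reverse p) ⟩
    0ℚ + x * (R + w * (a + x * 0ℚ))                          ≡⟨ l₁ x R w a ⟩
    0ℚ + x * R + x * w * a                                   ≡⟨ cong (_+ x * w * a) (eval-flipP p e) ⟩
    w * eval p x⁻¹ + x * w * a                               ≡⟨ cong (_+ x * w * a) (trans (sym (ℚₚ.*-identityˡ (w * eval p x⁻¹))) (cong (_* (w * eval p x⁻¹)) (sym e))) ⟩
    x * x⁻¹ * (w * eval p x⁻¹) + x * w * a                   ≡⟨ l₂ x x⁻¹ w (eval p x⁻¹) a ⟩
    x * w * (a + x⁻¹ * eval p x⁻¹) ∎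
    where
    open ≡-Reasoning
    R = eval (reverse p) x
    w = pow x (length p)
    l₁ : ∀ x r w a → 0ℚ + x * (r + w * (a + x * 0ℚ)) ≡ 0ℚ + x * r + x * w * a
    l₁ = solve-∀ ℚ-ring
    l₂ : ∀ x y w t a → x * y * (w * t) + x * w * a ≡ x * w * (a + y * t)
    l₂ = solve-∀ ℚ-ring

  coeff-zero⇒All : ∀ p → (∀ n → coeff p n ≡ 0ℚ) → All (_≡ 0ℚ) p
  coeff-zero⇒All [] h = []
  coeff-zero⇒All (a ∷ p) h = h 0 ∷ coeff-zero⇒All p (h ∘ suc)

  All⇒coeff-zero : ∀ {p} → All (_≡ 0ℚ) p → ∀ n → coeff p n ≡ 0ℚ
  All⇒coeff-zero [] n = refl
  All⇒coeff-zero (e ∷ h) zero = e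
  All⇒coeff-zero (e ∷ h) (suc n) = All⇒coeff-zero h n

  eval-zero : ∀ {p} x → All (_≡ 0ℚ) p → eval p x ≡ 0ℚ
  eval-zero x [] = refl
  eval-zero x (refl ∷ h) = trans (cong (λ t → 0ℚ + x * t) (eval-zero x h)) (l x)
    where
    l : ∀ x → 0ℚ + x * 0ℚ ≡ 0ℚ
    l = solve-∀ ℚ-ring

  coeff-+P : ∀ p r n → coeff (p +P r) n ≡ coeff p n + coeff r n
  coeff-+P [] r n = sym (ℚₚ.+-identityˡ (coeff r n))
  coeff-+P (a ∷ p) [] n = sym (ℚₚ.+-identityʳ (coeff (a ∷ p) n))
  coeff-+P (a ∷ p) (b ∷ r) zero = refl
  coeff-+P (a ∷ p) (b ∷ r) (suc n) = coeff-+P p r n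

  coeff-·P : ∀ c p n → coeff (c ·P p) n ≡ c * coeff p n
  coeff-·P c [] n = sym (ℚₚ.*-zeroʳ c)
  coeff-·P c (a ∷ p) zero = refl
  coeff-·P c (a ∷ p) (suc n) = coeff-·P c p n

  _-P_ : Poly → Poly → Poly
  p -P r = p +P ((- 1ℚ) ·P r)

  coeff--P : ∀ p r n → coeff (p -P r) n ≡ coeff p n - coeff r n
  coeff--P p r n = trans (coeff-+P p ((- 1ℚ) ·P r) n) (trans (cong (coeff p n +_) (coeff-·P (- 1ℚ) r n)) (l (coeff p n) (coeff r n)))
    where
    l : ∀ a b → a + (- 1ℚ) * b ≡ a - b
    l = solve-∀ ℚ-ring

  eval--P : ∀ p r x → eval (p -P r) x ≡ eval p x - eval r x
  eval--P p r x = trans (eval-+P p ((- 1ℚ) ·P r) x) (trans (cong (eval p x +_) (eval-·P (- 1ℚ) r x)) (l (eval p x) (eval r x)))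
    where
    l : ∀ a b → a + (- 1ℚ) * b ≡ a - b
    l = solve-∀ ℚ-ring

  eval-≈P : ∀ {p r} → p ≈P r → ∀ x → eval p x ≡ eval r x
  eval-≈P {p} {r} h x = difference-zero (eval p x) (eval r x) (trans (sym (eval--P p r x))
    (eval-zero x (coeff-zero⇒All (p -P r) (λ n → trans (coeff--P p r n) (trans (cong (_- coeff r n) (h n)) (ℚₚ.+-inverseʳ (coeff r n)))))))

  -- A positive lower bound, stronger than being nonzero, carries the induction: if `p` is at least
  -- `c` in absolute value, then so is `a + x p` as soon as `x ≥ 1 + |a| / c`.
  eventually-large : ∀ p → All (_≡ 0ℚ) p ⊎
    (∃₂ λ Q c → 0ℚ ≤ Q × 0ℚ < c × (∀ x → Q ≤ x → c ≤ ∣ eval p x ∣))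
  eventually-large [] = inj₁ []
  eventually-large (a ∷ p) with eventually-large p | a ℚₚ.≟ 0ℚ
  ... | inj₁ h | yes a≡0 = inj₁ (a≡0 ∷ h)
  ... | inj₁ h | no a≢0 = inj₂ (0ℚ , ∣ a ∣ , ℚₚ.≤-refl ,
    ≺-≢⇒< false (ℚₚ.0≤∣p∣ a) (λ e → a≢0 (ℚₚ.∣p∣≡0⇒p≡0 a (sym e))) ,
    λ x _ → ℚₚ.≤-reflexive (cong ∣_∣ (sym (trans (cong (λ t → a + x * t) (eval-zero x h)) (l a x)))))
    where
    l : ∀ a x → a + x * 0ℚ ≡ a
    l = solve-∀ ℚ-ring
  ... | inj₂ (Q , c , 0≤Q , 0<c , h) | _ = inj₂ (Q′ , c , 0≤Q′ , 0<c , bound)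
    where
    c⁻¹ = proj₁ (pos-inverse 0<c)
    0<c⁻¹ = proj₁ (proj₂ (pos-inverse 0<c))
    c⁻¹c = proj₂ (proj₂ (pos-inverse 0<c))
    R = 1ℚ + c⁻¹ * ∣ a ∣
    0≤R : 0ℚ ≤ R
    0≤R = 0≺-+ false 0≤1 (0≤-* (ℚₚ.<⇒≤ 0<c⁻¹) (ℚₚ.0≤∣p∣ a))
    Q′ = Q + R
    0≤Q′ = 0≺-+ false 0≤Q 0≤R
    bound : ∀ x → Q′ ≤ x → c ≤ ∣ a + x * eval p x ∣
    bound x Q′≤x = ≺-shift false (l₃ ∣ a + x * eval p x ∣ ∣ a ∣ c) (begin
        c + ∣ a ∣                        ≡⟨ cong (c +_) (trans (sym (ℚₚ.*-identityˡ ∣ a ∣)) (cong (_* ∣ a ∣) (sym c⁻¹c))) ⟩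
        c + c⁻¹ * c * ∣ a ∣              ≡⟨ l₁ c c⁻¹ ∣ a ∣ ⟩
        R * c                            ≤⟨ ℚₚ.*-monoʳ-≤-nonNeg c {{ℚ.nonNegative (ℚₚ.<⇒≤ 0<c)}} R≤x ⟩
        x * c                            ≤⟨ ℚₚ.*-monoˡ-≤-nonNeg x {{ℚ.nonNegative 0≤x}} (h x Q≤x) ⟩
        x * ∣ eval p x ∣                 ≡⟨ cong (_* ∣ eval p x ∣) (ℚₚ.0≤p⇒∣p∣≡p 0≤x) ⟨
        ∣ x ∣ * ∣ eval p x ∣             ≡⟨ ℚₚ.∣p*q∣≡∣p∣*∣q∣ x (eval p x) ⟨
        ∣ x * eval p x ∣                 ≡⟨ cong ∣_∣ (l₂ (x * eval p x) a) ⟩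
        ∣ (a + x * eval p x) - a ∣       ≤⟨ ℚₚ.∣p-q∣≤∣p∣+∣q∣ (a + x * eval p x) a ⟩
        ∣ a + x * eval p x ∣ + ∣ a ∣     ∎)
      where
      open ℚₚ.≤-Reasoning
      l₁ : ∀ c d a → c + d * c * a ≡ (1ℚ + d * a) * c
      l₁ = solve-∀ ℚ-ring
      l₂ : ∀ y a → y ≡ (a + y) - a
      l₂ = solve-∀ ℚ-ring
      l₃ : ∀ y a c → y + a - (c + a) ≡ y - c
      l₃ = solve-∀ ℚ-ring
      Q≤x : Q ≤ x
      Q≤x = ℚₚ.≤-trans (subst (_≤ Q′) (ℚₚ.+-identityʳ Q) (ℚₚ.+-monoʳ-≤ Q 0≤R)) Q′≤x
      R≤x : R ≤ x
      R≤x = ℚₚ.≤-trans (subst (_≤ Q′) (ℚₚ.+-identityˡ R) (ℚₚ.+-monoˡ-≤ R 0≤Q)) Q′≤x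
      0≤x : 0ℚ ≤ x
      0≤x = ℚₚ.≤-trans 0≤Q Q≤x

  eventually-nonzero : ∀ p → ¬ (p ≈P []) → ∃ λ Q → 0ℚ ≤ Q × (∀ x → Q ≤ x → eval p x ≢ 0ℚ)
  eventually-nonzero p p≉0 with eventually-large p
  ... | inj₁ h = contradiction (All⇒coeff-zero h) p≉0
  ... | inj₂ (Q , c , 0≤Q , 0<c , h) = Q , 0≤Q , λ x Q≤x e →
    ℚₚ.<-irrefl refl (ℚₚ.<-≤-trans 0<c (subst (λ t → c ≤ ∣ t ∣) e (h x Q≤x)))

  vanishes⇒zero : ∀ p B → (∀ n → B ℕ.≤ n → eval p (ℕtoℚ n) ≡ 0ℚ) → All (_≡ 0ℚ) p
  vanishes⇒zero p B h with eventually-large p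
  ... | inj₁ z = z
  ... | inj₂ (Q , c , 0≤Q , 0<c , g) with archimedean Q
  ... | A , Q≤A = contradiction (subst (λ t → c ≤ ∣ t ∣) (h (A ℕ.+ B) (ℕₚ.m≤n+m B A)) (g (ℕtoℚ (A ℕ.+ B)) Q≤)) (λ q → ℚₚ.<-irrefl refl (ℚₚ.<-≤-trans 0<c q))
    where
    Q≤ : Q ≤ ℕtoℚ (A ℕ.+ B)
    Q≤ = ℚₚ.≤-trans Q≤A (subst₂ _≤_ (ℚₚ.+-identityʳ (ℕtoℚ A)) (sym (/1-+ (ℤ.+ A) (ℤ.+ B)))
      (ℚₚ.+-monoʳ-≤ (ℕtoℚ A) (0≤ℕtoℚ B)))
      where
      0≤ℕtoℚ : ∀ n → 0ℚ ≤ ℕtoℚ n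
      0≤ℕtoℚ zero = ℚₚ.≤-refl
      0≤ℕtoℚ (suc n) = ℚₚ.<⇒≤ (0<ℕtoℚ (suc n) (ℕ.s≤s ℕ.z≤n))

  -- The value is stated by cross-multiplication, like `≈F`; the regular denominator makes it
  -- unique.
  record Val (x : ℚ) (f : Frac) (v : ℚ) : Set where
    constructor val
    field
      value : eval (num f) x ≡ v * eval (den f) x
      regular : eval (den f) x ≢ 0ℚ

  Val-unique : ∀ {x f g v w} → f ≈F g → Val x f v → Val x g w → v ≡ w
  Val-unique {x} {a ⁄ b} {c ⁄ d} {v} {w} h (val e r) (val e′ r′) = difference-zero v w (*-cancel-zero (*-nonzero r r′) (begin
    B * D * (v - w)           ≡⟨ l B D v w ⟩
    v * B * D - w * D * B     ≡⟨ cong₂ (λ s t → s * D - t * B) e e′ ⟨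
    eval a x * D - eval c x * B ≡⟨ cong₂ _-_ (eval-*P a d x) (eval-*P c b x) ⟨
    eval (a *P d) x - eval (c *P b) x ≡⟨ cong (_- eval (c *P b) x) (eval-≈P {a *P d} {c *P b} h x) ⟩
    eval (c *P b) x - eval (c *P b) x ≡⟨ ℚₚ.+-inverseʳ (eval (c *P b) x) ⟩
    0ℚ ∎))
    where
    open ≡-Reasoning
    B = eval b x
    D = eval d x
    l : ∀ b d v w → b * d * (v - w) ≡ v * b * d - w * d * b
    l = solve-∀ ℚ-ring

  Val-const : ∀ x c → Val x (constF c) c
  Val-const x c = val (l c x) (λ e → 1≢0 (trans (r x) e))
    where
    l : ∀ c x → c + x * 0ℚ ≡ c * (1ℚ + x * 0ℚ)
    l = solve-∀ ℚ-ring
    r : ∀ x → 1ℚ ≡ 1ℚ + x * 0ℚ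
    r = solve-∀ ℚ-ring

  Val-+ : ∀ {x f g v w} → Val x f v → Val x g w → Val x (f +F g) (v + w)
  Val-+ {x} {a ⁄ b} {c ⁄ d} {v} {w} (val e r) (val e′ r′) = val
    (trans (eval-+P (a *P d) (c *P b) x) (trans (cong₂ _+_ (eval-*P a d x) (eval-*P c b x))
      (trans (cong₂ (λ s t → s * eval d x + t * eval b x) e e′) (trans (l v w (eval b x) (eval d x)) (cong ((v + w) *_) (sym (eval-*P b d x)))))))
    (λ z → *-nonzero r r′ (trans (sym (eval-*P b d x)) z))
    where
    l : ∀ v w b d → v * b * d + w * d * b ≡ (v + w) * (b * d)
    l = solve-∀ ℚ-ring

  Val-* : ∀ {x f g v w} → Val x f v → Val x g w → Val x (f *F g) (v * w)
  Val-* {x} {a ⁄ b} {c ⁄ d} {v} {w} (val e r) (val e′ r′) = val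
    (trans (eval-*P a c x) (trans (cong₂ _*_ e e′) (trans (l v w (eval b x) (eval d x)) (cong (v * w *_) (sym (eval-*P b d x))))))
    (λ z → *-nonzero r r′ (trans (sym (eval-*P b d x)) z))
    where
    l : ∀ v w b d → v * b * (w * d) ≡ v * w * (b * d)
    l = solve-∀ ℚ-ring

  Val-neg : ∀ {x f v} → Val x f v → Val x (-F f) (- v)
  Val-neg {x} {a ⁄ b} {v} (val e r) = val (trans (eval-·P (- 1ℚ) a x) (trans (cong ((- 1ℚ) *_) e) (l v (eval b x)))) r
    where
    l : ∀ v b → (- 1ℚ) * (v * b) ≡ - v * b
    l = solve-∀ ℚ-ring

  Val-÷ : ∀ {x f g v w w⁻¹} → Val x f v → Val x g w → w⁻¹ * w ≡ 1ℚ → Val x (f ÷F g) (v * w⁻¹)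
  Val-÷ {x} {a ⁄ b} {c ⁄ d} {v} {w} {w⁻¹} (val e r) (val e′ r′) i = val
    (begin
      eval (a *P d) x                     ≡⟨ eval-*P a d x ⟩
      eval a x * D                        ≡⟨ cong (_* D) e ⟩
      v * B * D                           ≡⟨ ℚₚ.*-identityˡ (v * B * D) ⟨
      1ℚ * (v * B * D)                    ≡⟨ cong (_* (v * B * D)) i ⟨
      w⁻¹ * w * (v * B * D)               ≡⟨ l w⁻¹ w v B D ⟩
      v * w⁻¹ * (B * (w * D))             ≡⟨ cong (λ t → v * w⁻¹ * (B * t)) e′ ⟨
      v * w⁻¹ * (B * eval c x)            ≡⟨ cong (v * w⁻¹ *_) (eval-*P b c x) ⟨
      v * w⁻¹ * eval (b *P c) x           ∎)
    (λ z → *-nonzero r (λ c≡0 → *-nonzero w≢0 r′ (trans (sym e′) c≡0)) (trans (sym (eval-*P b c x)) z))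
    where
    open ≡-Reasoning
    B = eval b x
    D = eval d x
    w≢0 : w ≢ 0ℚ
    w≢0 e = 1≢0 (trans (sym i) (trans (cong (w⁻¹ *_) e) (ℚₚ.*-zeroʳ w⁻¹)))
    l : ∀ i w v b d → i * w * (v * b * d) ≡ v * i * (b * (w * d))
    l = solve-∀ ℚ-ring

  pow-nonzero : ∀ {x} → x ≢ 0ℚ → ∀ n → pow x n ≢ 0ℚ
  pow-nonzero x≢0 zero = 1≢0
  pow-nonzero x≢0 (suc n) = *-nonzero x≢0 (pow-nonzero x≢0 n)

  -- Numerator and denominator both acquire `x` to the power `length a + length b`, which cancels.
  Val-inv-q : ∀ {x x⁻¹ f v} → x * x⁻¹ ≡ 1ℚ → Val x⁻¹ f v → Val x (inv-q f) v
  Val-inv-q {x} {x⁻¹} {a ⁄ b} {v} i (val e r) = val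
    (trans (expand a b) (trans (cong (λ t → A * t * B) e) (trans (l A B v (eval b x⁻¹)) (cong (v *_) (sym (expand b a))))))
    (λ z → *-nonzero (*-nonzero (pow-nonzero x≢0 (length b)) r) (pow-nonzero x≢0 (length a)) (trans (sym (expand b a)) z))
    where
    A = pow x (length a)
    B = pow x (length b)
    x≢0 : x ≢ 0ℚ
    x≢0 e = 1≢0 (trans (sym i) (trans (cong (_* x⁻¹) e) (ℚₚ.*-zeroˡ x⁻¹)))
    expand : ∀ p r → eval (flipP p *P qⁿP (length r)) x ≡ pow x (length p) * eval p x⁻¹ * pow x (length r)
    expand p r = trans (eval-*P (flipP p) (qⁿP (length r)) x) (cong₂ _*_ (eval-flipP p i) (eval-qⁿP (length r) x))
    l : ∀ a b v t → a * (v * t) * b ≡ v * (b * t * a)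
    l = solve-∀ ℚ-ring

  Val-qpow : ∀ {x x⁻¹} → x * x⁻¹ ≡ 1ℚ → ∀ z → Val x (qpow z) (zpow x x⁻¹ z)
  Val-qpow {x} i (ℤ.+ n) = val (trans (eval-qⁿP n x) (l (pow x n) x)) (Val.regular (Val-const x 1ℚ))
    where
    l : ∀ w x → w ≡ w * (1ℚ + x * 0ℚ)
    l = solve-∀ ℚ-ring
  Val-qpow {x} {x⁻¹} i -[1+ n ] = val
    (trans (l x) (trans (sym (inverse-pow (suc n))) (cong (pow x⁻¹ (suc n) *_) (sym (eval-qⁿP (suc n) x)))))
    (λ e → 1≢0 (trans (sym (inverse-pow (suc n))) (trans (cong (pow x⁻¹ (suc n) *_) (trans (sym (eval-qⁿP (suc n) x)) e)) (ℚₚ.*-zeroʳ (pow x⁻¹ (suc n))))))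
    where
    l : ∀ x → 1ℚ + x * 0ℚ ≡ 1ℚ
    l = solve-∀ ℚ-ring
    r : ∀ a b c d → a * b * (c * d) ≡ c * a * (b * d)
    r = solve-∀ ℚ-ring
    inverse-pow : ∀ n → pow x⁻¹ n * pow x n ≡ 1ℚ
    inverse-pow zero = refl
    inverse-pow (suc n) = trans (r x⁻¹ (pow x⁻¹ n) x (pow x n)) (cong₂ _*_ i (inverse-pow n))

  Val-[]q : ∀ {x x⁻¹ i} → x * x⁻¹ ≡ 1ℚ → i * (x - 1ℚ) ≡ 1ℚ → ∀ z → Val x [ z ]q ((zpow x x⁻¹ z - 1ℚ) * i)
  Val-[]q {x} {x⁻¹} {i} xi e z = Val-÷ {f = qpow z -F 1F} {g = qMinus1}
    (Val-+ {f = qpow z} {g = -F 1F} (Val-qpow xi z) (Val-neg {f = 1F} (Val-const x 1ℚ)))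
    (val (l x) (Val.regular (Val-const x 1ℚ))) e
    where
    l : ∀ x → - 1ℚ + x * (1ℚ + x * 0ℚ) ≡ (x - 1ℚ) * (1ℚ + x * 0ℚ)
    l = solve-∀ ℚ-ring

  Val-ehrSum : ∀ {d x x⁻¹} → x * x⁻¹ ≡ 1ℚ → ∀ (λf : Form d) L → Val x (ehrSum λf L) (sumOver (zpow x x⁻¹ ∘ evalFormℤ λf) L)
  Val-ehrSum {x = x} xi λf [] = Val-const x 0ℚ
  Val-ehrSum xi λf (m ∷ L) = Val-+ {f = qpow (evalFormℤ λf m)} {g = ehrSum λf L} (Val-qpow xi (evalFormℤ λf m)) (Val-ehrSum xi λf L)

  Values : ℚ → PolyX → Set
  Values x χ = All (λ c → ∃ λ v → Val x c v) χ

  horner : ∀ {x χ} → Values x χ → ℚ → ℚ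
  horner [] y = 0ℚ
  horner ((v , _) ∷ vs) y = v + y * horner vs y

  Val-evalX : ∀ {x χ X y} (vs : Values x χ) → Val x X y → Val x (evalX χ X) (horner vs y)
  Val-evalX {x} [] V = Val-const x 0ℚ
  Val-evalX {χ = c ∷ χ} {X} ((v , W) ∷ vs) V = Val-+ {f = c} {g = X *F evalX χ X} W (Val-* {f = X} {g = evalX χ X} V (Val-evalX vs V))

  -- The inverted coefficients at `x` have the values of the original ones at `x⁻¹`, so one function
  -- `horner vs` serves both `χ` and its inversion.
  Val-evalX-inv : ∀ {x x⁻¹ χ X y} → x * x⁻¹ ≡ 1ℚ → (vs : Values x⁻¹ χ) → Val x X y → Val x (evalX (inv-qX χ) X) (horner vs y)
  Val-evalX-inv {x} i [] V = Val-const x 0ℚ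
  Val-evalX-inv {χ = c ∷ χ} {X} i ((v , W) ∷ vs) V = Val-+ {f = inv-q c} {g = X *F evalX (inv-qX χ) X} (Val-inv-q {f = c} i W)
    (Val-* {f = X} {g = evalX (inv-qX χ) X} V (Val-evalX-inv i vs V))

  regular⇒Val : ∀ {x} f → eval (den f) x ≢ 0ℚ → ∃ λ v → Val x f v
  regular⇒Val {x} (a ⁄ b) r = eval a x * i , val (sym (begin
    eval a x * i * eval b x     ≡⟨ ℚₚ.*-assoc (eval a x) i (eval b x) ⟩
    eval a x * (i * eval b x)   ≡⟨ cong (eval a x *_) (proj₂ (inverse (eval b x) r)) ⟩
    eval a x * 1ℚ               ≡⟨ ℚₚ.*-identityʳ (eval a x) ⟩
    eval a x                    ∎)) r
    where
    open ≡-Reasoning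
    i = proj₁ (inverse (eval b x) r)

  eventually-values : ∀ χ → (∀ c → c ∈ χ → NonZeroDen c) → ∃ λ Q → 0ℚ ≤ Q × (∀ x → Q ≤ x → Values x χ)
  eventually-values [] h = 0ℚ , ℚₚ.≤-refl , λ _ _ → []
  eventually-values (c ∷ χ) h with eventually-nonzero (den c) (h c (here refl)) | eventually-values χ (λ c m → h c (there m))
  ... | Q , 0≤Q , f | R , 0≤R , g = Q + R , 0≺-+ false 0≤Q 0≤R , λ x q →
    regular⇒Val c (f x (ℚₚ.≤-trans (subst (_≤ Q + R) (ℚₚ.+-identityʳ Q) (ℚₚ.+-monoʳ-≤ Q 0≤R)) q)) ∷
    g x (ℚₚ.≤-trans (subst (_≤ Q + R) (ℚₚ.+-identityˡ R) (ℚₚ.+-monoˡ-≤ R 0≤Q)) q)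

  -- The fractions are compared at the reciprocals of large integers. Flipping the cross-multiplied
  -- difference moves its zeros from `1/n` to `n`, and a nonzero polynomial cannot vanish at all
  -- large `n`.
  ≈F-from-values : ∀ f g B → (∀ n → B ℕ.≤ n → ∃₂ λ y v → ℕtoℚ n * y ≡ 1ℚ × Val y f v × Val y g v) → f ≈F g
  ≈F-from-values f g B h n = difference-zero (coeff p n) (coeff r n) (trans (sym (coeff--P p r n))
    (All⇒coeff-zero {p -P r} (All.tabulate (λ {a} a∈ → All.lookup reversed (∈-reverse {xs = p -P r} a∈))) n))
    where
    p = num f *P den g
    r = num g *P den f
    agree : ∀ {y v} → Val y f v → Val y g v → eval (p -P r) y ≡ 0ℚ
    agree {y} {v} (val e _) (val e′ _) = trans (eval--P p r y) (trans (cong₂ _-_ (eval-*P (num f) (den g) y) (eval-*P (num g) (den f) y))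
      (trans (cong₂ (λ s t → s * eval (den g) y - t * eval (den f) y) e e′) (l v (eval (den f) y) (eval (den g) y))))
      where
      l : ∀ v b d → v * b * d - v * d * b ≡ 0ℚ
      l = solve-∀ ℚ-ring
    flipped : ∀ n → B ℕ.≤ n → eval (flipP (p -P r)) (ℕtoℚ n) ≡ 0ℚ
    flipped n q with h n q
    ... | y , v , i , V , W = begin
      eval (flipP (p -P r)) (ℕtoℚ n)                          ≡⟨ eval-flipP (p -P r) i ⟩
      pow (ℕtoℚ n) (length (p -P r)) * eval (p -P r) y        ≡⟨ cong (pow (ℕtoℚ n) (length (p -P r)) *_) (agree V W) ⟩
      pow (ℕtoℚ n) (length (p -P r)) * 0ℚ                     ≡⟨ ℚₚ.*-zeroʳ (pow (ℕtoℚ n) (length (p -P r))) ⟩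
      0ℚ                                                      ∎
      where open ≡-Reasoning
    reversed : All (_≡ 0ℚ) (reverse (p -P r))
    -- `All.tail` removes the zero that `flipP` puts in front.
    reversed = All.tail (vanishes⇒zero (flipP (p -P r)) B flipped)
    ∈-reverse : ∀ {a : ℚ} {xs} → a ∈ xs → a ∈ reverse xs
    ∈-reverse = Anyₚ.reverse⁺

  -- The sign of the dimension, and common denominators

  parity : ∀ r → (r % 2 ≡ 0 × altSign r ≡ 1ℚ) ⊎ (r % 2 ≡ 1 × altSign r ≡ - 1ℚ)
  parity 0 = inj₁ (refl , refl)
  parity 1 = inj₂ (refl , refl)
  parity (suc (suc r)) with parity r
  ... | inj₁ (e , e′) = inj₁ (e , cong (λ t → - (- t)) e′)
  ... | inj₂ (e , e′) = inj₂ (e , cong (λ t → - (- t)) e′)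

  Val-signF : ∀ x r → Val x (signF ((ℤ.+ r) ℤ.- (ℤ.+ 1))) (- altSign r)
  -- Rank 0 stands for dimension -1, whose absolute value is odd, in accordance with `- altSign 0`.
  Val-signF x zero = Val-neg {f = 1F} (Val-const x 1ℚ)
  Val-signF x (suc r) = subst (Val x (signF (ℤ.+ r))) (l (altSign r)) (even-odd (r % 2) refl (parity r))
    where
    l : ∀ a → a ≡ - (- a)
    l = solve-∀ ℚ-ring
    even-odd : ∀ m → r % 2 ≡ m → (r % 2 ≡ 0 × altSign r ≡ 1ℚ) ⊎ (r % 2 ≡ 1 × altSign r ≡ - 1ℚ) → Val x (signF (ℤ.+ r)) (altSign r)
    even-odd m _ (inj₁ (e , e′)) rewrite e′ with r % 2
    even-odd m _ (inj₁ (refl , e′)) | .0 = Val-const x 1ℚ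
    even-odd m _ (inj₂ (e , e′)) rewrite e′ with r % 2
    even-odd m _ (inj₂ (refl , e′)) | .1 = Val-neg {f = 1F} (Val-const x 1ℚ)

  ℕtoℚ-* : ∀ m n → ℕtoℚ (m ℕ.* n) ≡ ℕtoℚ m * ℕtoℚ n
  ℕtoℚ-* m n = trans (cong (_/ 1) (ℤₚ.pos-* m n)) (/1-* (ℤ.+ m) (ℤ.+ n))

  embed-scale : ∀ {d} a (x : Lat d) → embed (V.map (a ℤ.*_) x) ≡ (a / 1) • embed x
  embed-scale a [] = refl
  embed-scale a (z ∷ x) = cong₂ _∷_ (/1-* a z) (embed-scale a x)

  IsIntegral-multiple : ∀ {d} {x : Pt d} m n → IsIntegral (ℕtoℚ n • x) → IsIntegral (ℕtoℚ (m ℕ.* n) • x)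
  IsIntegral-multiple {x = x} m n (z , e) = V.map ((ℤ.+ m) ℤ.*_) z , (begin
    embed (V.map ((ℤ.+ m) ℤ.*_) z)   ≡⟨ embed-scale (ℤ.+ m) z ⟩
    ℕtoℚ m • embed z                 ≡⟨ cong (ℕtoℚ m •_) e ⟩
    ℕtoℚ m • (ℕtoℚ n • x)            ≡⟨ •-• (ℕtoℚ m) (ℕtoℚ n) x ⟩
    (ℕtoℚ m * ℕtoℚ n) • x            ≡⟨ cong (_• x) (ℕtoℚ-* m n) ⟨
    ℕtoℚ (m ℕ.* n) • x               ∎)
    where open ≡-Reasoning

  IsIntegral-∷ : ∀ {d} {q : ℚ} {x : Pt d} {c} → IsIntegral (c • (q ∷ [])) → IsIntegral (c • x) → IsIntegral (c • (q ∷ x))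
  IsIntegral-∷ (a ∷ [] , e) (z , e′) = a ∷ z , cong₂ _∷_ (proj₁ (Vₚ.∷-injective e)) e′

  denominator-clears : ∀ q → IsIntegral (ℕtoℚ (ℚ.denominatorℕ q) • (q ∷ []))
  denominator-clears q@(ℚ.mkℚ a b c) = a ∷ [] , cong (_∷ []) (begin
    a / 1                                      ≡⟨ ℚₚ.fromℚᵘ-cong {ℚᵘ.mkℚᵘ a 0} {ℚᵘ.mkℚᵘ ((ℤ.+ suc b) ℤ.* a) (b ℕ.+ 0)} (ℚᵘ.*≡* cross) ⟩
    ((ℤ.+ suc b) ℤ.* a) / suc (b ℕ.+ 0)        ≡⟨⟩
    fromℤ (ℤ.+ suc b) * q                      ≡⟨ cong (_* q) (/1≡fromℤ (ℤ.+ suc b)) ⟨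
    ℕtoℚ (suc b) * q ∎)
    where
    open ≡-Reasoning
    cross : a ℤ.* (ℤ.+ suc (b ℕ.+ 0)) ≡ (ℤ.+ suc b) ℤ.* a ℤ.* (ℤ.+ 1)
    cross = trans (cong (λ n → a ℤ.* (ℤ.+ suc n)) (ℕₚ.+-identityʳ b)) (trans (ℤₚ.*-comm a (ℤ.+ suc b)) (sym (ℤₚ.*-identityʳ _)))

  0<-* : ∀ {m n} → 0 ℕ.< m → 0 ℕ.< n → 0 ℕ.< m ℕ.* n
  0<-* {suc m} {suc n} _ _ = ℕ.s≤s ℕ.z≤n

  common-denominator : ∀ {d} (x : Pt d) → ∃ λ m → 0 ℕ.< m × IsIntegral (ℕtoℚ m • x)
  common-denominator [] = 1 , ℕ.s≤s ℕ.z≤n , [] , refl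
  common-denominator (q ∷ x) with common-denominator x
  ... | m , 0<m , I = ℚ.denominatorℕ q ℕ.* m , 0<-* {ℚ.denominatorℕ q} (ℕ.s≤s ℕ.z≤n) 0<m ,
    IsIntegral-∷ {c = ℕtoℚ (ℚ.denominatorℕ q ℕ.* m)}
      (subst (λ k → IsIntegral (ℕtoℚ k • (q ∷ []))) (ℕₚ.*-comm m (ℚ.denominatorℕ q)) (IsIntegral-multiple m (ℚ.denominatorℕ q) (denominator-clears q)))
      (IsIntegral-multiple (ℚ.denominatorℕ q) m I)

  common-denominators : ∀ {d n} (gens : Vec (Pt d) n) → ∃ λ m → 0 ℕ.< m × (∀ i → IsIntegral (ℕtoℚ m • lookup gens i))
  common-denominators [] = 1 , ℕ.s≤s ℕ.z≤n , λ ()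
  common-denominators (g ∷ gens) with common-denominator g | common-denominators gens
  ... | m , 0<m , I | n , 0<n , J = m ℕ.* n , 0<-* 0<m 0<n , λ
    { zero → subst (λ k → IsIntegral (ℕtoℚ k • g)) (ℕₚ.*-comm n m) (IsIntegral-multiple n m I)
    ; (suc i) → IsIntegral-multiple m n (J i) }

  -- The translations in `Ω-Φ` become lattice translations of height `k`, so they act on lattice
  -- points slice by slice.
  lattice-shifts : ∀ {d n} k (gens : Vec (Pt d) n) → (∀ i → IsIntegral (ℕtoℚ k • lookup gens i)) →
    ∃ λ (vs : List (Lat d)) → map (ℕtoℚ k •_) (V.toList (homogenize gens)) ≡ map (λ v → embed ((ℤ.+ k) ∷ v)) vs
  lattice-shifts k [] h = [] , refl
  lattice-shifts k (g ∷ gens) h with h zero | lattice-shifts k gens (h ∘ suc)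
  ... | v , e | vs , es = v ∷ vs , cong₂ _∷_ (cong₂ _∷_ (ℚₚ.*-identityʳ (ℕtoℚ k)) (sym e)) es

  -- Weighted lattice sums over slices

  _⊝_ : ∀ {d} → Lat d → Lat d → Lat d
  x ⊝ y = V.zipWith ℤ._-_ x y

  _⊞_ : ∀ {d} → Lat d → Lat d → Lat d
  x ⊞ y = V.zipWith ℤ._+_ x y

  negL : ∀ {d} → Lat d → Lat d
  negL = V.map (λ a → ℤ.- a)

  ⊞-⊝ : ∀ {d} (x y : Lat d) → (x ⊞ y) ⊝ y ≡ x
  ⊞-⊝ [] [] = refl
  ⊞-⊝ (a ∷ x) (b ∷ y) = cong₂ _∷_ (l a b) (⊞-⊝ x y)
    where
    l : ∀ a b → a ℤ.+ b ℤ.- b ≡ a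
    l = ℤSolver.solve-∀

  ⊝-⊞ : ∀ {d} (x y : Lat d) → (x ⊝ y) ⊞ y ≡ x
  ⊝-⊞ [] [] = refl
  ⊝-⊞ (a ∷ x) (b ∷ y) = cong₂ _∷_ (l a b) (⊝-⊞ x y)
    where
    l : ∀ a b → a ℤ.- b ℤ.+ b ≡ a
    l = ℤSolver.solve-∀

  negL-involutive : ∀ {d} (x : Lat d) → negL (negL x) ≡ x
  negL-involutive [] = refl
  negL-involutive (a ∷ x) = cong₂ _∷_ (ℤₚ.neg-involutive a) (negL-involutive x)

  embed-⊝ : ∀ {d} (x y : Lat d) → embed (x ⊝ y) ≡ embed x ⊖ embed y
  embed-⊝ [] [] = refl
  embed-⊝ (a ∷ x) (b ∷ y) = cong₂ _∷_ (/1-- a b) (embed-⊝ x y)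

  embed-negL : ∀ {d} (x : Lat d) → embed (negL x) ≡ negV (embed x)
  embed-negL [] = refl
  embed-negL (a ∷ x) = cong₂ _∷_ (/1-neg a) (embed-negL x)

  evalFormℤ-⊝ : ∀ {d} (λf : Form d) m v → evalFormℤ λf m ≡ evalFormℤ λf v ℤ.+ evalFormℤ λf (m ⊝ v)
  evalFormℤ-⊝ [] [] [] = refl
  evalFormℤ-⊝ (c ∷ λf) (a ∷ m) (b ∷ v) = trans (cong (λ t → c ℤ.* a ℤ.+ t) (evalFormℤ-⊝ λf m v))
    (l c a b (evalFormℤ λf v) (evalFormℤ λf (m ⊝ v)))
    where
    l : ∀ c a b s t → c ℤ.* a ℤ.+ (s ℤ.+ t) ≡ c ℤ.* b ℤ.+ s ℤ.+ (c ℤ.* (a ℤ.- b) ℤ.+ t)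
    l = ℤSolver.solve-∀

  evalFormℤ-neg : ∀ {d} (λf : Form d) m → evalFormℤ λf (negL m) ≡ ℤ.- evalFormℤ λf m
  evalFormℤ-neg [] [] = refl
  evalFormℤ-neg (c ∷ λf) (a ∷ m) = trans (cong (λ t → c ℤ.* (ℤ.- a) ℤ.+ t) (evalFormℤ-neg λf m)) (l c a (evalFormℤ λf m))
    where
    l : ∀ c a s → c ℤ.* (ℤ.- a) ℤ.+ ℤ.- s ≡ ℤ.- (c ℤ.* a ℤ.+ s)
    l = ℤSolver.solve-∀

  module Weighted {d : ℕ} (w w⁻¹ : ℚ) (inv : w⁻¹ * w ≡ 1ℚ) (λf : Form d) where
    open Powers w w⁻¹ inv

    weight : Lat d → ℚ
    weight m = zpow w w⁻¹ (evalFormℤ λf m)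

    weight-⊝ : ∀ m v → weight m ≡ weight v * weight (m ⊝ v)
    weight-⊝ m v = trans (cong (zpow w w⁻¹) (evalFormℤ-⊝ λf m v)) (zpow-+ (evalFormℤ λf v) (evalFormℤ λf (m ⊝ v)))

    slice : (Pt (suc d) → ℚ) → ℤ → Lat d → ℚ
    slice F t m = weight m * F (embed (t ∷ m))

    -- A translation of height `(M + 1) p` lowers the index `k` by `M + 1`, and re-indexing the
    -- slice by `v` produces the factor `weight v`. Thus each factor of `Ω` becomes one factor of
    -- the recurrence.
    slice-sums-recurrent : ∀ (p r : ℤ) M (vs : List (Lat d)) F (X : ℤ → ℚ) →
      (∀ k → HasSum (slice F (k ℤ.* p ℤ.+ r)) (X k)) →
      (∀ x → Ω (map (λ v → embed (((ℤ.+ suc M) ℤ.* p) ∷ v)) vs) F x ≡ 0ℚ) → Recurrent X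
    slice-sums-recurrent p r M [] F X S h = null (λ k → HasSum-unique (S k)
      (hasSum [] [] (λ m ne → contradiction (trans (cong (weight m *_) (h _)) (ℚₚ.*-zeroʳ (weight m))) ne) refl))
    slice-sums-recurrent p r M (v ∷ vs) F X S h = step (weight v) M (zpow-nonzero (evalFormℤ λf v))
      (slice-sums-recurrent p r M vs F′ _ S′ h)
      where
      M′ = ℤ.+ suc M
      F′ : Pt (suc d) → ℚ
      F′ x = F x - F (x ⊖ embed ((M′ ℤ.* p) ∷ v))
      e : ∀ k p r M → k ℤ.* p ℤ.+ r ℤ.- M ℤ.* p ≡ (k ℤ.- M) ℤ.* p ℤ.+ r
      e = ℤSolver.solve-∀
      l : ∀ c u a b → c * u * a - c * (u * b) ≡ c * u * (a - b)
      l = solve-∀ ℚ-ring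
      value : ∀ k m → slice F (k ℤ.* p ℤ.+ r) m - weight v * slice F ((k ℤ.- M′) ℤ.* p ℤ.+ r) (m ⊝ v) ≡ slice F′ (k ℤ.* p ℤ.+ r) m
      value k m = begin
        weight m * F y - c * (u * F y′)      ≡⟨ cong (λ t → t * F y - c * (u * F y′)) (weight-⊝ m v) ⟩
        c * u * F y - c * (u * F y′)         ≡⟨ l c u (F y) (F y′) ⟩
        c * u * (F y - F y′)                 ≡⟨ cong₂ (λ s z → s * (F y - F z)) (sym (weight-⊝ m v)) shifted ⟩
        weight m * F′ y                      ∎
        where
        open ≡-Reasoning
        c = weight v
        u = weight (m ⊝ v)
        y = embed ((k ℤ.* p ℤ.+ r) ∷ m)
        y′ = embed (((k ℤ.- M′) ℤ.* p ℤ.+ r) ∷ (m ⊝ v))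
        shifted : y′ ≡ y ⊖ embed ((M′ ℤ.* p) ∷ v)
        shifted = trans (cong (λ t → embed (t ∷ (m ⊝ v))) (sym (e k p r M′))) (embed-⊝ ((k ℤ.* p ℤ.+ r) ∷ m) ((M′ ℤ.* p) ∷ v))
      S′ : ∀ k → HasSum (slice F′ (k ℤ.* p ℤ.+ r)) (X k - weight v * X (k ℤ.- M′))
      S′ k = HasSum-cong (value k) (HasSum-- (S k) (HasSum-* (weight v)
        (HasSum-reindex (_⊞ v) (_⊝ v) (λ m → ⊞-⊝ m v) (λ m → ⊝-⊞ m v) (S (k ℤ.- M′)))))

  -- Finiteness of the slices

  intRange : ℕ → List ℤ
  intRange B = map (λ n → ℤ.+ n) (upTo (suc B)) ++ map (λ n → ℤ.- (ℤ.+ n)) (upTo (suc B))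

  ∈-intRange : ∀ B z → ℤ.∣ z ∣ ℕ.≤ B → z ∈ intRange B
  ∈-intRange B (ℤ.+ n) h = ∈-++⁺ˡ (∈-map⁺ (λ n → ℤ.+ n) (∈-upTo⁺ (ℕ.s≤s h)))
  ∈-intRange B -[1+ n ] h = ∈-++⁺ʳ (map (λ n → ℤ.+ n) (upTo (suc B))) (∈-map⁺ (λ n → ℤ.- (ℤ.+ n)) (∈-upTo⁺ (ℕ.s≤s h)))

  box : ∀ d → ℕ → List (Lat d)
  box zero B = [] ∷ []
  box (suc d) B = cartesianProductWith _∷_ (intRange B) (box d B)

  ∈-box : ∀ {d} B (m : Lat d) → (∀ i → ℤ.∣ lookup m i ∣ ℕ.≤ B) → m ∈ box d B
  ∈-box B [] h = here refl
  ∈-box B (z ∷ m) h = ∈-cartesianProductWith⁺ _∷_ (∈-intRange B z (h zero)) (∈-box B m (h ∘ suc))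

  entries-bound : ∀ {d n} (gens : Vec (Pt d) n) → ∃ λ K → 0ℚ ≤ K × (∀ j i → ∣ lookup (lookup gens j) i ∣ ≤ K)
  entries-bound [] = 0ℚ , ℚₚ.≤-refl , λ ()
  entries-bound (g ∷ gens) with entry-bound g | entries-bound gens
  ... | A , 0≤A , f | B , 0≤B , h = A + B , 0≺-+ false 0≤A 0≤B , λ
    { zero i → ℚₚ.≤-trans (f i) (subst (_≤ A + B) (ℚₚ.+-identityʳ A) (ℚₚ.+-monoʳ-≤ A 0≤B))
    ; (suc j) i → ℚₚ.≤-trans (h j i) (subst (_≤ A + B) (ℚₚ.+-identityˡ B) (ℚₚ.+-monoˡ-≤ B 0≤A)) }

  abs-≤ : ∀ {a b} → a ≤ b → - a ≤ b → ∣ a ∣ ≤ b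
  abs-≤ {a} {b} p q with ℚₚ.∣p∣≡p∨∣p∣≡-p a
  ... | inj₁ e = subst (_≤ b) (sym e) p
  ... | inj₂ e = subst (_≤ b) (sym e) q

  neg-≤-abs : ∀ a → - a ≤ ∣ a ∣
  neg-≤-abs a = subst (- a ≤_) (ℚₚ.∣-p∣≡∣p∣ a) (≤-abs (- a))

  Cone-≤ : ∀ {D n} (f g : Lin D) (us : Vec (Pt D) n) → (∀ i → ap f (lookup us i) ≤ ap g (lookup us i)) →
    ∀ {x} → Cone us x → ap f x ≤ ap g x
  Cone-≤ f g us h {x} c = ≺-shift false (r (ap f x) (ap g x)) (Cone-nonneg (subL g f) us
    (λ i → ≺-shift false (sym (r (ap f (lookup us i)) (ap g (lookup us i)))) (h i)) c)
    where
    r : ∀ a b → b - a - 0ℚ ≡ b - a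
    r = solve-∀ ℚ-ring

  module Slices {d n : ℕ} (gens : Vec (Pt d) n) (N : ℚ) (C : ConeSystem N (homogenize gens)) where
    open ConeSystem C

    private
      K : ℚ
      K = proj₁ (entries-bound gens)

      0≤K : 0ℚ ≤ K
      0≤K = proj₁ (proj₂ (entries-bound gens))

      gens≤K : ∀ j i → ∣ lookup (lookup gens j) i ∣ ≤ K
      gens≤K = proj₂ (proj₂ (entries-bound gens))

    Sat-height : ∀ {x} → Sat false sys x → 0ℚ ≤ lookup x zero
    Sat-height {x} p = Cone-nonneg (coordinate zero) (homogenize gens)
      (λ j → subst (λ u → 0ℚ ≤ lookup u zero) (sym (Vₚ.lookup-map j (1ℚ ∷_) gens)) 0≤1) (to (membership x) p)

    -- The bound amounts to two linear inequalities, which need checking only at the generators;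
    -- these have height 1 and entries of absolute value at most `K`.
    Sat-entries : ∀ {x} → Sat false sys x → ∀ i → ∣ lookup x (suc i) ∣ ≤ K * lookup x zero
    Sat-entries {x} p i = abs-≤ (bound (coordinate (suc i)) (λ z → ≤-abs (lookup z i)))
      (subst (_≤ K * lookup x zero) (l (lookup x (suc i)))
        (bound (scaleL (- 1ℚ) (coordinate (suc i))) (λ z → subst (_≤ ∣ lookup z i ∣) (sym (l (lookup z i))) (neg-≤-abs (lookup z i)))))
      where
      l : ∀ a → - 1ℚ * a ≡ - a
      l = solve-∀ ℚ-ring
      bound : ∀ f → (∀ z → ap f (1ℚ ∷ z) ≤ ∣ lookup z i ∣) → ap f x ≤ K * lookup x zero
      bound f h = Cone-≤ f (scaleL K (coordinate zero)) (homogenize gens)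
        (λ j → subst (λ u → ap f u ≤ K * lookup u zero) (sym (Vₚ.lookup-map j (1ℚ ∷_) gens))
          (ℚₚ.≤-trans (h (lookup gens j)) (subst (∣ lookup (lookup gens j) i ∣ ≤_) (sym (ℚₚ.*-identityʳ K)) (gens≤K j i))))
        (to (membership x) p)

    Φ-zero : ∀ x → ¬ Sat false sys x → ¬ Sat true sys (negV x) → Φ sys (altSign rank) x ≡ 0ℚ
    Φ-zero x p q = trans (cong₂ (λ a b → a - altSign rank * b) (indicator-no (Sat? false sys x) p) (indicator-no (Sat? true sys (negV x)) q)) (l (altSign rank))
      where
      l : ∀ a → 0ℚ - a * 0ℚ ≡ 0ℚ
      l = solve-∀ ℚ-ring

    module _ (t : ℤ) where
      private
        A : ℕ
        A = proj₁ (archimedean (K * ∣ t / 1 ∣))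

      support : List (Lat d)
      support = deduplicate lat-≟ (box d A)

      support-unique : Unique support
      support-unique = DecUniqueₚ.deduplicate-! lat-≟ (box d A)

      private
        bounded : ∀ m → (∀ i → ∣ lookup (embed m) i ∣ ≤ K * ∣ t / 1 ∣) → m ∈ support
        bounded m h = ∈-deduplicate⁺ lat-≟ (∈-box A m λ i → ℤₚ.drop‿+≤+ (/1-cancel-≤
          (ℚₚ.≤-trans (ℚₚ.≤-reflexive (trans (sym (∣/1∣ (lookup m i))) (cong ∣_∣ (sym (Vₚ.lookup-map i (λ z → z / 1) m)))))
            (ℚₚ.≤-trans (h i) (proj₂ (archimedean (K * ∣ t / 1 ∣)))))))

        K-mono : ∀ {a} → a ≤ ∣ t / 1 ∣ → K * a ≤ K * ∣ t / 1 ∣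
        K-mono = ℚₚ.*-monoˡ-≤-nonNeg K {{ℚ.nonNegative 0≤K}}

      Sat⇒support : ∀ m → Sat false sys (embed (t ∷ m)) → m ∈ support
      Sat⇒support m p = bounded m (λ i → ℚₚ.≤-trans (Sat-entries p i) (K-mono (≤-abs (t / 1))))

      -- At negative `t` it is the reflected interior that contributes, which is why the box is
      -- measured by the absolute value of `t`.
      Φ⇒support : ∀ m → Φ sys (altSign rank) (embed (t ∷ m)) ≢ 0ℚ → m ∈ support
      Φ⇒support m ne with Sat? false sys (embed (t ∷ m)) in eq
      ... | yes p = Sat⇒support m p
      ... | no ¬p = bounded m (λ i → ℚₚ.≤-trans
        (ℚₚ.≤-reflexive (sym (trans (cong ∣_∣ (Vₚ.lookup-map i (λ a → - a) (embed m))) (ℚₚ.∣-p∣≡∣p∣ (lookup (embed m) i)))))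
        (ℚₚ.≤-trans (Sat-entries (Sat-weaken false {sys} q) i) (K-mono (neg-≤-abs (t / 1)))))
        where
        q : Sat true sys (negV (embed (t ∷ m)))
        q with Sat? true sys (negV (embed (t ∷ m)))
        ... | yes q = q
        ... | no ¬q = contradiction (Φ-zero (embed (t ∷ m)) ¬p ¬q) ne

  -- w is a value of the variable q.
  module AtPoint {d n : ℕ} (gens : Vec (Pt d) n) (p M : ℕ) (0<p : 0 ℕ.< p)
           (integral : ∀ i → IsIntegral (ℕtoℚ (suc M ℕ.* p) • lookup gens i))
           (C : ConeSystem (ℕtoℚ (suc M ℕ.* p)) (homogenize gens))
           (w w⁻¹ : ℚ) (inv : w⁻¹ * w ≡ 1ℚ) (λf : Form d) (r : ℕ) where
    N : ℚ
    N = ℕtoℚ (suc M ℕ.* p)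
    open ConeSystem C
    open Polytope gens N C
    open Slices gens N C
    open Weighted {d} w w⁻¹ inv λf
    open Powers w w⁻¹ inv

    Φ₀ : Pt (suc d) → ℚ
    Φ₀ = Φ sys (altSign rank)

    time : ℤ → ℤ
    time k = k ℤ.* (ℤ.+ p) ℤ.+ (ℤ.+ r)

    X : ℤ → ℚ
    X k = sumOver (slice Φ₀ (time k)) (support (time k))

    X-sum : ∀ k → HasSum (slice Φ₀ (time k)) (X k)
    X-sum k = hasSum (support (time k)) (support-unique (time k))
      (λ m ne → Φ⇒support (time k) m (λ e → ne (trans (cong (weight m *_) e) (ℚₚ.*-zeroʳ (weight m))))) refl

    X-recurrent : Recurrent X
    X-recurrent = slice-sums-recurrent (ℤ.+ p) (ℤ.+ r) M vs Φ₀ X X-sum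
      (λ x → trans (cong (λ us → Ω us Φ₀ x) (sym (trans (proj₂ (lattice-shifts (suc M ℕ.* p) gens integral))
        (cong (λ t → map (λ v → embed (t ∷ v)) vs) (ℤₚ.pos-* (suc M) p))))) (Ω-Φ x))
      where
      vs = proj₁ (lattice-shifts (suc M ℕ.* p) gens integral)

    -- The cone has no points of negative height, so at positive height the reflected interior is
    -- empty and `Φ₀` is the indicator of the dilate. A positive `k` guarantees a positive height.
    X-closed : ∀ k → 0 ℕ.< k → ∃ λ L → Enumerates L (Dil (k ℕ.* p ℕ.+ r) (Conv gens)) × X (ℤ.+ k) ≡ sumOver weight L
    X-closed k 0<k = L , (uL , mem) , HasSum-unique (X-sum (ℤ.+ k)) (hasSum L uL covers total)
      where
      T = k ℕ.* p ℕ.+ r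
      0<T : 0ℚ < ℕtoℚ T
      0<T = 0<ℕtoℚ T (ℕₚ.≤-trans (0<-* 0<k 0<p) (ℕₚ.m≤m+n (k ℕ.* p) r))
      time≡ : time (ℤ.+ k) ≡ ℤ.+ T
      time≡ = cong (ℤ._+ (ℤ.+ r)) (sym (ℤₚ.pos-* k p))
      in? : ∀ m → Dec (Sat false sys (embed ((ℤ.+ T) ∷ m)))
      in? m = Sat? false sys (embed ((ℤ.+ T) ∷ m))
      L = filter in? (support (ℤ.+ T))
      uL : Unique L
      uL = Uniqueₚ.filter⁺ in? (support-unique (ℤ.+ T))
      mem : ∀ m → (m ∈ L) ⇔ Dil T (Conv gens) (embed m)
      mem m = mk⇔ (λ m∈ → to (Sat⇔Slice (embed m) 0<T) (proj₂ (∈-filter⁻ in? {xs = support (ℤ.+ T)} m∈)))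
        (λ D → let s = from (Sat⇔Slice (embed m) 0<T) D in ∈-filter⁺ in? (Sat⇒support (ℤ.+ T) m s) s)
      no-interior : ∀ m → ¬ Sat true sys (negV (embed ((ℤ.+ T) ∷ m)))
      no-interior m s = ℚₚ.<-irrefl refl (ℚₚ.<-≤-trans (ℚₚ.neg-antimono-< 0<T) (Sat-height (Sat-weaken false {sys} s)))
      l : ∀ a → 1ℚ - a * 0ℚ ≡ 1ℚ
      l = solve-∀ ℚ-ring
      value : ∀ {m} → m ∈ L → slice Φ₀ (time (ℤ.+ k)) m ≡ weight m
      value {m} m∈ = trans (cong (λ t → slice Φ₀ t m) time≡) (trans (cong (weight m *_)
        (trans (cong₂ (λ a b → a - altSign rank * b) (indicator-yes (in? m) (proj₂ (∈-filter⁻ in? {xs = support (ℤ.+ T)} m∈)))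
          (indicator-no (Sat? true sys (negV (embed ((ℤ.+ T) ∷ m)))) (no-interior m))) (l (altSign rank)))) (ℚₚ.*-identityʳ (weight m)))
      total : sumOver (slice Φ₀ (time (ℤ.+ k))) L ≡ sumOver weight L
      total = sumOver-cong L value
      covers : ∀ m → slice Φ₀ (time (ℤ.+ k)) m ≢ 0ℚ → m ∈ L
      covers m ne with in? m in eq
      ... | yes s = ∈-filter⁺ in? (Sat⇒support (ℤ.+ T) m s) s
      ... | no ¬s = contradiction (trans (cong (λ t → slice Φ₀ t m) time≡) (trans (cong (weight m *_)
        (Φ-zero (embed ((ℤ.+ T) ∷ m)) ¬s (no-interior m))) (ℚₚ.*-zeroʳ (weight m)))) ne

    -- At negative height only the reflected interior is left. Replacing `m` by its negative takes
    -- it to the height `k p - r`, positive because of `r < p`, and inverts the weights.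
    X-interior : r ℕ.< p → ∀ k → 0 ℕ.< k → ∀ L → Enumerates L (RelInt (Dil (k ℕ.* p ℕ.∸ r) (Conv gens))) →
      X (ℤ.- (ℤ.+ k)) ≡ - altSign rank * sumOver (λ m → zpow w⁻¹ w (evalFormℤ λf m)) L
    X-interior r<p k 0<k L (uL , mem) = trans
      (HasSum-unique (HasSum-reindex negL negL negL-involutive negL-involutive (X-sum (ℤ.- (ℤ.+ k))))
        (hasSum {f = reflected} L uL covers refl))
      (trans (sumOver-cong L value) (sumOver-* (- altSign rank) (λ m → zpow w⁻¹ w (evalFormℤ λf m)) L))
      where
      T = k ℕ.* p ℕ.∸ r
      r<kp : r ℕ.< k ℕ.* p
      r<kp = ℕₚ.<-≤-trans r<p (ℕₚ.m≤n*m p k {{ℕ.>-nonZero 0<k}})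
      0<T : 0ℚ < ℕtoℚ T
      0<T = 0<ℕtoℚ T (ℕₚ.m<n⇒0<n∸m r<kp)
      reflected : Lat d → ℚ
      reflected m = slice Φ₀ (time (ℤ.- (ℤ.+ k))) (negL m)
      time≡ : time (ℤ.- (ℤ.+ k)) ≡ ℤ.- (ℤ.+ T)
      time≡ = trans (e (ℤ.+ k) (ℤ.+ p) (ℤ.+ r)) (cong ℤ.-_ (trans (cong (ℤ._- (ℤ.+ r)) (sym (ℤₚ.pos-* k p)))
        (trans (ℤₚ.m-n≡m⊖n (k ℕ.* p) r) (ℤₚ.⊖-≥ (ℕₚ.<⇒≤ r<kp)))))
        where
        e : ∀ k p r → ℤ.- k ℤ.* p ℤ.+ r ≡ ℤ.- (k ℤ.* p ℤ.- r)
        e = ℤSolver.solve-∀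
      point : ∀ m → embed (time (ℤ.- (ℤ.+ k)) ∷ negL m) ≡ negV (embed ((ℤ.+ T) ∷ m))
      point m = trans (cong (λ t → embed (t ∷ negL m)) time≡) (embed-negL ((ℤ.+ T) ∷ m))
      neg-point : ∀ m → negV (embed (time (ℤ.- (ℤ.+ k)) ∷ negL m)) ≡ embed ((ℤ.+ T) ∷ m)
      neg-point m = trans (sym (embed-negL (time (ℤ.- (ℤ.+ k)) ∷ negL m)))
        (cong embed (cong₂ _∷_ (trans (cong ℤ.-_ time≡) (ℤₚ.neg-involutive (ℤ.+ T))) (negL-involutive m)))
      not-closed : ∀ m → ¬ Sat false sys (embed (time (ℤ.- (ℤ.+ k)) ∷ negL m))
      not-closed m s = ℚₚ.<-irrefl refl (ℚₚ.<-≤-trans (ℚₚ.neg-antimono-< 0<T) (Sat-height (subst (Sat false sys) (point m) s)))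
      interior : ∀ m → (m ∈ L) ⇔ Sat true sys (negV (embed (time (ℤ.- (ℤ.+ k)) ∷ negL m)))
      interior m = mk⇔ (λ m∈ → subst (Sat true sys) (sym (neg-point m)) (RelInt⇒ T 0<T (embed m) (to (mem m) m∈)))
        (λ s → from (mem m) (RelInt⇐ T 0<T (embed m) (subst (Sat true sys) (neg-point m) s)))
      l : ∀ z a → z * (0ℚ - a * 1ℚ) ≡ - a * z
      l = solve-∀ ℚ-ring
      value : ∀ {m} → m ∈ L → reflected m ≡ - altSign rank * zpow w⁻¹ w (evalFormℤ λf m)
      value {m} m∈ = trans (cong₂ (λ z u → z * u)
          (trans (cong (zpow w w⁻¹) (evalFormℤ-neg λf m)) (sym (zpow-neg (evalFormℤ λf m))))
          (cong₂ (λ a b → a - altSign rank * b) (indicator-no (Sat? false sys _) (not-closed m))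
            (indicator-yes (Sat? true sys _) (to (interior m) m∈))))
        (l (zpow w⁻¹ w (evalFormℤ λf m)) (altSign rank))
      covers : ∀ m → reflected m ≢ 0ℚ → m ∈ L
      covers m ne with Sat? true sys (negV (embed (time (ℤ.- (ℤ.+ k)) ∷ negL m))) in eq
      ... | yes s = from (interior m) s
      ... | no ¬s = contradiction (trans (cong (weight (negL m) *_) (Φ-zero (embed (time (ℤ.- (ℤ.+ k)) ∷ negL m)) (not-closed m) ¬s))
          (ℚₚ.*-zeroʳ (weight (negL m)))) ne

    module _ {χ : PolyX} (vs : Values w χ) (i : ℚ) where
      bracket : ℤ → ℚ
      bracket k = (zpow w w⁻¹ k - 1ℚ) * i

      -- `bracket k` is affine in the power of `w` with exponent `k`, so Horner's scheme uses only
      -- constants, sums and products with such powers.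
      horner-recurrent : Recurrent (λ k → horner vs (bracket k))
      horner-recurrent = go vs
        where
        twist : ∀ {Y} → Recurrent Y → Recurrent (λ k → zpow w w⁻¹ k * Y k)
        twist (null z) = null (λ k → trans (cong (zpow w w⁻¹ k *_) (z k)) (ℚₚ.*-zeroʳ (zpow w w⁻¹ k)))
        -- Multiplication by the powers of `w` turns a factor with coefficient `c` and shift
        -- `suc M′` into one whose coefficient has the extra factor `w` to the `suc M′`, and it
        -- stays nonzero.
        twist {Y} (step c M′ c≢0 R) = step (c * zpow w w⁻¹ (ℤ.+ suc M′)) M′ (*-nonzero c≢0 (zpow-nonzero (ℤ.+ suc M′)))
          (Recurrent-cong (λ k → trans (cong (λ z → z * (Y k - c * Y (k ℤ.- (ℤ.+ suc M′)))) (split-power k (ℤ.+ suc M′)))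
            (trans (l (zpow w w⁻¹ (ℤ.+ suc M′)) (zpow w w⁻¹ (k ℤ.- (ℤ.+ suc M′))) (Y k) (Y (k ℤ.- (ℤ.+ suc M′))) c)
              (cong (λ z → z * Y k - c * zpow w w⁻¹ (ℤ.+ suc M′) * (zpow w w⁻¹ (k ℤ.- (ℤ.+ suc M′)) * Y (k ℤ.- (ℤ.+ suc M′)))) (sym (split-power k (ℤ.+ suc M′)))))) (twist R))
          where
          e : ∀ k M → M ℤ.+ (k ℤ.- M) ≡ k
          e = ℤSolver.solve-∀
          split-power : ∀ k M → zpow w w⁻¹ k ≡ zpow w w⁻¹ M * zpow w w⁻¹ (k ℤ.- M)
          split-power k M = trans (cong (zpow w w⁻¹) (sym (e k M))) (zpow-+ M (k ℤ.- M))
          l : ∀ a b y y′ c → a * b * (y - c * y′) ≡ a * b * y - c * a * (b * y′)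
          l = solve-∀ ℚ-ring
        go : ∀ {χ} (vs : Values w χ) → Recurrent (λ k → horner vs (bracket k))
        go [] = Recurrent-const 0ℚ
        go ((v , _) ∷ vs) = Recurrent-cong (λ k → l v i (zpow w w⁻¹ k) (horner vs (bracket k)))
          (Recurrent-+ (Recurrent-const v) (Recurrent-+ (Recurrent-* i (twist (go vs))) (Recurrent-* (- i) (go vs))))
          where
          l : ∀ v i z h → v + (i * (z * h) + - i * h) ≡ v + (z - 1ℚ) * i * h
          l = solve-∀ ℚ-ring

      horner≡X : (∀ k → 0 ℕ.< k → horner vs (bracket (ℤ.+ k)) ≡ X (ℤ.+ k)) → ∀ k → horner vs (bracket k) ≡ X k
      horner≡X h k = difference-zero (horner vs (bracket k)) (X k) (trans (l (horner vs (bracket k)) (X k))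
        (Recurrent-zero (Recurrent-+ horner-recurrent (Recurrent-* (- 1ℚ) X-recurrent)) (ℤ.+ 1) positive k))
        where
        l : ∀ a b → a - b ≡ a + - 1ℚ * b
        l = solve-∀ ℚ-ring
        positive : ∀ k → ℤ.+ 1 ℤ.≤ k → horner vs (bracket k) + - 1ℚ * X k ≡ 0ℚ
        positive (ℤ.+ k) (ℤ.+≤+ q) = trans (sym (l (horner vs (bracket (ℤ.+ k))) (X (ℤ.+ k))))
          (trans (cong (_- X (ℤ.+ k)) (h k q)) (ℚₚ.+-inverseʳ (X (ℤ.+ k))))

  -- Reciprocity at a point and in the field of rational functions

  altSign-square : ∀ r → altSign r * altSign r ≡ 1ℚ
  altSign-square zero = refl
  altSign-square (suc r) = trans (l (altSign r)) (altSign-square r)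
    where
    l : ∀ a → - a * - a ≡ a * a
    l = solve-∀ ℚ-ring

  homogenize-height : ∀ {d n} (gens : Vec (Pt d) n) i → 0ℚ < ap (coordinate zero) (lookup (homogenize gens) i)
  homogenize-height gens i = subst (λ u → 0ℚ < lookup u zero) (sym (Vₚ.lookup-map i (1ℚ ∷_) gens)) 0<1

  ℕtoℚ-invertible : ∀ {m n} → m ≢ n → ∃ λ i → i * (ℕtoℚ m - ℕtoℚ n) ≡ 1ℚ
  ℕtoℚ-invertible {m} {n} m≢n = inverse (ℕtoℚ m - ℕtoℚ n)
    (λ e → m≢n (ℤₚ.+-injective (/1-injective {ℤ.+ m} {ℤ.+ n} (difference-zero (ℕtoℚ m) (ℕtoℚ n) e))))

  module _ {d n : ℕ} (gens : Vec (Pt d) n) (p M : ℕ)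
           (integral : ∀ i → IsIntegral (ℕtoℚ (suc M ℕ.* p) • lookup gens i)) (λf : Form d) {δ : ℤ}
           (dim : HasDim (Conv gens) δ) (r : ℕ) (r<p : r ℕ.< p) {χ : PolyX}
           (isχ : ∀ k L → Enumerates L (Dil (k ℕ.* p ℕ.+ r) (Conv gens)) → evalX χ [ ℤ.+ k ]q ≈F ehrSum λf L)
           (k : ℕ) (0<k : 0 ℕ.< k) (L : List (Lat d))
           (enum : Enumerates L (RelInt (Dil (k ℕ.* p ℕ.∸ r) (Conv gens)))) where
    private
      N : ℚ
      N = ℕtoℚ (suc M ℕ.* p)

      C : ConeSystem N (homogenize gens)
      C = coneSystem N (coordinate zero) (homogenize gens) (homogenize-height gens)

      0<p : 0 ℕ.< p
      0<p = ℕₚ.≤-<-trans ℕ.z≤n r<p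

    open ConeSystem C using (rank)

    -- The recurrence is run at `w`, where the coefficients of `χ` are regular. Both sides are
    -- evaluated at `w⁻¹`, from where the substitution of 1/q leads back to `w`.
    reciprocity-at : ∀ {w w⁻¹ i} → w⁻¹ * w ≡ 1ℚ → i * (w - 1ℚ) ≡ 1ℚ → Values w χ →
      ∃ λ v → Val w⁻¹ (signF δ *F evalX (inv-qX χ) (inv-q [ ℤ.- (ℤ.+ k) ]q)) v × Val w⁻¹ (ehrSum λf L) v
    reciprocity-at {w} {w⁻¹} {i} w⁻¹w iw vs = S ,
      subst (Val w⁻¹ (signF δ *F evalX (inv-qX χ) (inv-q [ ℤ.- (ℤ.+ k) ]q))) value
        (Val-* {f = signF δ} {g = evalX (inv-qX χ) (inv-q [ ℤ.- (ℤ.+ k) ]q)} sign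
          (Val-evalX-inv {χ = χ} {X = inv-q [ ℤ.- (ℤ.+ k) ]q} w⁻¹w vs
            (Val-inv-q {f = [ ℤ.- (ℤ.+ k) ]q} w⁻¹w (Val-[]q ww⁻¹ iw (ℤ.- (ℤ.+ k)))))) ,
      Val-ehrSum w⁻¹w λf L
      where
      open AtPoint gens p M 0<p integral C w w⁻¹ w⁻¹w λf r using (X; X-closed; X-interior; bracket; horner≡X)
      S : ℚ
      S = sumOver (λ m → zpow w⁻¹ w (evalFormℤ λf m)) L
      ρ : ℚ
      ρ = altSign rank
      ww⁻¹ : w * w⁻¹ ≡ 1ℚ
      ww⁻¹ = trans (ℚₚ.*-comm w w⁻¹) w⁻¹w
      sign : Val w⁻¹ (signF δ) (- ρ)
      sign = subst (λ δ → Val w⁻¹ (signF δ) (- ρ)) (sym (Polytope.HasDim⇒rank gens N C dim)) (Val-signF w⁻¹ rank)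
      positive : ∀ j → 0 ℕ.< j → horner vs (bracket vs i (ℤ.+ j)) ≡ X (ℤ.+ j)
      positive j 0<j = let (L′ , enum′ , e) = X-closed j 0<j in trans
        (Val-unique {f = evalX χ [ ℤ.+ j ]q} {g = ehrSum λf L′} (isχ j L′ enum′)
          (Val-evalX {χ = χ} {X = [ ℤ.+ j ]q} vs (Val-[]q ww⁻¹ iw (ℤ.+ j))) (Val-ehrSum ww⁻¹ λf L′))
        (sym e)
      l : ∀ a s → - a * (- a * s) ≡ a * a * s
      l = solve-∀ ℚ-ring
      -- The sign of the dimension and the sign of `X` at `-k` are both `- ρ`, and `ρ` has square 1.
      value : - ρ * horner vs (bracket vs i (ℤ.- (ℤ.+ k))) ≡ S
      value = trans (cong (- ρ *_) (trans (horner≡X vs i positive (ℤ.- (ℤ.+ k))) (X-interior r<p k 0<k L enum)))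
        (trans (l ρ S) (trans (cong (_* S) (altSign-square rank)) (ℚₚ.*-identityˡ S)))

    reciprocity : (∀ c → c ∈ χ → NonZeroDen c) →
      (signF δ *F evalX (inv-qX χ) (inv-q [ ℤ.- (ℤ.+ k) ]q)) ≈F ehrSum λf L
    -- From `A` on all coefficients of `χ` are regular; the 2 makes both `w` and `w - 1` invertible.
    reciprocity regular = ≈F-from-values (signF δ *F evalX (inv-qX χ) (inv-q [ ℤ.- (ℤ.+ k) ]q)) (ehrSum λf L) (A ℕ.+ 2) at
      where
      Q = proj₁ (eventually-values χ regular)
      values : ∀ x → Q ≤ x → Values x χ
      values = proj₂ (proj₂ (eventually-values χ regular))
      A = proj₁ (archimedean Q)
      at : ∀ m → A ℕ.+ 2 ℕ.≤ m → ∃₂ λ y v → ℕtoℚ m * y ≡ 1ℚ ×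
        Val y (signF δ *F evalX (inv-qX χ) (inv-q [ ℤ.- (ℤ.+ k) ]q)) v × Val y (ehrSum λf L) v
      at m A+2≤m = w⁻¹ , proj₁ result , trans (ℚₚ.*-comm (ℕtoℚ m) w⁻¹) w⁻¹w , proj₂ result
        where
        2≤m : 2 ℕ.≤ m
        2≤m = ℕₚ.≤-trans (ℕₚ.m≤n+m 2 A) A+2≤m
        inv₀ = ℕtoℚ-invertible {m} {0} (λ e → ℕₚ.<-irrefl (sym e) (ℕₚ.≤-trans (ℕ.s≤s ℕ.z≤n) 2≤m))
        w⁻¹ = proj₁ inv₀
        w⁻¹w : w⁻¹ * ℕtoℚ m ≡ 1ℚ
        w⁻¹w = trans (cong (w⁻¹ *_) (sym (ℚₚ.+-identityʳ (ℕtoℚ m)))) (proj₂ inv₀)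
        Q≤w : Q ≤ ℕtoℚ m
        Q≤w = ℚₚ.≤-trans (proj₂ (archimedean Q)) (/1-mono-≤ (ℤ.+≤+ (ℕₚ.≤-trans (ℕₚ.m≤m+n A 2) A+2≤m)))
        inv₁ = ℕtoℚ-invertible {m} {1} (λ e → ℕₚ.<-irrefl (sym e) 2≤m)
        result = reciprocity-at {i = proj₁ inv₁} w⁻¹w (proj₂ inv₁) (values (ℕtoℚ m) Q≤w)

open import Data.Nat using (_<_; _*_; _∸_)
open import Data.Integer using (+_; -_)
open Reciprocity using (common-denominators; IsIntegral-multiple; reciprocity)

theorem1p13 : ∀ (d n : ℕ) (gens : Vec (Pt d) n) (p : ℕ) (λf : Form d) (δ : ℤ) →
    IsDenominator (Conv gens) p → GenericPositive λf (Conv gens) →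
    HasDim (Conv gens) δ →
    ∀ (r : ℕ) → r < p → ∀ (χ : PolyX) → IsChi (Conv gens) λf p r χ →
    ∀ (k : ℕ) → 0 < k → ∀ (L : List (Lat d)) →
    Enumerates L (RelInt (Dil (k * p ∸ r) (Conv gens))) →
    (signF δ *F evalX (inv-qX χ) (inv-q [ - (+ k) ]q)) ≈F ehrSum λf L
theorem1p13 d n gens p λf δ _ _ dim r r<p χ (regular , isχ) k 0<k L enum with common-denominators gens
-- The additional factor `p` makes the shifts preserve the residue of the height modulo `p`, so that
-- they act on the index `k` by `suc M`.
... | suc M , _ , integral = reciprocity gens p M
  (λ i → subst (λ m → IsIntegral (ℕtoℚ m • lookup gens i)) (ℕₚ.*-comm p (suc M)) (IsIntegral-multiple p (suc M) (integral i)))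
  λf dim r r<p isχ k 0<k L enum regular
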